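{- For every integer $n\ge 0$, the following congruences hold: \begin{align*} c\phi_{3}(3n+1) &\equiv 0 \pmod{3^2}, & c\phi_{3}(3n+2) &\equiv 0 \pmod{3^3},\\ c\phi_{3}(9n+5) &\equiv 0 \pmod{3^5}, & c\phi_{3}(9n+8) &\equiv 0 \pmod{3^7},\\ c\phi_{3}(27n+17) &\equiv 0 \pmod{3^8}, & c\phi_{3}(27n+26) &\equiv 0 \pmod{3^9},\\ c\phi_{3}(81n+44) &\equiv 0 \pmod{3^{10}}, & c\phi_{3}(81n+71) &\equiv 0 \pmod{3^{12}},\\ c\phi_{3}(243n+152) &\equiv 0 \pmod{3^{13}}, & c\phi_{3}(243n+233) &\equiv 0 \pmod{3^{14}}. \end{align*}
   Context: For a positive integer $k$, color each nonnegative integer with each of $k$ colors $1,\dots,k$, writing $a_c$ for $a$ with color $c$, and order colored integers by $0_1\prec 0_2\prec\cdots\prec 0_k\prec 1_1\prec\cdots\prec 1_k\prec 2_1\prec\cdots$. A $k$-colored generalized Frobenius partition of $n$ is a two-row array $\begin{pmatrix} a_1,\dots,a_r\\ b_1,\dots,b_r\end{pmatrix}$ of colored integers with $a_r\prec a_{r-1}\prec\cdots\prec a_1$ and $b_r\prec\cdots\prec b_1$ and $n=r+\sum_{i=1}^r(a_i+b_i)$ (the sum using the underlying integers). $c\phi_k(n)$ denotes the number of $k$-colored generalized Frobenius partitions of $n$. Equivalently, $\sum_{n\ge0}c\phi_k(n)q^n=\frac{1}{(q;q)_\infty^k}\sum_{m_1,\dots,m_{k-1}\in\mathbb{Z}}q^{\sum_i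 m_i^2+\sum_{i<j}m_im_j}$, where $(q;q)_\infty=\prod_{n\ge1}(1-q^n)$. -}

module Defs where

open import Data.Nat using (ℕ; zero; suc; _+_; _*_; _∸_; _≤ᵇ_; NonZero)
open import Data.Nat.DivMod using (_/_)
open import Data.Bool using (if_then_else_)
open import Data.List using (upTo; map)
open import Data.Nat.ListAction using (sum)

-- Encoding of k-colored integers: the colored integer a_c (a ≥ 0, 1 ≤ c ≤ k)
-- is encoded by the natural number  a * k + (c - 1).  This bijection
-- ℕ × {1..k} ≃ ℕ is order preserving for the order
--   0_1 ≺ 0_2 ≺ ... ≺ 0_k ≺ 1_1 ≺ ... ,
-- and the underlying integer of code m is  m / k.
underlying : (k : ℕ) .{{_ : NonZero k}} → ℕ → ℕ
underlying k m = m / k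

-- A strictly decreasing sequence  x_r ≺ ... ≺ x_1  of colored integers is
-- the same as a finite set of codes.  choose k b r s counts the strictly
-- decreasing sequences of length r of colored integers whose codes are all
-- < b and whose underlying integers sum to s.
choose : (k : ℕ) .{{_ : NonZero k}} → (b r s : ℕ) → ℕ
choose k zero    zero    zero    = 1
choose k zero    zero    (suc s) = 0
choose k zero    (suc r) s       = 0
choose k (suc b) zero    s       = choose k b zero s
choose k (suc b) (suc r) s       =
  choose k b (suc r) s
  + (if underlying k b ≤ᵇ s then choose k b r (s ∸ underlying k b) else 0)

Σ≤ : ℕ → (ℕ → ℕ) → ℕ
Σ≤ m f = sum (map f (upTo (suc m)))

-- cφ k n : number of k-colored generalized Frobenius partitions of n,
-- i.e. pairs of strictly decreasing sequences (a_1 ≻ ... ≻ a_r),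
-- (b_1 ≻ ... ≻ b_r) of colored integers with n = r + Σ (a_i + b_i).
-- Every entry has underlying integer ≤ n, i.e. code < k * (n + 1), so the
-- bound b = k * (n + 1) loses nothing.  We sum over r ≤ n and over the
-- split s₁ + s₂ = n - r of the weight between the two rows.
cφ : (k : ℕ) .{{_ : NonZero k}} → ℕ → ℕ
cφ k n =
  Σ≤ n λ r → Σ≤ (n ∸ r) λ s₁ →
    choose k (k * suc n) r s₁ * choose k (k * suc n) r ((n ∸ r) ∸ s₁)

{-# OPTIONS --safe #-}

-- Let E = ∏ (1 − qⁿ), E_k = E(q^k), and let Φ be the generating function of cφ₃.  Then Φ is
-- the constant term in z of H(z)³, where H(z) = ∏ (1 + z qⁿ) ∏ (1 + z⁻¹ qⁿ⁻¹).  Write H as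
-- H₀ + H₁ + H₂ by the residue mod 3 of the exponent of z.  For a primitive cube root of unity
-- ω, H(z) H(ωz) H(ω²z) = H₀³ + H₁³ + H₂³ − 3 H₀H₁H₂ is H(z³) with q³ for q, so its constant
-- term is 1/E₃ and that of H³ is 1/E₃ + 9w, with w the constant term of H₀H₁H₂.  By the
-- triple product E³w only has exponents ≡ 1 mod 3, and the 3-dissection of Jacobi's series
-- for E³ identifies it: E₁³ E₃ Φ = E₁³ + 9 q E₉³.
--
-- Put τ = q E₉³/E₁³ and t = q E₃¹²/E₁¹².  The norm q ↦ ωq applied to E³ gives
-- t = τ (1 + 9τ + 27τ²) and τ³ = t(q³) (1 + 9τ + 27τ²).  Hence extracting the exponents in a
-- residue class mod 3 turns a polynomial in t, times one of two fixed series, into another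
-- polynomial in t, times a fixed series; these polynomials are computed, and the powers of 3
-- in the theorem divide all of their coefficients.
module Submission where

open import Defs
open import Algebra.Bundles using (CommutativeRing)
import Algebra.Properties.AbelianGroup
import Algebra.Properties.Group
import Algebra.Properties.Ring
import Algebra.Properties.Semiring.Mult
import Algebra.Solver.Ring as Solver
open import Algebra.Solver.Ring.AlmostCommutativeRing using (fromCommutativeRing; _-Raw-AlmostCommutative⟶_)
open import Data.Bool.Base using (Bool; true; false; _∧_; if_then_else_)
open import Data.Bool.Properties using (T-∧; T-≡)
open import Data.Integer.Base as ℤ using (ℤ; +_; -[1+_])
import Data.Integer.Properties as ℤₚ
open import Data.List.Base using (List; []; _∷_; applyUpTo; map)
open import Data.Maybe.Base using (Maybe; just; nothing)
open import Data.Nat.Base as ℕ using (ℕ; zero; suc; z≤n; s≤s; _<_; _∸_; _≤ᵇ_; _≡ᵇ_; NonZero)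
open import Data.Nat.DivMod using (_/_; _%_; m*n/n≡m; +-distrib-/-∣ʳ; /-monoˡ-≤; m≡m%n+[m/n]*n)
open import Data.Nat.Divisibility using (divides; n∣m*n)
open import Data.Nat.ListAction using (sum)
import Data.Nat.Properties as ℕₚ
open import Data.Nat.Solver using (module +-*-Solver)
open import Data.Product using (∃; _×_; _,_; proj₁; proj₂)
open import Data.Sum using (inj₁; inj₂; _⊎_)
open import Function.Base using (_∘_)
open import Function.Bundles using (Equivalence)
open import Level using (0ℓ)
open import Relation.Binary.PropositionalEquality as ≡ using (_≡_)
open import Relation.Nullary using (yes; no)

-- H is a Laurent series in z, infinite in both directions. It is therefore replaced by finite
-- products: `H n` is z^n times the product of n factors of each kind, a polynomial in z, and each
-- statement about H becomes a congruence modulo a power of q, supplied by the q-binomial theorem.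
-- Constant terms turn into coefficients of z^n, or of z^(3n) for the cube.
--
-- No root of unity is adjoined. The product of f(z), f(ωz), f(ω²z) is the norm polynomial in the
-- three residue parts of f, and its multiplicativity is a ring identity. Applied in z it compares H
-- with its analogue for q³; applied in q it relates E, E₃ and E₉.
--
-- To find w, write 1/E₃ = F - 3w, where F is the constant term of H₀³ + H₁³ + H₂³, and multiply by
-- E³E₃. Since E³F has only exponents divisible by 3, the term -3E₃E³w must be the part of E³ itself
-- with exponents ≡ 1, which Jacobi's series gives as -3qE₉³.

Ring : Set₁
Ring = CommutativeRing 0ℓ 0ℓ

module _ {A : Set} (_+_ _*_ : A → A → A) where

  -- Built from the bare operations and not from a ring: `seriesRing` and `ringMod N` share their
  -- operations, so products of series with coefficients in either are definitionally equal.
  conv : (ℕ → A) → (ℕ → A) → ℕ → A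
  conv f g zero    = f 0 * g 0
  conv f g (suc n) = (f 0 * g (suc n)) + conv (f ∘ suc) g n

-- Integers in a commutative ring, and the ring solver over them.

module Scalars (R : Ring) where
  open CommutativeRing R
  open Algebra.Properties.Ring ring using (-‿distribˡ-*; -‿distribʳ-*)
  open Algebra.Properties.AbelianGroup +-abelianGroup using (⁻¹-∙-comm; ε⁻¹≈ε; ⁻¹-involutive)
  open Algebra.Properties.Semiring.Mult semiring using (×-homo-+; ×1-homo-*) renaming (_×_ to _·_)
  open import Relation.Binary.Reasoning.Setoid setoid

  private abstract
    κ : ℤ → Carrier
    κ (+ n)    = n · 1#
    κ -[1+ n ] = - (suc n · 1#)

    κ-neg : ∀ i → κ (ℤ.- i) ≈ - κ i
    κ-neg (+ zero)  = sym ε⁻¹≈ε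
    κ-neg (+ suc n) = refl
    κ-neg -[1+ n ]  = sym (⁻¹-involutive _)

    shuffle : ∀ a x y → (a + x) + - (a + y) ≈ x + - y
    shuffle a x y = begin
      (a + x) + - (a + y)     ≈⟨ +-cong (+-comm a x) (sym (⁻¹-∙-comm a y)) ⟩
      (x + a) + (- a + - y)   ≈⟨ +-assoc x a _ ⟩
      x + (a + (- a + - y))   ≈⟨ +-congˡ (sym (+-assoc a (- a) (- y))) ⟩
      x + ((a + - a) + - y)   ≈⟨ +-congˡ (+-congʳ (-‿inverseʳ a)) ⟩
      x + (0# + - y)          ≈⟨ +-congˡ (+-identityˡ _) ⟩
      x + - y                 ∎

    κ-⊖ : ∀ m n → κ (m ℤ.⊖ n) ≈ m · 1# + - (n · 1#)
    κ-⊖ zero    zero    = sym (-‿inverseʳ 0#)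
    κ-⊖ zero    (suc n) = sym (+-identityˡ _)
    κ-⊖ (suc m) zero    = sym (trans (+-congˡ ε⁻¹≈ε) (+-identityʳ _))
    κ-⊖ (suc m) (suc n) = begin
      κ (suc m ℤ.⊖ suc n)             ≡⟨ ≡.cong κ (ℤₚ.[1+m]⊖[1+n]≡m⊖n m n) ⟩
      κ (m ℤ.⊖ n)                     ≈⟨ κ-⊖ m n ⟩
      m · 1# + - (n · 1#)           ≈⟨ sym (shuffle 1# _ _) ⟩
      suc m · 1# + - (suc n · 1#)   ∎

    κ-+ : ∀ i j → κ (i ℤ.+ j) ≈ κ i + κ j
    κ-+ (+ m)    (+ n)    = ×-homo-+ 1# m n
    κ-+ (+ m)    -[1+ n ] = κ-⊖ m (suc n)
    κ-+ -[1+ m ] (+ n)    = trans (κ-⊖ n (suc m)) (+-comm _ _)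
    κ-+ -[1+ m ] -[1+ n ] = begin
      - (suc (suc (m ℕ.+ n)) · 1#)        ≡⟨ ≡.cong (λ k → - (k · 1#)) (≡.sym (ℕₚ.+-suc (suc m) n)) ⟩
      - ((suc m ℕ.+ suc n) · 1#)          ≈⟨ -‿cong (×-homo-+ 1# (suc m) (suc n)) ⟩
      - (suc m · 1# + suc n · 1#)         ≈⟨ sym (⁻¹-∙-comm _ _) ⟩
      - (suc m · 1#) + - (suc n · 1#)     ∎

    κ-*⁺ : ∀ m j → κ (+ m ℤ.* j) ≈ κ (+ m) * κ j
    κ-*⁺ m (+ n) = begin
      κ (+ m ℤ.* + n)     ≡⟨ ≡.cong κ (≡.sym (ℤₚ.pos-* m n)) ⟩
      (m ℕ.* n) · 1#      ≈⟨ ×1-homo-* m n ⟩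
      (m · 1#) * (n · 1#) ∎
    κ-*⁺ m -[1+ n ] = begin
      κ (+ m ℤ.* -[1+ n ])          ≡⟨ ≡.cong κ (≡.sym (ℤₚ.neg-distribʳ-* (+ m) (+ suc n))) ⟩
      κ (ℤ.- (+ m ℤ.* + suc n))     ≈⟨ κ-neg (+ m ℤ.* + suc n) ⟩
      - κ (+ m ℤ.* + suc n)         ≈⟨ -‿cong (κ-*⁺ m (+ suc n)) ⟩
      - (κ (+ m) * κ (+ suc n))     ≈⟨ -‿distribʳ-* _ _ ⟩
      κ (+ m) * κ -[1+ n ]          ∎

    κ-* : ∀ i j → κ (i ℤ.* j) ≈ κ i * κ j
    κ-* (+ m)    j = κ-*⁺ m j
    κ-* -[1+ m ] j = begin
      κ (-[1+ m ] ℤ.* j)            ≡⟨ ≡.cong κ (≡.sym (ℤₚ.neg-distribˡ-* (+ suc m) j)) ⟩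
      κ (ℤ.- (+ suc m ℤ.* j))       ≈⟨ κ-neg (+ suc m ℤ.* j) ⟩
      - κ (+ suc m ℤ.* j)           ≈⟨ -‿cong (κ-*⁺ (suc m) j) ⟩
      - (κ (+ suc m) * κ j)         ≈⟨ -‿distribˡ-* _ _ ⟩
      κ -[1+ m ] * κ j              ∎

    κ-0 : 0# ≈ κ (+ 0)
    κ-0 = refl

    κ-1 : 1# ≈ κ (+ 1)
    κ-1 = sym (+-identityʳ 1#)

    κ-suc : ∀ n → κ (+ suc n) ≈ 1# + κ (+ n)
    κ-suc n = refl

  -- κ is abstract to keep numerals from unfolding in the ring solver; only
  -- the values at 0 and 1 are exposed.
  ι : ℤ → Carrier
  ι (+ 0)           = 0#
  ι (+ 1)           = 1#
  ι (+ suc (suc n)) = κ (+ suc (suc n))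
  ι -[1+ n ]        = κ -[1+ n ]

  private
    ι≈κ : ∀ i → ι i ≈ κ i
    ι≈κ (+ 0)           = κ-0
    ι≈κ (+ 1)           = κ-1
    ι≈κ (+ suc (suc n)) = refl
    ι≈κ -[1+ n ]        = refl

  ι-+ : ∀ i j → ι (i ℤ.+ j) ≈ ι i + ι j
  ι-+ i j = trans (ι≈κ (i ℤ.+ j)) (trans (κ-+ i j) (sym (+-cong (ι≈κ i) (ι≈κ j))))

  ι-* : ∀ i j → ι (i ℤ.* j) ≈ ι i * ι j
  ι-* i j = trans (ι≈κ (i ℤ.* j)) (trans (κ-* i j) (sym (*-cong (ι≈κ i) (ι≈κ j))))

  ι-neg : ∀ i → ι (ℤ.- i) ≈ - ι i
  ι-neg i = trans (ι≈κ (ℤ.- i)) (trans (κ-neg i) (sym (-‿cong (ι≈κ i))))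

  ι-suc : ∀ n → ι (+ suc n) ≈ 1# + ι (+ n)
  ι-suc n = trans (ι≈κ (+ suc n)) (trans (κ-suc n) (sym (+-congˡ (ι≈κ (+ n)))))

  private
    ι-homomorphism : CommutativeRing.rawRing ℤₚ.+-*-commutativeRing -Raw-AlmostCommutative⟶ fromCommutativeRing R
    ι-homomorphism = record
      { ⟦_⟧ = ι ; +-homo = ι-+ ; *-homo = ι-* ; -‿homo = ι-neg ; 0-homo = refl ; 1-homo = refl }

    decide : ∀ i j → Maybe (ι i ≈ ι j)
    decide i j with i ℤₚ.≟ j
    ... | yes i≡j = just (reflexive (≡.cong ι i≡j))
    ... | no  _   = nothing

  open Solver (CommutativeRing.rawRing ℤₚ.+-*-commutativeRing) (fromCommutativeRing R) ι-homomorphism decide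
    public using (solve; con; _:=_; _:+_; _:*_; :-_; _:^_)

-- Allows two divisions: by the 3 in the dissection of E³, and by the constant term 3 of a² + ab +
-- b² when a³ = b³ is to give a = b.
3-TorsionFree : Ring → Set
3-TorsionFree R = ∀ x → ι (+ 3) * x ≈ 0# → x ≈ 0#
  where
  open CommutativeRing R
  open Scalars R

-- Formal power series over a ring, exact and truncated.

module Series (R : Ring) where

  open CommutativeRing R using () renaming
    ( Carrier to A; _≈_ to _≈ᴬ_; _+_ to _+ᴬ_; _*_ to _*ᴬ_; -_ to -ᴬ_; 0# to 0ᴬ; 1# to 1ᴬ )
  private
    module A = CommutativeRing R
    module S = Scalars R

  Seq : Set
  Seq = ℕ → A

  tail : Seq → Seq
  tail f = f ∘ suc

  infix  8 ⊖_
  infixl 6 _⊕_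
  infixl 7 _⊛_

  _⊕_ : Seq → Seq → Seq
  (f ⊕ g) n = f n +ᴬ g n

  ⊖_ : Seq → Seq
  (⊖ f) n = -ᴬ f n

  _⊛_ : Seq → Seq → Seq
  _⊛_ = conv _+ᴬ_ _*ᴬ_

  const : A → Seq
  const a zero    = a
  const a (suc n) = 0ᴬ

  0ˢ : Seq
  0ˢ n = 0ᴬ

  private
    open import Relation.Binary.Reasoning.Setoid A.setoid

    -- A coefficient of a product involves only coefficients up to its own index. With the bounds
    -- `m ≤ n` the same proof serves exact equality and equality modulo a power of `X`.
    ⊛-cong : ∀ {f f′ g g′} n → (∀ m → m ℕ.≤ n → f m ≈ᴬ f′ m) → (∀ m → m ℕ.≤ n → g m ≈ᴬ g′ m) → (f ⊛ g) n ≈ᴬ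
      (f′ ⊛ g′) n
    ⊛-cong zero    f≈ g≈ = A.*-cong (f≈ 0 z≤n) (g≈ 0 z≤n)
    ⊛-cong (suc n) f≈ g≈ = A.+-cong (A.*-cong (f≈ 0 z≤n) (g≈ (suc n) ℕₚ.≤-refl))
      (⊛-cong n (λ m m≤n → f≈ (suc m) (s≤s m≤n)) (λ m m≤n → g≈ m (ℕₚ.m≤n⇒m≤1+n m≤n)))

    ⊛-sucʳ : ∀ f g n → (f ⊛ g) (suc n) ≈ᴬ (f ⊛ tail g) n +ᴬ f (suc n) *ᴬ g 0
    ⊛-sucʳ f g zero    = A.refl
    ⊛-sucʳ f g (suc n) = A.trans (A.+-congˡ (⊛-sucʳ (tail f) g n)) (A.sym (A.+-assoc _ _ _))

    ⊛-comm : ∀ f g n → (f ⊛ g) n ≈ᴬ (g ⊛ f) n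
    ⊛-comm f g zero    = A.*-comm _ _
    ⊛-comm f g (suc n) = begin
      f 0 *ᴬ g (suc n) +ᴬ (tail f ⊛ g) n ≈⟨ A.+-cong (A.*-comm _ _) (⊛-comm (tail f) g n) ⟩
      g (suc n) *ᴬ f 0 +ᴬ (g ⊛ tail f) n ≈⟨ A.+-comm _ _ ⟩
      (g ⊛ tail f) n +ᴬ g (suc n) *ᴬ f 0 ≈⟨ A.sym (⊛-sucʳ g f n) ⟩
      (g ⊛ f) (suc n)                    ∎

    ⊛-distribʳ : ∀ f g h n → ((f ⊕ g) ⊛ h) n ≈ᴬ (f ⊛ h) n +ᴬ (g ⊛ h) n
    ⊛-distribʳ f g h zero    = A.distribʳ _ _ _
    ⊛-distribʳ f g h (suc n) = begin
      (f 0 +ᴬ g 0) *ᴬ h (suc n) +ᴬ (tail (f ⊕ g) ⊛ h) n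
        ≈⟨ A.+-congˡ (⊛-distribʳ (tail f) (tail g) h n) ⟩
      (f 0 +ᴬ g 0) *ᴬ h (suc n) +ᴬ ((tail f ⊛ h) n +ᴬ (tail g ⊛ h) n)
        ≈⟨ S.solve 5 (λ a b c u v → (a S.:+ b) S.:* c S.:+ (u S.:+ v) S.:= (a S.:* c S.:+ u) S.:+
          (b S.:* c S.:+ v)) A.refl _ _ _ _ _ ⟩
      (f ⊛ h) (suc n) +ᴬ (g ⊛ h) (suc n) ∎

    ⊛-scale : ∀ a f g n → ((λ m → a *ᴬ f m) ⊛ g) n ≈ᴬ a *ᴬ (f ⊛ g) n
    ⊛-scale a f g zero    = A.*-assoc _ _ _
    ⊛-scale a f g (suc n) = A.trans (A.+-cong (A.*-assoc _ _ _) (⊛-scale a (tail f) g n)) (A.sym (A.distribˡ _ _ _))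

    ⊛-assoc : ∀ f g h n → ((f ⊛ g) ⊛ h) n ≈ᴬ (f ⊛ (g ⊛ h)) n
    ⊛-assoc f g h zero    = A.*-assoc _ _ _
    ⊛-assoc f g h (suc n) = begin
      (f 0 *ᴬ g 0) *ᴬ h (suc n) +ᴬ (((λ m → f 0 *ᴬ tail g m) ⊕ (tail f ⊛ g)) ⊛ h) n
        ≈⟨ A.+-congˡ (⊛-distribʳ _ _ h n) ⟩
      (f 0 *ᴬ g 0) *ᴬ h (suc n) +ᴬ (((λ m → f 0 *ᴬ tail g m) ⊛ h) n +ᴬ ((tail f ⊛ g) ⊛ h) n)
        ≈⟨ A.+-congˡ (A.+-cong (⊛-scale (f 0) (tail g) h n) (⊛-assoc (tail f) g h n)) ⟩
      (f 0 *ᴬ g 0) *ᴬ h (suc n) +ᴬ (f 0 *ᴬ (tail g ⊛ h) n +ᴬ (tail f ⊛ (g ⊛ h)) n)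
        ≈⟨ S.solve 5 (λ a b c u v → (a S.:* b) S.:* c S.:+ (a S.:* u S.:+ v) S.:= a S.:*
          (b S.:* c S.:+ u) S.:+ v) A.refl _ _ _ _ _ ⟩
      f 0 *ᴬ (g ⊛ h) (suc n) +ᴬ (tail f ⊛ (g ⊛ h)) n ∎

  0⊛ : ∀ g n → (0ˢ ⊛ g) n ≈ᴬ 0ᴬ
  0⊛ g zero    = A.zeroˡ _
  0⊛ g (suc n) = A.trans (A.+-cong (A.zeroˡ _) (0⊛ g n)) (A.+-identityˡ _)

  const-⊛ : ∀ a f n → (const a ⊛ f) n ≈ᴬ a *ᴬ f n
  const-⊛ a f zero    = A.refl
  const-⊛ a f (suc n) = A.trans (A.+-congˡ (0⊛ f n)) (A.+-identityʳ _)

  infix 4 _≋_ _≋[_]_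

  -- A record, so that unification can recover `f` and `g`, which a bare function type of pointwise
  -- equations would not allow.
  record _≋_ (f g : Seq) : Set where
    constructor ext
    field at : ∀ n → f n ≈ᴬ g n
  open _≋_ public

  record _≋[_]_ (f : Seq) (N : ℕ) (g : Seq) : Set where
    constructor ext<
    field at< : ∀ n → n < N → f n ≈ᴬ g n
  open _≋[_]_ public

  seriesRing : Ring
  seriesRing = record
    { Carrier = Seq ; _≈_ = _≋_ ; _+_ = _⊕_ ; _*_ = _⊛_ ; -_ = ⊖_ ; 0# = 0ˢ ; 1# = const 1ᴬ
    ; isCommutativeRing = record
      { isRing = record
        { +-isAbelianGroup = record
          { isGroup = record
            { isMonoid = record
              { isSemigroup = record
                { isMagma = record
                  { isEquivalence = record
                    { refl  = ext λ n → A.refl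
                    ; sym   = λ p → ext λ n → A.sym (at p n)
                    ; trans = λ p q → ext λ n → A.trans (at p n) (at q n) }
                  ; ∙-cong = λ p q → ext λ n → A.+-cong (at p n) (at q n) }
                ; assoc = λ f g h → ext λ n → A.+-assoc _ _ _ }
              ; identity = (λ f → ext λ n → A.+-identityˡ _) , (λ f → ext λ n → A.+-identityʳ _) }
            ; inverse = (λ f → ext λ n → A.-‿inverseˡ _) , (λ f → ext λ n → A.-‿inverseʳ _)
            ; ⁻¹-cong = λ p → ext λ n → A.-‿cong (at p n) }
          ; comm = λ f g → ext λ n → A.+-comm _ _ }
        ; *-cong = λ p q → ext λ n → ⊛-cong n (λ m _ → at p m) (λ m _ → at q m)
        ; *-assoc = λ f g h → ext (⊛-assoc f g h)
        ; *-identity = (λ f → ext λ n → 1⊛ f n) , (λ f → ext λ n → A.trans (⊛-comm f (const 1ᴬ) n) (1⊛ f n))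
        ; distrib = (λ f g h → ext λ n → A.trans (⊛-comm f (g ⊕ h) n)
          (A.trans (⊛-distribʳ g h f n) (A.+-cong (⊛-comm g f n) (⊛-comm h f n))))
                  , (λ f g h → ext (⊛-distribʳ g h f)) }
      ; *-comm = λ f g → ext (⊛-comm f g) } }
    where
    1⊛ : ∀ f n → (const 1ᴬ ⊛ f) n ≈ᴬ f n
    1⊛ f n = A.trans (const-⊛ 1ᴬ f n) (A.*-identityˡ _)

  weaken : ∀ {f g N} → f ≋ g → f ≋[ N ] g
  weaken p = ext< λ n _ → at p n

  truncate : ∀ {f g M N} → M ℕ.≤ N → f ≋[ N ] g → f ≋[ M ] g
  truncate M≤N p = ext< λ n n<M → at< p n (ℕₚ.<-≤-trans n<M M≤N)

  -- Series modulo X^N: the operations are those of `seriesRing`, so that an equation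
  -- between series can be read in either ring.
  ringMod : ℕ → Ring
  ringMod N = record
    { Carrier = Seq ; _≈_ = _≋[ N ]_ ; _+_ = _⊕_ ; _*_ = _⊛_ ; -_ = ⊖_ ; 0# = 0ˢ ; 1# = const 1ᴬ
    ; isCommutativeRing = record
      { isRing = record
        { +-isAbelianGroup = record
          { isGroup = record
            { isMonoid = record
              { isSemigroup = record
                { isMagma = record
                  { isEquivalence = record
                    { refl  = ext< λ n _ → A.refl
                    ; sym   = λ p → ext< λ n l → A.sym (at< p n l)
                    ; trans = λ p q → ext< λ n l → A.trans (at< p n l) (at< q n l) }
                  ; ∙-cong = λ p q → ext< λ n l → A.+-cong (at< p n l) (at< q n l) }
                ; assoc = λ f g h → weaken (K.+-assoc f g h) }
              ; identity = (λ f → weaken (K.+-identityˡ f)) , (λ f → weaken (K.+-identityʳ f)) }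
            ; inverse = (λ f → weaken (K.-‿inverseˡ f)) , (λ f → weaken (K.-‿inverseʳ f))
            ; ⁻¹-cong = λ p → ext< λ n l → A.-‿cong (at< p n l) }
          ; comm = λ f g → weaken (K.+-comm f g) }
        ; *-cong = λ p q → ext< λ n l → ⊛-cong n (λ m m≤n → at< p m (ℕₚ.≤-<-trans m≤n l))
          (λ m m≤n → at< q m (ℕₚ.≤-<-trans m≤n l))
        ; *-assoc = λ f g h → weaken (K.*-assoc f g h)
        ; *-identity = (λ f → weaken (K.*-identityˡ f)) , (λ f → weaken (K.*-identityʳ f))
        ; distrib = (λ f g h → weaken (K.distribˡ f g h)) , (λ f g h → weaken (K.distribʳ f g h)) }
      ; *-comm = λ f g → weaken (K.*-comm f g) } }
    where module K = CommutativeRing seriesRing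

  private
    module K = CommutativeRing seriesRing
    module KS = Scalars seriesRing

  ⊖-0ˢ : ⊖ 0ˢ ≋ 0ˢ
  ⊖-0ˢ = ε⁻¹≈ε
    where open Algebra.Properties.AbelianGroup K.+-abelianGroup using (ε⁻¹≈ε)

  shift : Seq → Seq
  shift f zero    = 0ᴬ
  shift f (suc n) = f n

  X : Seq
  X = shift (const 1ᴬ)

  X⊛ : ∀ f → X ⊛ f ≋ shift f
  X⊛ f = ext λ { zero → A.zeroˡ _ ; (suc n) → A.trans
    (A.+-cong (A.zeroˡ _) (A.trans (const-⊛ 1ᴬ f n) (A.*-identityˡ _))) (A.+-identityˡ _) }

  const-cong : ∀ {a b} → a ≈ᴬ b → const a ≋ const b
  const-cong a≈b = ext λ { zero → a≈b ; (suc n) → A.refl }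

  const-+ : ∀ a b → const (a +ᴬ b) ≋ const a ⊕ const b
  const-+ a b = ext λ { zero → A.refl ; (suc n) → A.sym (A.+-identityˡ _) }

  const-* : ∀ a b → const (a *ᴬ b) ≋ const a ⊛ const b
  const-* a b = ext λ { zero → A.refl ; (suc n) → A.sym (A.trans (const-⊛ a (const b) (suc n)) (A.zeroʳ _)) }

  const-0 : const 0ᴬ ≋ 0ˢ
  const-0 = ext λ { zero → A.refl ; (suc n) → A.refl }

  head-tail : ∀ f → f ≋ const (f 0) ⊕ X ⊛ tail f
  head-tail f = ext λ { zero → A.sym (A.trans (A.+-congˡ (A.zeroˡ _)) (A.+-identityʳ _))
                      ; (suc n) → A.sym (A.trans (A.+-congˡ (at (X⊛ (tail f)) (suc n))) (A.+-identityˡ _)) }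

  private
    ι-const⁺ : ∀ n → KS.ι (+ n) ≋ const (S.ι (+ n))
    ι-const⁺ zero    = K.sym const-0
    ι-const⁺ (suc n) = K.trans (KS.ι-suc n) (K.trans (K.trans (K.+-congˡ (ι-const⁺ n)) (K.sym (const-+ _ _)))
      (const-cong (A.sym (S.ι-suc n))))

  ι-const : ∀ i → KS.ι i ≋ const (S.ι i)
  ι-const (+ n)    = ι-const⁺ n
  ι-const -[1+ n ] = K.trans (KS.ι-neg (+ suc n)) (K.trans (K.-‿cong (ι-const⁺ (suc n)))
    (ext λ { zero → A.sym (S.ι-neg (+ suc n)) ; (suc m) → ε⁻¹≈ε }))
    where open Algebra.Properties.AbelianGroup A.+-abelianGroup using (ε⁻¹≈ε)

  ι-⊛ : ∀ i f n → (KS.ι i ⊛ f) n ≈ᴬ S.ι i *ᴬ f n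
  ι-⊛ i f n = A.trans (at (K.*-congʳ (ι-const i)) n) (const-⊛ (S.ι i) f n)

-- 3-dissection of power series and the cubic norm.

module Dissect (R : Ring) where

  open Series R
  open CommutativeRing R using () renaming
    ( Carrier to A; _≈_ to _≈ᴬ_; _+_ to _+ᴬ_; _*_ to _*ᴬ_; -_ to -ᴬ_; 0# to 0ᴬ; 1# to 1ᴬ )
  private
    module A = CommutativeRing R
    module K = CommutativeRing seriesRing
    module KS = Scalars seriesRing

  V : Seq → Seq
  V f 0 = f 0
  V f 1 = 0ᴬ
  V f 2 = 0ᴬ
  V f (suc (suc (suc n))) = V (tail f) n

  U₀ U₁ U₂ : Seq → Seq
  U₀ f zero    = f 0
  U₀ f (suc n) = U₀ (tail (tail (tail f))) n
  U₁ f = U₀ (tail f)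
  U₂ f = U₀ (tail (tail f))

  U₀-at : ∀ f n → U₀ f n ≡ f (n ℕ.* 3)
  U₀-at f zero    = ≡.refl
  U₀-at f (suc n) = U₀-at _ n

  -- A series with prescribed parts in the three residue classes. On coefficients its parts are read
  -- off by plain recursion; `interleave-V` converts it to the form used in ring identities.
  interleave : Seq → Seq → Seq → Seq
  interleave a b c 0 = a 0
  interleave a b c 1 = b 0
  interleave a b c 2 = c 0
  interleave a b c (suc (suc (suc n))) = interleave (tail a) (tail b) (tail c) n

  V-cong< : ∀ N {f g} → f ≋[ N ] g → V f ≋[ N ℕ.* 3 ] V g
  V-cong< N p = ext< (go N (at< p))
    where
    go : ∀ N {f g} → (∀ n → n < N → f n ≈ᴬ g n) → ∀ n → n < N ℕ.* 3 → V f n ≈ᴬ V g n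
    go (suc N) p 0 l = p 0 (s≤s z≤n)
    go (suc N) p 1 l = A.refl
    go (suc N) p 2 l = A.refl
    go (suc N) p (suc (suc (suc n))) (s≤s (s≤s (s≤s l))) = go N (λ m m<N → p (suc m) (s≤s m<N)) n l

  V-cong : ∀ {f g} → f ≋ g → V f ≋ V g
  V-cong p = ext λ n → at< (V-cong< (suc n) (weaken p)) n (ℕₚ.m≤m*n (suc n) 3)

  U₀-cong< : ∀ N {f g} → f ≋[ N ℕ.* 3 ] g → U₀ f ≋[ N ] U₀ g
  U₀-cong< N {f} {g} p = ext< λ n n<N → A.trans (A.reflexive (U₀-at f n))
    (A.trans (at< p _ (ℕₚ.*-monoˡ-< 3 n<N)) (A.reflexive (≡.sym (U₀-at g n))))

  private
    3n+1<3N : ∀ {n N} → n < N → suc (suc (n ℕ.* 3)) < N ℕ.* 3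
    3n+1<3N {n} l = ℕₚ.≤-trans ℕₚ.≤-refl (ℕₚ.*-monoˡ-≤ 3 l)

  U₁-cong< : ∀ N {f g} → f ≋[ N ℕ.* 3 ] g → U₁ f ≋[ N ] U₁ g
  U₁-cong< N {f} {g} p = ext< λ n n<N → A.trans (A.reflexive (U₀-at (tail f) n))
    (A.trans (at< p _ (ℕₚ.<-trans (ℕₚ.n<1+n _) (3n+1<3N n<N))) (A.reflexive (≡.sym (U₀-at (tail g) n))))

  U₂-cong< : ∀ N {f g} → f ≋[ N ℕ.* 3 ] g → U₂ f ≋[ N ] U₂ g
  U₂-cong< N {f} {g} p = ext< λ n n<N → A.trans (A.reflexive (U₀-at (tail (tail f)) n))
    (A.trans (at< p _ (3n+1<3N n<N)) (A.reflexive (≡.sym (U₀-at (tail (tail g)) n))))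

  U₀-cong : ∀ {f g} → f ≋ g → U₀ f ≋ U₀ g
  U₀-cong p = ext λ n → at< (U₀-cong< (suc n) (weaken p)) n ℕₚ.≤-refl
  U₁-cong : ∀ {f g} → f ≋ g → U₁ f ≋ U₁ g
  U₁-cong p = ext λ n → at< (U₁-cong< (suc n) (weaken p)) n ℕₚ.≤-refl
  U₂-cong : ∀ {f g} → f ≋ g → U₂ f ≋ U₂ g
  U₂-cong p = ext λ n → at< (U₂-cong< (suc n) (weaken p)) n ℕₚ.≤-refl

  U₀-interleave : ∀ a b c → U₀ (interleave a b c) ≋ a
  U₀-interleave a b c = ext (go a b c)
    where
    go : ∀ a b c n → U₀ (interleave a b c) n ≈ᴬ a n
    go a b c zero    = A.refl
    go a b c (suc n) = go (tail a) (tail b) (tail c) n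

  U₁-interleave : ∀ a b c → U₁ (interleave a b c) ≋ b
  U₁-interleave a b c = ext (go a b c)
    where
    go : ∀ a b c n → U₁ (interleave a b c) n ≈ᴬ b n
    go a b c zero    = A.refl
    go a b c (suc n) = go (tail a) (tail b) (tail c) n

  U₂-interleave : ∀ a b c → U₂ (interleave a b c) ≋ c
  U₂-interleave a b c = ext (go a b c)
    where
    go : ∀ a b c n → U₂ (interleave a b c) n ≈ᴬ c n
    go a b c zero    = A.refl
    go a b c (suc n) = go (tail a) (tail b) (tail c) n

  V-+ : ∀ f g → V (f ⊕ g) ≋ V f ⊕ V g
  V-+ f g = ext (go f g)
    where
    go : ∀ f g n → V (f ⊕ g) n ≈ᴬ V f n +ᴬ V g n
    go f g 0 = A.refl
    go f g 1 = A.sym (A.+-identityˡ _)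
    go f g 2 = A.sym (A.+-identityˡ _)
    go f g (suc (suc (suc n))) = go (tail f) (tail g) n

  V-scale : ∀ a f n → V (λ m → a *ᴬ f m) n ≈ᴬ a *ᴬ V f n
  V-scale a f 0 = A.refl
  V-scale a f 1 = A.sym (A.zeroʳ _)
  V-scale a f 2 = A.sym (A.zeroʳ _)
  V-scale a f (suc (suc (suc n))) = V-scale a (tail f) n

  V-* : ∀ f g → V (f ⊛ g) ≋ V f ⊛ V g
  V-* f g = ext (go f g)
    where
    0*+ : ∀ x y → 0ᴬ *ᴬ x +ᴬ y ≈ᴬ y
    0*+ x y = A.trans (A.+-congʳ (A.zeroˡ x)) (A.+-identityˡ y)
    go : ∀ f g n → V (f ⊛ g) n ≈ᴬ (V f ⊛ V g) n
    go f g 0 = A.refl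
    go f g 1 = A.sym (A.trans (A.+-cong (A.zeroʳ _) (A.zeroˡ _)) (A.+-identityˡ _))
    go f g 2 = A.sym (A.trans (A.+-cong (A.zeroʳ _) (A.trans (0*+ _ _) (A.zeroˡ _))) (A.+-identityˡ _))
    go f g (suc (suc (suc n))) = A.trans
      (A.trans (at (V-+ (λ m → f 0 *ᴬ tail g m) (tail f ⊛ g)) n)
        (A.+-cong (V-scale (f 0) (tail g) n) (go (tail f) g n)))
      (A.sym (A.+-congˡ (A.trans (0*+ _ _) (0*+ _ _))))

  V-const : ∀ a → V (const a) ≋ const a
  V-const a = ext go
    where
    V-0 : ∀ n → V 0ˢ n ≈ᴬ 0ᴬ
    V-0 0 = A.refl
    V-0 1 = A.refl
    V-0 2 = A.refl
    V-0 (suc (suc (suc n))) = V-0 n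
    go : ∀ n → V (const a) n ≈ᴬ const a n
    go 0 = A.refl
    go 1 = A.refl
    go 2 = A.refl
    go (suc (suc (suc n))) = V-0 n

  V-0 : V 0ˢ ≋ 0ˢ
  V-0 = K.trans (K.sym (V-cong const-0)) (K.trans (V-const 0ᴬ) const-0)

  V-⊖ : ∀ f → V (⊖ f) ≋ ⊖ V f
  V-⊖ f = P.inverseʳ-unique (V f) (V (⊖ f)) (K.trans (K.sym (V-+ f (⊖ f))) (K.trans (V-cong (K.-‿inverseʳ f)) V-0))
    where import Algebra.Properties.Group K.+-group as P

  V-X : V X ≋ X ⊛ (X ⊛ X)
  V-X = K.sym (K.trans (X⊛ (X ⊛ X)) (ext λ { 0 → A.refl ; 1 → A.zeroˡ _ ; 2 → at (X⊛ X) 1 ; 3 → at (X⊛ X) 2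
       ; (suc (suc (suc (suc n)))) → A.trans (at (X⊛ X) (suc (suc (suc n)))) (A.sym (at (V-const 1ᴬ) (suc n))) }))

  interleave-shift : ∀ a b c → X ⊛ interleave a b c ≋ interleave (shift c) a b
  interleave-shift a b c = K.trans (X⊛ _) (ext λ { 0 → A.refl ; 1 → A.refl ; 2 → A.refl ; (suc (suc (suc n)))
    → go a b c n })
    where
    go : ∀ a b c n → interleave a b c (suc (suc n)) ≈ᴬ interleave c (tail a) (tail b) n
    go a b c 0 = A.refl
    go a b c 1 = A.refl
    go a b c 2 = A.refl
    go a b c (suc (suc (suc n))) = go (tail a) (tail b) (tail c) n

  interleave-cong : ∀ {a a′ b b′ c c′} → a ≋ a′ → b ≋ b′ → c ≋ c′ → interleave a b c ≋ interleave a′ b′ c′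
  interleave-cong p q r = ext (go (at p) (at q) (at r))
    where
    go : ∀ {a a′ b b′ c c′} → (∀ n → a n ≈ᴬ a′ n) → (∀ n → b n ≈ᴬ b′ n) → (∀ n → c n ≈ᴬ c′ n) → ∀ n
      → interleave a b c n ≈ᴬ interleave a′ b′ c′ n
    go p q r 0 = p 0
    go p q r 1 = q 0
    go p q r 2 = r 0
    go p q r (suc (suc (suc n))) = go (p ∘ suc) (q ∘ suc) (r ∘ suc) n

  interleave-V : ∀ a b c → interleave a b c ≋ V a ⊕ X ⊛ (V b ⊕ X ⊛ V c)
  interleave-V a b c = begin
    interleave a b c
      ≈⟨ ext (split a b c) ⟩
    interleave a 0ˢ 0ˢ ⊕ (interleave 0ˢ b 0ˢ ⊕ interleave 0ˢ 0ˢ c)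
      ≈⟨ K.+-congˡ (K.+-cong (K.sym (K.trans (interleave-shift b 0ˢ 0ˢ) (interleave-cong sh0 K.refl K.refl)))
           (K.sym (K.trans (K.*-congˡ (K.trans (interleave-shift c 0ˢ 0ˢ) (interleave-cong sh0 K.refl K.refl)))
             (K.trans (interleave-shift 0ˢ c 0ˢ) (interleave-cong sh0 K.refl K.refl))))) ⟩
    interleave a 0ˢ 0ˢ ⊕ (X ⊛ interleave b 0ˢ 0ˢ ⊕ X ⊛ (X ⊛ interleave c 0ˢ 0ˢ))
      ≈⟨ K.+-cong (V≋ a) (K.trans (K.sym (K.distribˡ X _ _)) (K.*-congˡ (K.+-cong (V≋ b) (K.*-congˡ (V≋ c))))) ⟩
    V a ⊕ X ⊛ (V b ⊕ X ⊛ V c) ∎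
    where
    open import Relation.Binary.Reasoning.Setoid K.setoid
    sh0 : shift 0ˢ ≋ 0ˢ
    sh0 = ext λ { zero → A.refl ; (suc n) → A.refl }
    V≋ : ∀ f → interleave f 0ˢ 0ˢ ≋ V f
    V≋ f = ext (go f)
      where
      go : ∀ f n → interleave f 0ˢ 0ˢ n ≈ᴬ V f n
      go f 0 = A.refl
      go f 1 = A.refl
      go f 2 = A.refl
      go f (suc (suc (suc n))) = go (tail f) n
    split : ∀ a b c n → interleave a b c n ≈ᴬ interleave a 0ˢ 0ˢ n +ᴬ (interleave 0ˢ b 0ˢ n +ᴬ interleave 0ˢ 0ˢ c n)
    split a b c 0 = A.sym (A.trans (A.+-congˡ (A.+-identityˡ _)) (A.+-identityʳ _))
    split a b c 1 = A.sym (A.trans (A.+-identityˡ _) (A.+-identityʳ _))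
    split a b c 2 = A.sym (A.trans (A.+-identityˡ _) (A.+-identityˡ _))
    split a b c (suc (suc (suc n))) = split (tail a) (tail b) (tail c) n

  dissect : ∀ f → f ≋ V (U₀ f) ⊕ X ⊛ (V (U₁ f) ⊕ X ⊛ V (U₂ f))
  dissect f = K.trans (ext (go f)) (interleave-V (U₀ f) (U₁ f) (U₂ f))
    where
    go : ∀ f n → f n ≈ᴬ interleave (U₀ f) (U₁ f) (U₂ f) n
    go f 0 = A.refl
    go f 1 = A.refl
    go f 2 = A.refl
    go f (suc (suc (suc n))) = go (tail (tail (tail f))) n

  -- Uniqueness of the 3-dissection. Parts of a concrete series are found by bringing it to this
  -- shape with ring identities.
  U-V : ∀ {f} a b c → f ≋ V a ⊕ X ⊛ (V b ⊕ X ⊛ V c) → (U₀ f ≋ a) × (U₁ f ≋ b) × (U₂ f ≋ c)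
  U-V a b c p =
    K.trans (U₀-cong q) (U₀-interleave a b c) , K.trans (U₁-cong q) (U₁-interleave a b c) , K.trans (U₂-cong q)
      (U₂-interleave a b c)
    where q = K.trans p (K.sym (interleave-V a b c))

  -- Residues add; a sum that reaches 3 carries a factor q³, which becomes `X` once the exponents
  -- are divided by 3.
  U-* : ∀ f g →
    (U₀ (f ⊛ g) ≋ U₀ f ⊛ U₀ g ⊕ X ⊛ (U₁ f ⊛ U₂ g ⊕ U₂ f ⊛ U₁ g)) ×
    (U₁ (f ⊛ g) ≋ U₀ f ⊛ U₁ g ⊕ U₁ f ⊛ U₀ g ⊕ X ⊛ (U₂ f ⊛ U₂ g)) ×
    (U₂ (f ⊛ g) ≋ U₀ f ⊛ U₂ g ⊕ U₁ f ⊛ U₁ g ⊕ U₂ f ⊛ U₀ g)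
  U-* f g = U-V _ _ _ (begin
    f ⊛ g
      ≈⟨ K.*-cong (dissect f) (dissect g) ⟩
    (V a ⊕ X ⊛ (V b ⊕ X ⊛ V c)) ⊛ (V a′ ⊕ X ⊛ (V b′ ⊕ X ⊛ V c′))
      ≈⟨ KS.solve 7 (λ a b c a′ b′ c′ x → let open KS in
           (a :+ x :* (b :+ x :* c)) :* (a′ :+ x :* (b′ :+ x :* c′)) :=
           (a :* a′ :+ x :* (x :* x) :* (b :* c′ :+ c :* b′)) :+ x :*
             ((a :* b′ :+ b :* a′ :+ x :* (x :* x) :* (c :* c′)) :+ x :* (a :* c′ :+ b :* b′ :+ c :* a′))) K.refl
         (V a) (V b) (V c) (V a′) (V b′) (V c′) X ⟩
    (V a ⊛ V a′ ⊕ X ⊛ (X ⊛ X) ⊛ (V b ⊛ V c′ ⊕ V c ⊛ V b′)) ⊕ X ⊛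
      ((V a ⊛ V b′ ⊕ V b ⊛ V a′ ⊕ X ⊛ (X ⊛ X) ⊛ (V c ⊛ V c′)) ⊕ X ⊛ (V a ⊛ V c′ ⊕ V b ⊛ V b′ ⊕ V c ⊛ V a′))
      ≈⟨ K.sym (K.+-cong (V2 _ _ (V-* a a′) (V-*2 V-X (V2 _ _ (V-* b c′) (V-* c b′))))
           (K.*-congˡ (K.+-cong (V2 _ _ (V2 _ _ (V-* a b′) (V-* b a′)) (V-*2 V-X (V-* c c′)))
              (K.*-congˡ (V2 _ _ (V2 _ _ (V-* a c′) (V-* b b′)) (V-* c a′)))))) ⟩
    _ ∎)
    where
    open import Relation.Binary.Reasoning.Setoid K.setoid
    a b c a′ b′ c′ : Seq
    a = U₀ f
    b = U₁ f
    c = U₂ f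
    a′ = U₀ g
    b′ = U₁ g
    c′ = U₂ g
    V2 : ∀ f g {h k} → V f ≋ h → V g ≋ k → V (f ⊕ g) ≋ h ⊕ k
    V2 f g p q = K.trans (V-+ f g) (K.+-cong p q)
    V-*2 : ∀ {f g h k} → V f ≋ h → V g ≋ k → V (f ⊛ g) ≋ h ⊛ k
    V-*2 {f} {g} p q = K.trans (V-* f g) (K.*-cong p q)

  -- The norm of a + bξ + cξ² for ξ³ = `X`, as an expanded determinant.
  norm : Seq → Seq → Seq → Seq
  norm a b c = a ⊛ a ⊛ a ⊕ X ⊛ (b ⊛ b ⊛ b) ⊕ X ⊛ (X ⊛ (c ⊛ c ⊛ c)) ⊕ ⊖ (KS.ι (+ 3) ⊛ (X ⊛ (a ⊛ b ⊛ c)))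

  norm-cong : ∀ {a a′ b b′ c c′} → a ≋ a′ → b ≋ b′ → c ≋ c′ → norm a b c ≋ norm a′ b′ c′
  norm-cong p q r = K.+-cong (K.+-cong (K.+-cong (cube p) (K.*-congˡ (cube q))) (K.*-congˡ (K.*-congˡ (cube r))))
    (K.-‿cong (K.*-congˡ (K.*-congˡ (K.*-cong (K.*-cong p q) r))))
    where
    cube : ∀ {f g} → f ≋ g → f ⊛ f ⊛ f ≋ g ⊛ g ⊛ g
    cube p = K.*-cong (K.*-cong p p) p

  -- N f (X³) = f(X) f(ωX) f(ω²X) for a primitive cube root of unity ω.
  N : Seq → Seq
  N f = norm (U₀ f) (U₁ f) (U₂ f)

  N-cong : ∀ {f g} → f ≋ g → N f ≋ N g
  N-cong p = norm-cong (U₀-cong p) (U₁-cong p) (U₂-cong p)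

  N-* : ∀ f g → N (f ⊛ g) ≋ N f ⊛ N g
  N-* f g = K.trans (norm-cong (proj₁ (U-* f g)) (proj₁ (proj₂ (U-* f g))) (proj₂ (proj₂ (U-* f g))))
    (KS.solve 7 (λ a b c a′ b′ c′ x → let open KS
                                          norm = λ a b c → a :* a :* a :+ x :* (b :* b :* b) :+ x :*
                                            (x :* (c :* c :* c)) :+ :- (con (+ 3) :* (x :* (a :* b :* c))) in
        norm (a :* a′ :+ x :* (b :* c′ :+ c :* b′)) (a :* b′ :+ b :* a′ :+ x :* (c :* c′))
          (a :* c′ :+ b :* b′ :+ c :* a′)
        := norm a b c :* norm a′ b′ c′) K.refl (U₀ f) (U₁ f) (U₂ f) (U₀ g) (U₁ g) (U₂ g) X)

  N-V : ∀ {f} a b c → f ≋ V a ⊕ X ⊛ (V b ⊕ X ⊛ V c) → N f ≋ norm a b c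
  N-V a b c p = norm-cong (proj₁ (U-V a b c p)) (proj₁ (proj₂ (U-V a b c p))) (proj₂ (proj₂ (U-V a b c p)))

  -- The exponents divisible by 3 in (a + bξ + cξ²)³ carry 6abcξ³ where the norm has -3abcξ³; the
  -- difference is the 9.
  U₀-cube : ∀ f → U₀ (f ⊛ f ⊛ f) ≋ N f ⊕ KS.ι (+ 9) ⊛ (X ⊛ (U₀ f ⊛ U₁ f ⊛ U₂ f))
  U₀-cube f = K.trans (proj₁ (U-* (f ⊛ f) f))
    (K.trans (K.+-cong (K.*-congʳ (proj₁ (U-* f f)))
        (K.*-congˡ (K.+-cong (K.*-congʳ (proj₁ (proj₂ (U-* f f)))) (K.*-congʳ (proj₂ (proj₂ (U-* f f)))))))
     (KS.solve 4 (λ a b c x → let open KS in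
        (a :* a :+ x :* (b :* c :+ c :* b)) :* a :+ x :*
          ((a :* b :+ b :* a :+ x :* (c :* c)) :* c :+ (a :* c :+ b :* b :+ c :* a) :* b)
        := (a :* a :* a :+ x :* (b :* b :* b) :+ x :* (x :* (c :* c :* c)) :+ :- (con (+ 3) :* (x :* (a :* b :* c))))
          :+ con (+ 9) :* (x :* (a :* b :* c))) K.refl (U₀ f) (U₁ f) (U₂ f) X))

-- X-adic limits and inverses.

module Adic (R : Ring) where

  open Series R
  open CommutativeRing R using () renaming
    ( Carrier to A; _≈_ to _≈ᴬ_; _+_ to _+ᴬ_; _*_ to _*ᴬ_; -_ to -ᴬ_; 0# to 0ᴬ; 1# to 1ᴬ )
  private
    module A = CommutativeRing R
    module K = CommutativeRing seriesRing
    module KS = Scalars seriesRing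
    module M (N : ℕ) = CommutativeRing (ringMod N)
  open import Algebra.Properties.Semiring.Exp K.semiring using (_^_)

  X⊛-cong< : ∀ {N f g} → f ≋[ N ] g → X ⊛ f ≋[ suc N ] X ⊛ g
  X⊛-cong< {N} {f} {g} p = M.trans (suc N) (weaken (X⊛ f))
    (M.trans (suc N) (ext< (λ { zero _ → A.refl ; (suc n) (s≤s l) → at< p n l })) (weaken (K.sym (X⊛ g))))

  X^⊛-cong< : ∀ a {N f g} → f ≋[ N ] g → X ^ a ⊛ f ≋[ a ℕ.+ N ] X ^ a ⊛ g
  X^⊛-cong< zero    {N} {f} {g} p = M.trans N (weaken (K.*-identityˡ f))
    (M.trans N p (weaken (K.sym (K.*-identityˡ g))))
  X^⊛-cong< (suc a) {N} {f} {g} p = M.trans (suc a ℕ.+ N) (weaken (K.*-assoc X _ f))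
    (M.trans (suc a ℕ.+ N) (X⊛-cong< (X^⊛-cong< a p)) (weaken (K.sym (K.*-assoc X _ g))))

  empty : ∀ {f g} → f ≋[ 0 ] g
  empty = ext< λ n ()

  X^⊛-zero : ∀ a f → X ^ a ⊛ f ≋[ a ] 0ˢ
  X^⊛-zero a f = ≡.subst (X ^ a ⊛ f ≋[_] 0ˢ) (ℕₚ.+-identityʳ a)
    (M.trans (a ℕ.+ 0) (X^⊛-cong< a (empty {f} {0ˢ})) (weaken (K.zeroʳ _)))

  X^-zero : ∀ {a N} → N ℕ.≤ a → X ^ a ≋[ N ] 0ˢ
  X^-zero {a} {N} N≤a = M.trans N (weaken (K.sym (K.*-identityʳ _))) (truncate N≤a (X^⊛-zero a (const 1ᴬ)))

  X^⊛-at : ∀ a f n → (X ^ a ⊛ f) (a ℕ.+ n) ≈ᴬ f n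
  X^⊛-at zero    f n = at (K.*-identityˡ f) n
  X^⊛-at (suc a) f n = A.trans (at (K.trans (K.*-assoc X _ f) (X⊛ _)) (suc (a ℕ.+ n))) (X^⊛-at a f n)

  -- The diagonal suffices: in a sequence that is `Cauchy` as below, coefficient n no longer changes
  -- from index n on.
  lim : (ℕ → Seq) → Seq
  lim s n = s n n

  Cauchy : (ℕ → Seq) → Set
  Cauchy s = ∀ n → s (suc n) ≋[ suc n ] s n

  Cauchy-≤ : ∀ {s} → Cauchy s → ∀ {m n} → n ℕ.≤ m → s m ≋[ suc n ] s n
  Cauchy-≤ {s} c {m} {n} n≤m = ≡.subst (λ m → s m ≋[ suc n ] s n) (ℕₚ.m∸n+n≡m n≤m) (go (m ℕ.∸ n))
    where
    go : ∀ d → s (d ℕ.+ n) ≋[ suc n ] s n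
    go zero    = M.refl (suc n)
    go (suc d) = M.trans (suc n) (truncate (s≤s (ℕₚ.m≤n+m n d)) (c (d ℕ.+ n))) (go d)

  lim-≋ : ∀ {s} → Cauchy s → ∀ n → lim s ≋[ suc n ] s n
  lim-≋ {s} c n = ext< λ k k<1+n → A.sym (at< (Cauchy-≤ c (ℕₚ.≤-pred k<1+n)) k ℕₚ.≤-refl)

  ≋-from-< : ∀ {f g} → (∀ N → f ≋[ N ] g) → f ≋ g
  ≋-from-< p = ext λ n → at< (p (suc n)) n ℕₚ.≤-refl

  module Inverse (f : Seq) (f0 : f 0 ≈ᴬ 1ᴬ) where
    private
      u : Seq
      u = const 1ᴬ ⊕ ⊖ f

      -- The constant term of `u` is 0, so each further factor contributes a power of `X`; hence the
      -- geometric series for 1/(1 - u) = 1/f converges.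
      u^ : ∀ n → u ^ n ≋[ n ] 0ˢ
      u^ zero    = empty
      u^ (suc n) = M.trans (suc n) (weaken (K.trans (K.*-congʳ (head-tail u))
        (K.trans (K.*-congʳ (K.trans (K.+-congʳ u0) (K.+-identityˡ _))) (K.*-assoc X _ _))))
        (M.trans (suc n) (X⊛-cong< (M.trans n (M.*-congˡ n (u^ n)) (M.zeroʳ n (tail u)))) (weaken (K.zeroʳ X)))
        where
        u0 : const (u 0) ≋ 0ˢ
        u0 = K.trans (const-cong (A.trans (A.+-congˡ (A.-‿cong f0)) (A.-‿inverseʳ 1ᴬ))) const-0

      geometric : ℕ → Seq
      geometric zero    = const 1ᴬ
      geometric (suc n) = geometric n ⊕ u ^ suc n

      cauchy : Cauchy geometric
      cauchy n = M.trans (suc n) (M.+-congˡ (suc n) (u^ (suc n))) (M.+-identityʳ (suc n) _)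

      f-geometric : ∀ n → f ⊛ geometric n ≋ const 1ᴬ ⊕ ⊖ (u ^ suc n)
      f-geometric zero    = KS.solve 1 (λ f → let open KS in f :* con (+ 1) := con (+ 1) :+ :-
        ((con (+ 1) :+ :- f) :^ 1)) K.refl f
      f-geometric (suc n) = K.trans (K.distribˡ f _ _) (K.trans (K.+-congʳ (f-geometric n))
        (KS.solve 2 (λ f v → let open KS in (con (+ 1) :+ :- v) :+ f :* v := con (+ 1) :+ :-
          ((con (+ 1) :+ :- f) :* v)) K.refl f (u ^ suc n)))

    inverse : Seq
    inverse = lim geometric

    inverseʳ : f ⊛ inverse ≋ const 1ᴬ
    inverseʳ = ≋-from-< λ N → truncate (ℕₚ.n≤1+n N) (M.trans (suc N) (M.*-congˡ (suc N) (lim-≋ cauchy N))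
      (M.trans (suc N) (weaken (f-geometric N)) (M.trans (suc N)
        (M.+-congˡ (suc N) (M.trans (suc N) (M.-‿cong (suc N) (u^ (suc N))) (weaken ⊖-0ˢ)))
        (M.+-identityʳ (suc N) _))))

-- q-binomial coefficients and the finite triple product, for q = `X` and q = `V X`.

module Gauss (R : Ring) (q : CommutativeRing.Carrier R) where

  open Series R
  open CommutativeRing R using () renaming
    ( Carrier to A; _≈_ to _≈ᴬ_; _+_ to _+ᴬ_; _*_ to _*ᴬ_; -_ to -ᴬ_; 0# to 0ᴬ; 1# to 1ᴬ )
  private
    module A = CommutativeRing R
    module S = Scalars R
    module K = CommutativeRing seriesRing
    module KS = Scalars seriesRing
  open import Algebra.Properties.Semiring.Exp A.semiring using (_^_; ^-homo-*)

  -- tri k b is the triangular number m(m+1)/2 of the integer m = k − b.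
  tri : ℕ → ℕ → ℕ
  tri zero    zero    = 0
  tri (suc k) zero    = suc k ℕ.+ tri k zero
  tri zero    (suc b) = b ℕ.+ tri zero b
  tri (suc k) (suc b) = tri k b

  -- The step T(m + 1) = T(m) + m + 1 at m = k - b, with b moved across to avoid subtraction.
  tri-suc : ∀ k b → tri (suc k) b ℕ.+ b ≡ tri k b ℕ.+ suc k
  tri-suc k       zero    = ≡.trans (ℕₚ.+-identityʳ _) (ℕₚ.+-comm (suc k) _)
  tri-suc zero    (suc b) = let open +-*-Solver in solve 2 (λ b t → t :+ (con 1 :+ b) := b :+ t :+ con 1) ≡.refl b
    (tri zero b)
  tri-suc (suc k) (suc b) = ≡.trans (ℕₚ.+-suc _ b) (≡.trans (≡.cong suc (tri-suc k b)) (≡.sym (ℕₚ.+-suc _ (suc k))))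

  gauss : ℕ → ℕ → A
  gauss n       zero    = 1ᴬ
  gauss zero    (suc k) = 0ᴬ
  gauss (suc n) (suc k) = gauss n k +ᴬ q ^ suc k *ᴬ gauss n (suc k)

  gauss-zero : ∀ n k → n < k → gauss n k ≈ᴬ 0ᴬ
  gauss-zero zero    (suc k) l       = A.refl
  gauss-zero (suc n) (suc k) (s≤s l) =
    A.trans (A.+-cong (gauss-zero n k l) (A.trans (A.*-congˡ (gauss-zero n (suc k) (ℕₚ.m≤n⇒m≤1+n l))) (A.zeroʳ _)))
      (A.+-identityˡ _)

  gauss-diag : ∀ n → gauss n n ≈ᴬ 1ᴬ
  gauss-diag zero    = A.refl
  gauss-diag (suc n) = A.trans (A.+-cong (gauss-diag n)
    (A.trans (A.*-congˡ (gauss-zero n (suc n) ℕₚ.≤-refl)) (A.zeroʳ _))) (A.+-identityʳ _)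

  open import Relation.Binary.Reasoning.Setoid A.setoid

  -- The second q-Pascal rule, with n = k + j. The rule built into `gauss` matches a new factor of
  -- `prodB`, this one a new factor of `prodA`.
  gauss-suc : ∀ k j → gauss (suc (k ℕ.+ j)) (suc k) ≈ᴬ gauss (k ℕ.+ j) (suc k) +ᴬ q ^ j *ᴬ gauss (k ℕ.+ j) k
  gauss-suc k zero rewrite ℕₚ.+-identityʳ k = begin
    gauss (suc k) (suc k)                     ≈⟨ gauss-diag (suc k) ⟩
    1ᴬ                                        ≈⟨ A.sym (gauss-diag k) ⟩
    gauss k k                                 ≈⟨ A.sym (A.trans (A.+-identityˡ _) (A.*-identityˡ _)) ⟩
    0ᴬ +ᴬ 1ᴬ *ᴬ gauss k k                     ≈⟨ A.+-congʳ (A.sym (gauss-zero k (suc k) ℕₚ.≤-refl)) ⟩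
    gauss k (suc k) +ᴬ 1ᴬ *ᴬ gauss k k        ∎
  gauss-suc zero (suc j) = begin
    1ᴬ +ᴬ q ^ 1 *ᴬ gauss (suc j) 1
      ≈⟨ A.+-congˡ (A.*-congˡ (gauss-suc 0 j)) ⟩
    1ᴬ +ᴬ q ^ 1 *ᴬ (gauss j 1 +ᴬ q ^ j *ᴬ 1ᴬ)
      ≈⟨ S.solve 3 (λ q g p → let open S in con (+ 1) :+ q :^ 1 :* (g :+ p :* con (+ 1)) :=
        (con (+ 1) :+ q :^ 1 :* g) :+ q :* p :* con (+ 1)) A.refl q (gauss j 1) (q ^ j) ⟩
    gauss (suc j) 1 +ᴬ q ^ suc j *ᴬ 1ᴬ ∎
  gauss-suc (suc k) (suc j) = begin
    gauss (suc (k ℕ.+ suc j)) (suc k) +ᴬ q ^ suc (suc k) *ᴬ gauss (suc (k ℕ.+ suc j)) (suc (suc k))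
      ≈⟨ A.+-cong (gauss-suc k (suc j)) (A.*-congˡ
        (A.trans (A.reflexive (≡.cong (λ n → gauss (suc n) (suc (suc k))) (ℕₚ.+-suc k j))) (gauss-suc (suc k) j))) ⟩
    (gauss (k ℕ.+ suc j) (suc k) +ᴬ q ^ suc j *ᴬ gauss (k ℕ.+ suc j) k) +ᴬ q ^ suc (suc k) *ᴬ
      (gauss (suc (k ℕ.+ j)) (suc (suc k)) +ᴬ q ^ j *ᴬ gauss (suc (k ℕ.+ j)) (suc k))
      ≡⟨ ≡.cong (λ n → (gauss (k ℕ.+ suc j) (suc k) +ᴬ q ^ suc j *ᴬ gauss (k ℕ.+ suc j) k) +ᴬ q ^ suc (suc k) *ᴬ
        (gauss n (suc (suc k)) +ᴬ q ^ j *ᴬ gauss n (suc k))) (≡.sym (ℕₚ.+-suc k j)) ⟩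
    (gauss (k ℕ.+ suc j) (suc k) +ᴬ q ^ suc j *ᴬ gauss (k ℕ.+ suc j) k) +ᴬ q ^ suc (suc k) *ᴬ
      (gauss (k ℕ.+ suc j) (suc (suc k)) +ᴬ q ^ j *ᴬ gauss (k ℕ.+ suc j) (suc k))
      ≈⟨ S.solve 6 (λ a b c q p r → let open S in
           (a :+ q :* p :* b) :+ q :* (q :* r) :* (c :+ p :* a) := (a :+ q :* (q :* r) :* c) :+ q :* p :*
             (b :+ q :* r :* a)) A.refl
           (gauss (k ℕ.+ suc j) (suc k)) (gauss (k ℕ.+ suc j) k) (gauss (k ℕ.+ suc j) (suc (suc k))) q (q ^ j)
             (q ^ k) ⟩
    gauss (suc (k ℕ.+ suc j)) (suc (suc k)) +ᴬ q ^ suc j *ᴬ gauss (suc (k ℕ.+ suc j)) (suc k) ∎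

  qfac : ℕ → A
  qfac zero    = 1ᴬ
  qfac (suc n) = qfac n *ᴬ (1ᴬ +ᴬ -ᴬ q ^ suc n)

  -- Cleared of denominators, since `qfac` need not be invertible in a general ring.
  gauss-qfac : ∀ i j → qfac i *ᴬ qfac j *ᴬ gauss (i ℕ.+ j) i ≈ᴬ qfac (i ℕ.+ j)
  gauss-qfac zero    j       = A.trans (A.*-identityʳ _) (A.*-identityˡ _)
  gauss-qfac (suc i) zero    rewrite ℕₚ.+-identityʳ i = A.trans (A.*-cong (A.*-identityʳ _) (gauss-diag (suc i)))
    (A.*-identityʳ _)
  gauss-qfac (suc i) (suc j) = begin
    qfac i *ᴬ (1ᴬ +ᴬ -ᴬ q ^ suc i) *ᴬ (qfac j *ᴬ (1ᴬ +ᴬ -ᴬ q ^ suc j)) *ᴬ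
      (gauss (i ℕ.+ suc j) i +ᴬ q ^ suc i *ᴬ gauss (i ℕ.+ suc j) (suc i))
      ≈⟨ S.solve 6 (λ I J x y g h → let open S in
            I :* (con (+ 1) :+ :- x) :* (J :* (con (+ 1) :+ :- y)) :* (g :+ x :* h) :=
            (con (+ 1) :+ :- x) :* (I :* (J :* (con (+ 1) :+ :- y)) :* g) :+ x :* (con (+ 1) :+ :- y) :*
              (I :* (con (+ 1) :+ :- x) :* J :* h)) A.refl
          (qfac i) (qfac j) (q ^ suc i) (q ^ suc j) (gauss (i ℕ.+ suc j) i) (gauss (i ℕ.+ suc j) (suc i)) ⟩
    (1ᴬ +ᴬ -ᴬ q ^ suc i) *ᴬ (qfac i *ᴬ qfac (suc j) *ᴬ gauss (i ℕ.+ suc j) i) +ᴬ q ^ suc i *ᴬ (1ᴬ +ᴬ -ᴬ q ^ suc j) *ᴬ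
      (qfac (suc i) *ᴬ qfac j *ᴬ gauss (i ℕ.+ suc j) (suc i))
      ≈⟨ A.+-cong (A.*-congˡ (gauss-qfac i (suc j)))
        (A.*-congˡ (A.trans (A.*-congˡ (A.reflexive (≡.cong (λ n → gauss n (suc i)) (ℕₚ.+-suc i j))))
           (A.trans (gauss-qfac (suc i) j) (A.reflexive (≡.cong qfac (≡.sym (ℕₚ.+-suc i j))))))) ⟩
    (1ᴬ +ᴬ -ᴬ q ^ suc i) *ᴬ qfac (i ℕ.+ suc j) +ᴬ q ^ suc i *ᴬ (1ᴬ +ᴬ -ᴬ q ^ suc j) *ᴬ qfac (i ℕ.+ suc j)
      ≈⟨ S.solve 3 (λ x y F → let open S in (con (+ 1) :+ :- x) :* F :+ x :* (con (+ 1) :+ :- y) :* F := F :*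
        (con (+ 1) :+ :- (x :* y))) A.refl (q ^ suc i) (q ^ suc j) (qfac (i ℕ.+ suc j)) ⟩
    qfac (i ℕ.+ suc j) *ᴬ (1ᴬ +ᴬ -ᴬ (q ^ suc i *ᴬ q ^ suc j))
      ≈⟨ A.*-congˡ (A.+-congˡ (A.-‿cong (A.sym (^-homo-* q (suc i) (suc j))))) ⟩
    qfac (suc i ℕ.+ suc j) ∎

  -- Here `c` serves as a list of n coefficients. The argument z is any series: both the variable
  -- itself and -1 plus the variable will be inserted.
  eval : ℕ → Seq → Seq → Seq
  eval zero    c z = 0ˢ
  eval (suc n) c z = const (c 0) ⊕ z ⊛ eval n (tail c) z

  eval-cong : ∀ n {c d} z → (∀ k → c k ≈ᴬ d k) → eval n c z ≋ eval n d z
  eval-cong zero    z p = K.refl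
  eval-cong (suc n) z p = K.+-cong (const-cong (p 0)) (K.*-congˡ (eval-cong n z (p ∘ suc)))

  private
    eval-linear : ∀ n u v c d z → eval n (λ k → u *ᴬ c k +ᴬ v *ᴬ d k) z ≋ const u ⊛ eval n c z ⊕ const v ⊛ eval n d z
    eval-linear zero    u v c d z = K.sym (K.trans (K.+-cong (K.zeroʳ _) (K.zeroʳ _)) (K.+-identityˡ _))
    eval-linear (suc n) u v c d z = K.trans
      (K.+-cong (K.trans (const-+ _ _) (K.+-cong (const-* _ _) (const-* _ _)))
        (K.*-congˡ (eval-linear n u v (tail c) (tail d) z)))
      (KS.solve 7 (λ u v a b z x y → let open KS in (u :* a :+ v :* b) :+ z :* (u :* x :+ v :* y) := u :*
        (a :+ z :* x) :+ v :* (b :+ z :* y)) K.refl _ _ _ _ _ _ _)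

    eval-last : ∀ n c z → c n ≈ᴬ 0ᴬ → eval (suc n) c z ≋ eval n c z
    eval-last zero    c z p = K.trans (K.+-cong (K.trans (const-cong p) const-0) (K.zeroʳ z)) (K.+-identityˡ _)
    eval-last (suc n) c z p = K.+-congˡ (K.*-congˡ (eval-last n (tail c) z p))

  times : A → A → Seq → Seq
  times u w c zero    = u *ᴬ c 0
  times u w c (suc k) = u *ᴬ c (suc k) +ᴬ w *ᴬ c k

  -- The top coefficient of `times u w c` also reads `c n`, which lies outside the polynomial on the
  -- left; hence the hypothesis.
  eval-times : ∀ n u w c z → c n ≈ᴬ 0ᴬ → (const u ⊕ z ⊛ const w) ⊛ eval n c z ≋ eval (suc n) (times u w c) z
  eval-times n u w c z p = K.trans
    (K.trans (K.distribʳ _ _ _) (K.+-congʳ (K.*-congˡ (K.sym (eval-last n c z p)))))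
    (K.sym (K.trans (K.+-cong (const-* _ _) (K.*-congˡ (eval-linear n u w (tail c) c z)))
      (KS.solve 6 (λ u w a z x y → let open KS in u :* a :+ z :* (u :* x :+ w :* y) := u :* (a :+ z :* x)
        :+ z :* w :* y) K.refl _ _ _ _ _ _)))

  -- `prodA a z` is the product of 1 + z qⁱ for 1 ≤ i ≤ a, and `prodB b z` is z^b times the product
  -- of 1 + z⁻¹ qⁱ for 0 ≤ i < b. The power of z removes negative exponents, so the constant term
  -- moves to index b.
  prodA prodB : ℕ → Seq → Seq
  prodA zero    z = const 1ᴬ
  prodA (suc a) z = (const 1ᴬ ⊕ z ⊛ const (q ^ suc a)) ⊛ prodA a z
  prodB zero    z = const 1ᴬ
  prodB (suc b) z = (const (q ^ b) ⊕ z ⊛ const 1ᴬ) ⊛ prodB b z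

  coefAB : ℕ → ℕ → Seq
  coefAB n b k = q ^ tri k b *ᴬ gauss n k

  private
    coefAB-last : ∀ n b → coefAB n b (suc n) ≈ᴬ 0ᴬ
    coefAB-last n b = A.trans (A.*-congˡ (gauss-zero n (suc n) ℕₚ.≤-refl)) (A.zeroʳ _)

    pow : ∀ {m n} → m ≡ n → q ^ m ≈ᴬ q ^ n
    pow p = A.reflexive (≡.cong (q ^_) p)

    stepB : ∀ n b k → times (q ^ b) 1ᴬ (coefAB n b) k ≈ᴬ coefAB (suc n) (suc b) k
    stepB n b zero    = A.trans (A.sym (A.*-assoc _ _ _)) (A.*-congʳ (A.sym (^-homo-* q b _)))
    stepB n b (suc k) = begin
      q ^ b *ᴬ (q ^ tri (suc k) b *ᴬ gauss n (suc k)) +ᴬ 1ᴬ *ᴬ (q ^ tri k b *ᴬ gauss n k)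
        ≈⟨ A.+-cong (A.trans (A.sym (A.*-assoc _ _ _)) (A.*-congʳ powers)) (A.*-identityˡ _) ⟩
      q ^ tri k b *ᴬ q ^ suc k *ᴬ gauss n (suc k) +ᴬ q ^ tri k b *ᴬ gauss n k
        ≈⟨ S.solve 4 (λ x y g h → let open S in x :* y :* g :+ x :* h := x :* (h :+ y :* g)) A.refl _ _ _ _ ⟩
      q ^ tri k b *ᴬ (gauss n k +ᴬ q ^ suc k *ᴬ gauss n (suc k)) ∎
      where
      powers : q ^ b *ᴬ q ^ tri (suc k) b ≈ᴬ q ^ tri k b *ᴬ q ^ suc k
      powers = A.trans (A.*-comm _ _) (A.trans (A.sym (^-homo-* q (tri (suc k) b) b))
        (A.trans (pow (tri-suc k b)) (^-homo-* q (tri k b) (suc k))))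

    stepA : ∀ a b k → times 1ᴬ (q ^ suc a) (coefAB (a ℕ.+ b) b) k ≈ᴬ coefAB (suc a ℕ.+ b) b k
    stepA a b zero    = A.*-identityˡ _
    -- `gauss-suc` needs k ≤ a + b; beyond that all q-binomials involved vanish.
    stepA a b (suc k) with ℕₚ.≤-<-connex k (a ℕ.+ b)
    ... | inj₂ n<k = A.trans
      (A.+-cong (A.trans (A.*-identityˡ _) (A.trans (A.*-congˡ (gauss-zero _ _ (ℕₚ.m≤n⇒m≤1+n n<k))) (A.zeroʳ _)))
                (A.trans (A.*-congˡ (A.trans (A.*-congˡ (gauss-zero _ _ n<k)) (A.zeroʳ _))) (A.zeroʳ _)))
      (A.trans (A.+-identityˡ _) (A.sym (A.trans (A.*-congˡ (gauss-zero (suc (a ℕ.+ b)) (suc k) (s≤s n<k)))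
        (A.zeroʳ _))))
    ... | inj₁ k≤n = begin
      1ᴬ *ᴬ (q ^ tri (suc k) b *ᴬ gauss n (suc k)) +ᴬ q ^ suc a *ᴬ (q ^ tri k b *ᴬ gauss n k)
        ≈⟨ A.+-cong (A.*-identityˡ _) (A.trans (A.sym (A.*-assoc _ _ _)) (A.*-congʳ powers)) ⟩
      q ^ tri (suc k) b *ᴬ gauss n (suc k) +ᴬ q ^ tri (suc k) b *ᴬ q ^ j *ᴬ gauss n k
        ≈⟨ S.solve 4 (λ x y g h → let open S in x :* g :+ x :* y :* h := x :* (g :+ y :* h)) A.refl _ _ _ _ ⟩
      q ^ tri (suc k) b *ᴬ (gauss n (suc k) +ᴬ q ^ j *ᴬ gauss n k)
        ≈⟨ A.*-congˡ (A.sym (≡.subst (λ n → gauss (suc n) (suc k) ≈ᴬ gauss n (suc k) +ᴬ q ^ j *ᴬ gauss n k)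
          (ℕₚ.m+[n∸m]≡n k≤n) (gauss-suc k j))) ⟩
      q ^ tri (suc k) b *ᴬ gauss (suc n) (suc k) ∎
      where
      n = a ℕ.+ b
      j = n ℕ.∸ k
      exponents : suc a ℕ.+ tri k b ≡ tri (suc k) b ℕ.+ j
      exponents = ℕₚ.+-cancelʳ-≡ k _ _ (≡.trans
        (let open +-*-Solver in solve 3 (λ a t k → con 1 :+ a :+ t :+ k := (t :+ (con 1 :+ k)) :+ a) ≡.refl a
          (tri k b) k)
        (≡.trans (≡.cong (ℕ._+ a) (≡.sym (tri-suc k b)))
        (≡.trans (let open +-*-Solver in solve 3 (λ a t b → t :+ b :+ a := t :+ (a :+ b)) ≡.refl a (tri (suc k) b) b)
        (≡.trans (≡.cong (tri (suc k) b ℕ.+_) (≡.sym (ℕₚ.m∸n+n≡m k≤n))) (≡.sym (ℕₚ.+-assoc (tri (suc k) b) j k))))))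
      powers : q ^ suc a *ᴬ q ^ tri k b ≈ᴬ q ^ tri (suc k) b *ᴬ q ^ j
      powers = A.trans (A.sym (^-homo-* q (suc a) (tri k b))) (A.trans (pow exponents) (^-homo-* q (tri (suc k) b) j))

  -- The q-binomial theorem, in the shape of a finite Jacobi triple product.
  prodA-prodB : ∀ a b z → prodA a z ⊛ prodB b z ≋ eval (suc (a ℕ.+ b)) (coefAB (a ℕ.+ b) b) z
  prodA-prodB zero zero z = K.trans (K.*-identityˡ _) (K.trans (const-cong (A.sym (A.*-identityˡ _)))
    (K.sym (K.trans (K.+-congˡ (K.zeroʳ z)) (K.+-identityʳ _))))
  prodA-prodB zero (suc b) z = K.trans (K.*-identityˡ _)
    (K.trans (K.*-congˡ (K.trans (K.sym (K.*-identityˡ _)) (prodA-prodB zero b z)))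
    (K.trans (eval-times (suc b) (q ^ b) 1ᴬ (coefAB b b) z (coefAB-last b b))
      (eval-cong (suc (suc b)) z (stepB b b))))
  prodA-prodB (suc a) b z = K.trans (K.*-assoc _ _ _) (K.trans (K.*-congˡ (prodA-prodB a b z))
    (K.trans (eval-times (suc (a ℕ.+ b)) 1ᴬ (q ^ suc a) (coefAB (a ℕ.+ b) b) z (coefAB-last (a ℕ.+ b) b))
      (eval-cong (suc (suc (a ℕ.+ b))) z (stepA a b))))

  eval-X : ∀ n c → (∀ k → n ℕ.≤ k → c k ≈ᴬ 0ᴬ) → eval n c X ≋ c
  eval-X zero    c p = ext λ k → A.sym (p k z≤n)
  eval-X (suc n) c p = K.trans (K.+-congˡ (K.*-congˡ (eval-X n (tail c) (λ k n≤k → p (suc k) (s≤s n≤k)))))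
    (K.sym (head-tail c))

  times-at : ∀ u w f → (const u ⊕ X ⊛ const w) ⊛ f ≋ times u w f
  times-at u w f = K.trans (K.distribʳ _ _ _) (K.trans (K.+-congˡ (K.trans (K.*-assoc X _ f) (X⊛ _)))
    (ext λ { zero → A.+-identityʳ _ ; (suc n) → A.+-cong (const-⊛ u f (suc n)) (const-⊛ w f n) }))

-- Euler's product E, the triple product modulo a power of q, and the norm of E.

module Eta (R : Ring) where

  open Series R
  open Dissect R
  open Adic R
  module A = CommutativeRing R
  module K = CommutativeRing seriesRing
  module M (N : ℕ) = CommutativeRing (ringMod N)
  module KS = Scalars seriesRing
  open import Algebra.Properties.Semiring.Exp K.semiring using (_^_)
  open Gauss seriesRing X
  module Z = Series seriesRing

  1ˢ : Seq
  1ˢ = const A.1#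

  qfac-cauchy : Cauchy qfac
  qfac-cauchy n = M.trans (suc n) (M.*-congˡ (suc n)
    (M.trans (suc n) (M.+-congˡ (suc n) (M.trans (suc n) (M.-‿cong (suc n) (X^-zero ℕₚ.≤-refl)) (weaken ⊖-0ˢ)))
    (M.+-identityʳ (suc n) _))) (M.*-identityʳ (suc n) _)

  E : Seq
  E = lim qfac

  E-qfac : ∀ {m n} → n ℕ.≤ m → E ≋[ suc n ] qfac m
  E-qfac {m} {n} n≤m = M.trans (suc n) (lim-≋ qfac-cauchy n) (M.sym (suc n) (Cauchy-≤ qfac-cauchy n≤m))

  open Inverse E A.refl public using () renaming (inverse to E⁻¹; inverseʳ to E⊛E⁻¹)

  unit-cancel : ∀ {u v} → u ⊛ v ≋ 1ˢ → ∀ {N f g} → u ⊛ f ≋[ N ] u ⊛ g → f ≋[ N ] g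
  unit-cancel {u} {v} uv {N} {f} {g} p = M.trans N (weaken (undo f))
    (M.trans N (M.*-congˡ N p) (weaken (K.sym (undo g))))
    where
    undo : ∀ f → f ≋ v ⊛ (u ⊛ f)
    undo f = K.sym (K.trans (K.sym (K.*-assoc v u f))
      (K.trans (K.*-congʳ (K.trans (K.*-comm v u) uv)) (K.*-identityˡ f)))

  -- Modulo the given power of `X` all three q-factorials in the product formula agree with `E`, so
  -- the q-binomial is E/E².
  E-gauss : ∀ {m} i j → m ℕ.≤ i → m ℕ.≤ j → E ⊛ gauss (i ℕ.+ j) i ≋[ suc m ] 1ˢ
  E-gauss {m} i j m≤i m≤j = unit-cancel E⊛E⁻¹ (begin
    E ⊛ (E ⊛ gauss (i ℕ.+ j) i)             ≈⟨ sym (*-assoc E E _) ⟩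
    E ⊛ E ⊛ gauss (i ℕ.+ j) i               ≈⟨ *-congʳ (*-cong (E-qfac m≤i) (E-qfac m≤j)) ⟩
    qfac i ⊛ qfac j ⊛ gauss (i ℕ.+ j) i     ≈⟨ weaken (gauss-qfac i j) ⟩
    qfac (i ℕ.+ j)                          ≈⟨ sym (E-qfac (ℕₚ.≤-trans m≤i (ℕₚ.m≤m+n i j))) ⟩
    E                                       ≈⟨ sym (*-identityʳ E) ⟩
    E ⊛ 1ˢ                         ∎)
    where
    open CommutativeRing (ringMod (suc m))
    open import Relation.Binary.Reasoning.Setoid setoid

  tri-≥ : ∀ k b → k ℕ.≤ tri k b ℕ.+ b
  tri-≥ zero    b       = z≤n
  tri-≥ (suc k) zero    = ℕₚ.≤-trans (ℕₚ.m≤m+n (suc k) (tri k 0)) (ℕₚ.m≤m+n _ 0)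
  tri-≥ (suc k) (suc b) = ℕₚ.≤-trans (s≤s (tri-≥ k b)) (ℕₚ.≤-reflexive (≡.sym (ℕₚ.+-suc _ b)))

  -- The triple product, one coefficient at a time. `E-gauss` is precise only to about min(k, 2N -
  -- k), which is poor near both ends; there the triangular exponent is large enough to restore
  -- precision `N`. Beyond k = 2N both sides vanish.
  E-coefAB : ∀ N k → E ⊛ coefAB (N ℕ.+ N) N k ≋[ N ] X ^ tri k N
  E-coefAB N k with ℕₚ.≤-<-connex k (N ℕ.+ N)
  ... | inj₂ 2N<k = M.trans N (M.trans N (weaken (K.*-congˡ (K.trans (K.*-congˡ (gauss-zero _ _ 2N<k)) (K.zeroʳ _))))
    (M.zeroʳ N E))
      (M.sym N (X^-zero (ℕₚ.+-cancelʳ-≤ N _ _ (ℕₚ.≤-trans (ℕₚ.<⇒≤ 2N<k) (tri-≥ k N)))))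
  ... | inj₁ k≤2N = M.trans N (weaken (KS.solve 3
    (λ e x g → let open KS in e :* (x :* g) := x :* (e :* g)) K.refl _ _ _))
      (M.trans N (by-side (ℕₚ.≤-total k N)) (weaken (K.*-identityʳ _)))
    where
    j = N ℕ.+ N ℕ.∸ k
    k+j : k ℕ.+ j ≡ N ℕ.+ N
    k+j = ℕₚ.m+[n∸m]≡n k≤2N
    main : ∀ m → m ℕ.≤ k → m ℕ.≤ j → N ℕ.≤ tri k N ℕ.+ suc m → X ^ tri k N ⊛
      (E ⊛ gauss (N ℕ.+ N) k) ≋[ N ] X ^ tri k N ⊛ 1ˢ
    main m m≤k m≤j l = truncate l (X^⊛-cong< (tri k N)
      (≡.subst (λ n → E ⊛ gauss n k ≋[ suc m ] 1ˢ) k+j (E-gauss k j m≤k m≤j)))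
    by-side : _ → X ^ tri k N ⊛ (E ⊛ gauss (N ℕ.+ N) k) ≋[ N ] X ^ tri k N ⊛ 1ˢ
    by-side (inj₁ k≤N) = main k ℕₚ.≤-refl (ℕₚ.≤-trans k≤N
      (ℕₚ.+-cancelˡ-≤ k _ _ (ℕₚ.≤-trans (ℕₚ.+-monoˡ-≤ N k≤N) (ℕₚ.≤-reflexive (≡.sym k+j)))))
      (ℕₚ.≤-trans (ℕₚ.m≤n+m N _) (ℕₚ.≤-reflexive (tri-suc k N)))
    by-side (inj₂ N≤k) = main j (ℕₚ.+-cancelˡ-≤ N _ _
      (ℕₚ.≤-trans (ℕₚ.+-monoˡ-≤ j N≤k) (ℕₚ.≤-trans (ℕₚ.≤-reflexive k+j) (ℕₚ.+-monoʳ-≤ N N≤k)))) ℕₚ.≤-refl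
      (ℕₚ.+-cancelʳ-≤ N _ _ (ℕₚ.≤-trans (ℕₚ.≤-reflexive (≡.sym k+j)) (ℕₚ.≤-trans (ℕₚ.+-monoˡ-≤ j (tri-≥ k N))
        (let t = tri k N in ℕₚ.≤-trans (ℕₚ.≤-reflexive
          (let open +-*-Solver in solve 3 (λ t n j → t :+ n :+ j := t :+ j :+ n) ≡.refl t N j))
          (ℕₚ.+-monoˡ-≤ N (ℕₚ.+-monoʳ-≤ t (ℕₚ.n≤1+n j)))))))

  cube : Seq → Seq
  cube f = f ⊛ f ⊛ f

  cube-cong< : ∀ N {f g} → f ≋[ N ] g → cube f ≋[ N ] cube g
  cube-cong< N p = M.*-cong N (M.*-cong N p p) p

  V-^ : ∀ f n → V (f ^ n) ≋ V f ^ n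
  V-^ f zero    = V-const A.1#
  V-^ f (suc n) = K.trans (V-* f (f ^ n)) (K.*-congˡ (V-^ f n))

  ^-V : ∀ n → X ^ (n ℕ.* 3) ≋ V (X ^ n)
  ^-V zero    = K.sym (V-const A.1#)
  ^-V (suc n) = K.trans (K.*-congˡ (K.*-congˡ (K.*-congˡ (^-V n))))
    (K.trans (KS.solve 2 (λ x v → let open KS in x :* (x :* (x :* v)) := x :* (x :* x) :* v) K.refl X (V (X ^ n)))
    (K.trans (K.*-congʳ (K.sym V-X)) (K.sym (V-* X (X ^ n)))))

  ^-*3 : ∀ n → X ^ (n ℕ.* 3) ≋ cube (X ^ n)
  ^-*3 zero    = KS.solve 0 (let open KS in con (+ 1) := con (+ 1) :* con (+ 1) :* con (+ 1)) K.refl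
  ^-*3 (suc n) = K.trans (K.*-congˡ (K.*-congˡ (K.*-congˡ (^-*3 n))))
    (KS.solve 2 (λ x v → let open KS in x :* (x :* (x :* (v :* v :* v))) := (x :* v) :* (x :* v) :*
    (x :* v)) K.refl X (X ^ n))

  N-V₀ : ∀ f → N (V f) ≋ cube f
  N-V₀ f = K.trans (N-V f 0ˢ 0ˢ (K.sym (K.trans
    (K.+-congˡ (K.trans (K.*-congˡ (K.trans (K.+-cong V-0 (K.trans (K.*-congˡ V-0) (K.zeroʳ X))) (K.+-identityʳ _)))
    (K.zeroʳ X))) (K.+-identityʳ _))))
    (KS.solve 2 (λ f x → let open KS in f :* f :* f :+ x :* (con (+ 0) :* con (+ 0) :* con (+ 0)) :+ x :*
      (x :* (con (+ 0) :* con (+ 0) :* con (+ 0))) :+ :- (con (+ 3) :* (x :* (f :* con (+ 0) :* con (+ 0))))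
      := f :* f :* f) K.refl f X)

  -- The norm of 1 - q^m is 1 - q^m if 3 does not divide m, and (1 - q^k)³ if m = 3k. The factors 1
  -- - q^(3k) of `V (qfac n)` complete the first kind to `qfac (n * 3)`.
  qfac-N : ∀ n → N (qfac (n ℕ.* 3)) ⊛ V (qfac n) ≋ qfac (n ℕ.* 3) ⊛ cube (qfac n)
  qfac-N zero    = K.trans (K.*-congʳ (K.trans (N-cong (K.sym (V-const A.1#))) (N-V₀ (1ˢ))))
    (K.trans (K.*-congˡ (V-const A.1#)) (K.*-comm (cube (1ˢ)) (1ˢ)))
  qfac-N (suc n) = begin
    N (q3 ⊛ f₁ ⊛ f₂ ⊛ f₃) ⊛ V (qfac n ⊛ f)
      ≈⟨ K.*-cong (K.trans (N-* _ f₃) (K.*-cong (K.trans (N-* _ f₂) (K.*-congʳ (N-* q3 f₁))) Nf₃))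
        (K.trans (V-* (qfac n) f) (K.*-congˡ Vf)) ⟩
    N q3 ⊛ N f₁ ⊛ N f₂ ⊛ cube f ⊛ (V (qfac n) ⊛ f₃)
      ≈⟨ K.*-congʳ (K.*-congʳ (K.*-cong (K.*-congˡ Nf₁) Nf₂)) ⟩
    N q3 ⊛ f₁ ⊛ f₂ ⊛ cube f ⊛ (V (qfac n) ⊛ f₃)
      ≈⟨ KS.solve 6 (λ a b c d e f → let open KS in a :* b :* c :* d :* (e :* f) := (a :* e) :*
        (b :* c :* f :* d)) K.refl (N q3) f₁ f₂ (cube f) (V (qfac n)) f₃ ⟩
    N q3 ⊛ V (qfac n) ⊛ (f₁ ⊛ f₂ ⊛ f₃ ⊛ cube f)
      ≈⟨ K.*-congʳ (qfac-N n) ⟩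
    q3 ⊛ cube (qfac n) ⊛ (f₁ ⊛ f₂ ⊛ f₃ ⊛ cube f)
      ≈⟨ KS.solve 6 (λ a b c d e f → let open KS in a :* (b :* b :* b) :* (c :* d :* e :* (f :* f :* f))
        := a :* c :* d :* e :* ((b :* f) :* (b :* f) :* (b :* f))) K.refl q3 (qfac n) f₁ f₂ f₃ f ⟩
    q3 ⊛ f₁ ⊛ f₂ ⊛ f₃ ⊛ cube (qfac n ⊛ f) ∎
    where
    open import Relation.Binary.Reasoning.Setoid K.setoid
    q3 f f₁ f₂ f₃ y : Seq
    q3 = qfac (n ℕ.* 3)
    y  = X ^ n
    f  = 1ˢ ⊕ ⊖ X ^ suc n
    f₁ = 1ˢ ⊕ ⊖ X ^ suc (n ℕ.* 3)
    f₂ = 1ˢ ⊕ ⊖ X ^ suc (suc (n ℕ.* 3))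
    f₃ = 1ˢ ⊕ ⊖ X ^ suc (suc (suc (n ℕ.* 3)))
    Vf : V f ≋ f₃
    Vf = K.trans (V-+ _ _) (K.+-cong (V-const A.1#) (K.trans (V-⊖ _) (K.-‿cong (K.sym (^-V (suc n))))))
    Nf₃ : N f₃ ≋ cube f
    Nf₃ = K.trans (N-cong (K.sym Vf)) (N-V₀ f)
    Nf₁ : N f₁ ≋ f₁
    Nf₁ = K.trans (N-V (1ˢ) (⊖ y) 0ˢ (K.sym (begin
        V (1ˢ) ⊕ X ⊛ (V (⊖ y) ⊕ X ⊛ V 0ˢ) ≈⟨ K.+-cong (V-const A.1#)
          (K.*-congˡ (K.+-cong (K.trans (V-⊖ y) (K.-‿cong (K.sym (^-V n)))) (K.*-congˡ V-0))) ⟩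
        1ˢ ⊕ X ⊛ (⊖ X ^ (n ℕ.* 3) ⊕ X ⊛ 0ˢ) ≈⟨ KS.solve 2
          (λ x v → let open KS in con (+ 1) :+ x :* (:- v :+ x :* con (+ 0)) := con (+ 1) :+ :- (x :* v)) K.refl X
          (X ^ (n ℕ.* 3)) ⟩
        f₁ ∎)))
      (K.trans (KS.solve 2 (λ x y → let open KS in con (+ 1) :* con (+ 1) :* con (+ 1) :+ x :*
        ((:- y) :* (:- y) :* (:- y)) :+ x :* (x :* (con (+ 0) :* con (+ 0) :* con (+ 0))) :+ :-
        (con (+ 3) :* (x :* (con (+ 1) :* (:- y) :* con (+ 0)))) := con (+ 1) :+ :- (x :* (y :* y :* y))) K.refl X y)
        (K.+-congˡ (K.-‿cong (K.*-congˡ (K.sym (^-*3 n))))))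
    Nf₂ : N f₂ ≋ f₂
    Nf₂ = K.trans (N-V (1ˢ) 0ˢ (⊖ y) (K.sym (begin
        V (1ˢ) ⊕ X ⊛ (V 0ˢ ⊕ X ⊛ V (⊖ y)) ≈⟨ K.+-cong (V-const A.1#)
          (K.*-congˡ (K.+-cong V-0 (K.*-congˡ (K.trans (V-⊖ y) (K.-‿cong (K.sym (^-V n))))))) ⟩
        1ˢ ⊕ X ⊛ (0ˢ ⊕ X ⊛ ⊖ X ^ (n ℕ.* 3)) ≈⟨ KS.solve 2
          (λ x v → let open KS in con (+ 1) :+ x :* (con (+ 0) :+ x :* (:- v)) := con (+ 1) :+ :-
          (x :* (x :* v))) K.refl X (X ^ (n ℕ.* 3)) ⟩
        f₂ ∎)))
      (K.trans (KS.solve 2 (λ x y → let open KS in con (+ 1) :* con (+ 1) :* con (+ 1) :+ x :*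
        (con (+ 0) :* con (+ 0) :* con (+ 0)) :+ x :* (x :* ((:- y) :* (:- y) :* (:- y))) :+ :-
        (con (+ 3) :* (x :* (con (+ 1) :* con (+ 0) :* (:- y)))) := con (+ 1) :+ :-
        (x :* (x :* (y :* y :* y)))) K.refl X y)
        (K.+-congˡ (K.-‿cong (K.*-congˡ (K.*-congˡ (K.sym (^-*3 n)))))))

  N-cong< : ∀ n {f g} → f ≋[ n ℕ.* 3 ] g → N f ≋[ n ] N g
  N-cong< n p = M.+-cong n (M.+-cong n (M.+-cong n (cube-cong< n (U₀-cong< n p))
    (M.*-congˡ n (cube-cong< n (U₁-cong< n p)))) (M.*-congˡ n (M.*-congˡ n (cube-cong< n (U₂-cong< n p)))))
    (M.-‿cong n (M.*-congˡ n (M.*-congˡ n (M.*-cong n (M.*-cong n (U₀-cong< n p) (U₁-cong< n p)) (U₂-cong< n p)))))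

  -- The limit of `qfac-N`: the norm of E is E₁⁴/E₃.
  N-E : N E ⊛ V E ≋ E ⊛ cube E
  N-E = ≋-from-< λ n → M.trans n
    (M.*-cong n (N-cong< n (E≈qfac (n ℕ.* 3))) (truncate (ℕₚ.m≤m*n n 3) (V-cong< n (E≈qfac n))))
    (M.trans n (weaken (qfac-N n))
      (M.sym n (M.*-cong n (truncate (ℕₚ.m≤m*n n 3) (E≈qfac (n ℕ.* 3))) (cube-cong< n (E≈qfac n)))))
    where
    E≈qfac : ∀ n → E ≋[ n ] qfac n
    E≈qfac n = truncate (ℕₚ.n≤1+n n) (E-qfac ℕₚ.≤-refl)

-- Triangular numbers modulo 3 and the 3-dissection of Jacobi's series.

module Jacobi (R : Ring) where

  open Series R
  open Dissect R
  open Adic R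
  open Eta R
  open import Algebra.Properties.Semiring.Exp K.semiring using (_^_)
  open Gauss seriesRing X

  -- T(m) is divisible by 3 unless m ≡ 1 mod 3, and T(3m + 1) = 9T(m) + 1. This lemma and the next
  -- settle the axes b = 0 and k = 0, where the recursion of `tri` ends; the later ones step down
  -- the diagonal to them.
  tri-3-0 : ∀ j → (∃ λ t → tri (j ℕ.* 3) 0 ≡ t ℕ.* 3) × (tri (suc (j ℕ.* 3)) 0 ≡ suc (tri j 0 ℕ.* 3 ℕ.* 3))
  tri-3-0 zero    = (0 , ≡.refl) , ≡.refl
  tri-3-0 (suc j) with tri-3-0 j
  ... | (t , p) , r =
    (2 ℕ.+ 2 ℕ.* j ℕ.+ tri j 0 ℕ.* 3 , ≡.trans (≡.cong
      (λ x → suc (suc (suc (j ℕ.* 3))) ℕ.+ (suc (suc (j ℕ.* 3)) ℕ.+ x)) r)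
      (let open +-*-Solver in solve 2 (λ j t → con 3 :+ j :* con 3 :+
        (con 2 :+ j :* con 3 :+ (con 1 :+ t :* con 3 :* con 3)) :=
        (con 2 :+ con 2 :* j :+ t :* con 3) :* con 3) ≡.refl j (tri j 0)))
    , ≡.trans (≡.cong (λ x → suc (suc (suc (suc (j ℕ.* 3)))) ℕ.+
      (suc (suc (suc (j ℕ.* 3))) ℕ.+ (suc (suc (j ℕ.* 3)) ℕ.+ x))) r)
      (let open +-*-Solver in solve 2 (λ j t → con 4 :+ j :* con 3 :+
        (con 3 :+ j :* con 3 :+ (con 2 :+ j :* con 3 :+ (con 1 :+ t :* con 3 :* con 3))) := con 1 :+
        (con 1 :+ j :+ t) :* con 3 :* con 3) ≡.refl j (tri j 0))

  tri-0-3 : ∀ l → (∃ λ t → tri 0 (l ℕ.* 3) ≡ t ℕ.* 3) ×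
    (tri 0 (suc (suc (l ℕ.* 3))) ≡ suc (tri 0 (suc l) ℕ.* 3 ℕ.* 3))
  tri-0-3 zero    = (0 , ≡.refl) , ≡.refl
  tri-0-3 (suc l) with tri-0-3 l
  ... | (t , p) , r = 
    (1 ℕ.+ l ℕ.+ tri 0 (suc l) ℕ.* 3 , ≡.trans (≡.cong (suc (suc (l ℕ.* 3)) ℕ.+_) r)
      (let open +-*-Solver in solve 2 (λ l t → con 2 :+ l :* con 3 :+ (con 1 :+ t :* con 3 :* con 3) :=
        (con 1 :+ l :+ t :* con 3) :* con 3) ≡.refl l (tri 0 (suc l))))
    , ≡.trans (≡.cong (λ x → suc (suc (suc (suc (l ℕ.* 3)))) ℕ.+
      (suc (suc (suc (l ℕ.* 3))) ℕ.+ (suc (suc (l ℕ.* 3)) ℕ.+ x))) r)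
      (let open +-*-Solver in solve 2 (λ l t → con 4 :+ l :* con 3 :+
        (con 3 :+ l :* con 3 :+ (con 2 :+ l :* con 3 :+ (con 1 :+ t :* con 3 :* con 3))) := con 1 :+
        (con 1 :+ l :+ t) :* con 3 :* con 3) ≡.refl l (tri 0 (suc l)))

  tri-≡0 : ∀ j l → ∃ λ t → tri (j ℕ.* 3) (l ℕ.* 3) ≡ t ℕ.* 3
  tri-≡0 zero    l       = proj₁ (tri-0-3 l)
  tri-≡0 (suc j) zero    = proj₁ (tri-3-0 (suc j))
  tri-≡0 (suc j) (suc l) = tri-≡0 j l

  tri-≡1 : ∀ j l → tri (suc (j ℕ.* 3)) (l ℕ.* 3) ≡ suc (tri j l ℕ.* 3 ℕ.* 3)
  tri-≡1 zero    zero    = ≡.refl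
  tri-≡1 zero    (suc l) = proj₂ (tri-0-3 l)
  tri-≡1 (suc j) zero    = proj₂ (tri-3-0 (suc j))
  tri-≡1 (suc j) (suc l) = tri-≡1 j l

  tri-≡-1 : ∀ j l → ∃ λ t → tri (j ℕ.* 3) (suc (l ℕ.* 3)) ≡ t ℕ.* 3
  tri-≡-1 zero l with tri-0-3 l
  ... | (t , p) , _ = l ℕ.+ t , ≡.trans (≡.cong (l ℕ.* 3 ℕ.+_) p) (≡.sym (ℕₚ.*-distribʳ-+ 3 l t))
  tri-≡-1 (suc j) zero with tri-3-0 j
  ... | _ , r = suc j ℕ.+ tri j 0 ℕ.* 3 , ≡.trans (≡.cong (suc (suc (j ℕ.* 3)) ℕ.+_) r)
    (let open +-*-Solver in solve 2 (λ j t → con 2 :+ j :* con 3 :+ (con 1 :+ t :* con 3 :* con 3) :=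
      (con 1 :+ j :+ t :* con 3) :* con 3) ≡.refl j (tri j 0))
  tri-≡-1 (suc j) (suc l) = tri-≡-1 j l

  -- Value and derivative at z = −1 of the polynomial with n coefficients c.
  alt der : ℕ → Z.Seq → Seq
  alt zero    c = 0ˢ
  alt (suc n) c = c 0 ⊕ ⊖ alt n (Z.tail c)
  der zero    c = 0ˢ
  der (suc n) c = alt n (Z.tail c) ⊕ ⊖ der n (Z.tail c)

  private

    -- With ε the series variable, the coefficients of ε⁰ and ε¹ are value and derivative at -1, and
    -- multiplication of series supplies the product rule.
    -1+ε : Z.Seq
    -1+ε = Z.⊖ Z.const 1ˢ Z.⊕ Z.X

    z₀ : -1+ε 0 ≋ ⊖ 1ˢ
    z₀ = K.+-identityʳ _

    z₁ : -1+ε 1 ≋ 1ˢ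
    z₁ = K.trans (K.+-congʳ ⊖-0ˢ) (K.+-identityˡ _)

    eval-alt : ∀ n c → eval n c -1+ε 0 ≋ alt n c
    eval-alt zero    c = K.refl
    eval-alt (suc n) c = K.+-congˡ (K.trans (K.*-cong z₀ (eval-alt n (Z.tail c)))
      (KS.solve 1 (λ x → let open KS in (:- con (+ 1)) :* x := :- x) K.refl _))

    eval-der : ∀ n c → eval n c -1+ε 1 ≋ der n c
    eval-der zero    c = K.refl
    eval-der (suc n) c = K.trans (K.+-identityˡ _)
      (K.trans (K.+-cong (K.*-cong z₀ (eval-der n (Z.tail c))) (K.*-cong z₁ (eval-alt n (Z.tail c))))
      (KS.solve 2 (λ x y → let open KS in (:- con (+ 1)) :* x :+ con (+ 1) :* y := y :+ :- x) K.refl _ _))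

  sign : ℕ → Seq
  sign zero    = 1ˢ
  sign (suc n) = ⊖ sign n

  sign² : ∀ n → sign n ⊛ sign n ≋ 1ˢ
  sign² zero    = K.*-identityˡ _
  sign² (suc n) = K.trans (KS.solve 1 (λ x → let open KS in (:- x) :* (:- x) := x :* x) K.refl _) (sign² n)

  sign-3 : ∀ n → sign (n ℕ.* 3) ≋ sign n
  sign-3 zero    = K.refl
  sign-3 (suc n) = K.trans (KS.solve 1 (λ x → let open KS in :- (:- (:- x)) := :- x) K.refl _) (K.-‿cong (sign-3 n))

  V-sign : ∀ n → V (sign n) ≋ sign n
  V-sign zero    = V-const A.1#
  V-sign (suc n) = K.trans (V-⊖ _) (K.-‿cong (V-sign n))

  private
    prodA-0 : ∀ a → prodA a -1+ε 0 ≋ qfac a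
    prodA-0 zero    = K.refl
    prodA-0 (suc a) = K.trans (K.*-cong (K.+-congˡ (K.*-congʳ z₀)) (prodA-0 a))
      (KS.solve 2 (λ x y → let open KS in (con (+ 1) :+ (:- con (+ 1)) :* x) :* y := y :*
        (con (+ 1) :+ :- x)) K.refl _ _)

    factorB-0 : ∀ b → (Z.const (X ^ b) Z.⊕ -1+ε Z.⊛ Z.const 1ˢ) 0 ≋ ⊖ (1ˢ ⊕ ⊖ X ^ b)
    factorB-0 b = K.trans (K.+-congˡ (K.*-congʳ z₀))
      (KS.solve 1 (λ x → let open KS in x :+ (:- con (+ 1)) :* con (+ 1) := :- (con (+ 1) :+ :- x)) K.refl _)

    factorB-1 : ∀ b → (Z.const (X ^ b) Z.⊕ -1+ε Z.⊛ Z.const 1ˢ) 1 ≋ 1ˢ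
    factorB-1 b = K.trans (K.+-identityˡ _) (K.trans (K.+-cong (K.zeroʳ _) (K.*-congʳ z₁))
      (K.trans (K.+-identityˡ _) (K.*-identityˡ _)))

    prodB-0 : ∀ b → prodB (suc b) -1+ε 0 ≋ 0ˢ
    prodB-0 zero    = K.trans (K.*-congʳ (factorB-0 0))
      (KS.solve 0 (let open KS in (:- (con (+ 1) :+ :- con (+ 1))) :* con (+ 1) := con (+ 0)) K.refl)
    prodB-0 (suc b) = K.trans (K.*-congˡ (prodB-0 b)) (K.zeroʳ _)

    -- The factor 1 + z vanishes at -1, so the derivative is the product of the remaining factors qⁱ
    -- - 1.
    prodB-1 : ∀ b → prodB (suc b) -1+ε 1 ≋ sign b ⊛ qfac b
    prodB-1 zero    = K.trans (K.+-cong (K.zeroʳ _) (K.*-congʳ (factorB-1 0))) (K.+-identityˡ _)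
    prodB-1 (suc b) = K.trans (K.+-cong (K.*-cong (factorB-0 (suc b)) (prodB-1 b)) (K.*-congˡ (prodB-0 b)))
      (KS.solve 4 (λ x s f y → let open KS in (:- x) :* (s :* f) :+ y :* con (+ 0) := (:- s) :*
        (f :* x)) K.refl _ _ _ _)

    alt-coefAB : ∀ m → let n = suc m in alt (suc (n ℕ.+ n)) (coefAB (n ℕ.+ n) n) ≋ 0ˢ
    alt-coefAB m = K.trans (K.sym (K.trans (Z.at (prodA-prodB (suc m) (suc m) -1+ε) 0)
      (eval-alt (suc (suc m ℕ.+ suc m)) (coefAB (suc m ℕ.+ suc m) (suc m)))))
      (K.trans (K.*-congˡ (prodB-0 m)) (K.zeroʳ _))

    der-coefAB : ∀ m → let n = suc m in der (suc (n ℕ.+ n)) (coefAB (n ℕ.+ n) n) ≋ sign m ⊛ (qfac (suc m) ⊛ qfac m)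
    der-coefAB m = K.trans (K.sym (K.trans (Z.at (prodA-prodB (suc m) (suc m) -1+ε) 1)
      (eval-der (suc (suc m ℕ.+ suc m)) (coefAB (suc m ℕ.+ suc m) (suc m)))))
      (K.trans (K.+-cong (K.*-cong (prodA-0 (suc m)) (prodB-1 m)) (K.*-congˡ (prodB-0 m)))
        (KS.solve 4 (λ f s g y → let open KS in f :* (s :* g) :+ y :* con (+ 0) := s :* (f :* g)) K.refl _ _ _ _))

  theta : ℕ → Z.Seq
  theta n k = X ^ tri k n

  private
    record Linear (φ : Seq → Seq) : Set where
      field
        φ-0 : φ 0ˢ ≋ 0ˢ
        φ-+ : ∀ f g → φ (f ⊕ g) ≋ φ f ⊕ φ g
        φ-⊖ : ∀ f → φ (⊖ f) ≋ ⊖ φ f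

      φ-alt : ∀ n c → φ (alt n c) ≋ alt n (φ ∘ c)
      φ-alt zero    c = φ-0
      φ-alt (suc n) c = K.trans (φ-+ _ _) (K.+-congˡ (K.trans (φ-⊖ _) (K.-‿cong (φ-alt n (Z.tail c)))))

      φ-der : ∀ n c → φ (der n c) ≋ der n (φ ∘ c)
      φ-der zero    c = φ-0
      φ-der (suc n) c = K.trans (φ-+ _ _) (K.+-cong (φ-alt n (Z.tail c))
        (K.trans (φ-⊖ _) (K.-‿cong (φ-der n (Z.tail c)))))

    times-linear : ∀ f → Linear (f ⊛_)
    times-linear f = record { φ-0 = K.zeroʳ f ; φ-+ = K.distribˡ f ; φ-⊖ = λ g → K.sym (-‿distribʳ-* f g) }
      where open Algebra.Properties.Ring K.ring using (-‿distribʳ-*)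

    V-linear : Linear V
    V-linear = record { φ-0 = V-0 ; φ-+ = V-+ ; φ-⊖ = V-⊖ }

    XV-linear : Linear (λ f → X ⊛ V f)
    XV-linear = record
      { φ-0 = K.trans (K.*-congˡ V-0) (K.zeroʳ X)
      ; φ-+ = λ f g → K.trans (K.*-congˡ (V-+ f g)) (K.distribˡ X _ _)
      ; φ-⊖ = λ f → K.trans (K.*-congˡ (V-⊖ f)) (Linear.φ-⊖ (times-linear X) (V f)) }

    alt-cong< : ∀ N n {c d} → (∀ k → c k ≋[ N ] d k) → alt n c ≋[ N ] alt n d
    alt-cong< N zero    p = M.refl N
    alt-cong< N (suc n) p = M.+-cong N (p 0) (M.-‿cong N (alt-cong< N n (p ∘ suc)))

    der-cong< : ∀ N n {c d} → (∀ k → c k ≋[ N ] d k) → der n c ≋[ N ] der n d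
    der-cong< N zero    p = M.refl N
    der-cong< N (suc n) p = M.+-cong N (alt-cong< N n (p ∘ suc)) (M.-‿cong N (der-cong< N n (p ∘ suc)))

    alt-cong : ∀ n {c d} → (∀ k → c k ≋ d k) → alt n c ≋ alt n d
    alt-cong n p = ≋-from-< λ N → alt-cong< N n (weaken ∘ p)

    der-cong : ∀ n {c d} → (∀ k → c k ≋ d k) → der n c ≋ der n d
    der-cong n p = ≋-from-< λ N → der-cong< N n (weaken ∘ p)

  -- The triple product has a zero at z = -1; in terms of exponents, T(j) = T(-1 - j) with opposite
  -- signs.
  alt-theta : ∀ m → let n = suc m in alt (suc (n ℕ.+ n)) (theta n) ≋[ n ] 0ˢ
  alt-theta m = M.trans n (M.sym n (alt-cong< n (suc (n ℕ.+ n)) (E-coefAB n))) (weaken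
    (K.trans (K.sym (Linear.φ-alt (times-linear E) (suc (n ℕ.+ n)) (coefAB (n ℕ.+ n) n)))
      (K.trans (K.*-congˡ (alt-coefAB m)) (K.zeroʳ E))))
    where n = suc m

  -- Jacobi's identity is the derivative of the triple product at its zero z = -1: the terms of T(j)
  -- and T(-1 - j) combine to the weight 2j + 1 up to sign. `sign m` comes from the factors qⁱ - 1
  -- of `prodB`.
  der-theta : ∀ m → let n = suc m in der (suc (n ℕ.+ n)) (theta n) ≋[ n ] sign m ⊛ cube E
  der-theta m = M.trans n (M.sym n (der-cong< n (suc (n ℕ.+ n)) (E-coefAB n)))
    (M.trans n (weaken (K.trans (K.sym (Linear.φ-der (times-linear E) (suc (n ℕ.+ n)) (coefAB (n ℕ.+ n) n)))
      (K.*-congˡ (der-coefAB m))))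
    (M.trans n (M.*-congˡ n (M.*-congˡ n (M.sym n (M.*-cong n (E-qfac (ℕₚ.n≤1+n m)) (E-qfac ℕₚ.≤-refl)))))
      (weaken (KS.solve 2 (λ e s → let open KS in e :* (s :* (e :* e)) := s :* (e :* e :* e)) K.refl E (sign m)))))
    where n = suc m

  every : ℕ → Z.Seq → Z.Seq
  every i c k = c (i ℕ.+ k ℕ.* 3)

  private
    alt-3 : ∀ n c → alt (n ℕ.* 3) c ≋ alt n (every 0 c) ⊕ ⊖ alt n (every 1 c) ⊕ alt n (every 2 c)
    alt-3 zero    c = KS.solve 0 (let open KS in con (+ 0) := con (+ 0) :+ :- con (+ 0) :+ con (+ 0)) K.refl
    alt-3 (suc n) c = K.trans (K.+-congˡ (K.-‿cong (K.+-congˡ (K.-‿cong (K.+-congˡ (K.-‿cong (alt-3 n _)))))))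
      (KS.solve 6 (λ c₀ c₁ c₂ a₀ a₁ a₂ → let open KS in c₀ :+ :- (c₁ :+ :- (c₂ :+ :- (a₀ :+ :- a₁ :+ a₂))) :=
        (c₀ :+ :- a₀) :+ :- (c₁ :+ :- a₁) :+ (c₂ :+ :- a₂)) K.refl _ _ _ _ _ _)

    -- The derivative weights the index 3k + i by 3k + i: the 3k gives three times `der` of the
    -- subsequence, the i gives i times `alt`, up to signs.
    der-3 : ∀ n c → der (n ℕ.* 3) c ≋
      (KS.ι (+ 3) ⊛ der n (every 0 c) ⊕ (alt n (every 1 c) ⊕ ⊖ (KS.ι (+ 3) ⊛ der n (every 1 c)))) ⊕
        (KS.ι (+ 3) ⊛ der n (every 2 c) ⊕ ⊖ (KS.ι (+ 2) ⊛ alt n (every 2 c)))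
    der-3 zero    c = KS.solve 0 (let open KS in con (+ 0) :=
      (con (+ 3) :* con (+ 0) :+ (con (+ 0) :+ :- (con (+ 3) :* con (+ 0)))) :+
      (con (+ 3) :* con (+ 0) :+ :- (con (+ 2) :* con (+ 0)))) K.refl
    der-3 (suc n) c = K.trans
      (K.+-cong (K.+-congˡ (K.-‿cong (K.+-congˡ (K.-‿cong (alt-3 n _)))))
        (K.-‿cong (K.+-cong (K.+-congˡ (K.-‿cong (alt-3 n _)))
          (K.-‿cong (K.+-cong (alt-3 n _) (K.-‿cong (der-3 n _)))))))
      (KS.solve 8 (λ c₁ c₂ a₀ a₁ a₂ d₀ d₁ d₂ → let open KS
                                                   a = a₀ :+ :- a₁ :+ a₂
                                                   d = (con (+ 3) :* d₀ :+ (a₁ :+ :- (con (+ 3) :* d₁))) :+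
                                                     (con (+ 3) :* d₂ :+ :- (con (+ 2) :* a₂)) in
        (c₁ :+ :- (c₂ :+ :- a)) :+ :- ((c₂ :+ :- a) :+ :- (a :+ :- d)) :=
        (con (+ 3) :* (a₀ :+ :- d₀) :+ ((c₁ :+ :- a₁) :+ :- (con (+ 3) :* (a₁ :+ :- d₁)))) :+
          (con (+ 3) :* (a₂ :+ :- d₂) :+ :- (con (+ 2) :* (c₂ :+ :- a₂)))) K.refl _ _ _ _ _ _ _ _)

  V-ι : ∀ i → V (KS.ι i) ≋ KS.ι i
  V-ι i = K.trans (V-cong (ι-const i)) (K.trans (V-const _) (K.sym (ι-const i)))

  theta-0 : ∀ l k → ∃ λ t → every 0 (theta (suc (l ℕ.* 3))) k ≋ V (X ^ t)
  theta-0 l k with tri-≡-1 k l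
  ... | t , p = t , K.trans (K.reflexive (≡.cong (X ^_) p)) (^-V t)

  theta-1 : ∀ l k → ∃ λ t → every 1 (theta (suc (l ℕ.* 3))) k ≋ V (X ^ t)
  theta-1 l k with tri-≡0 k l
  ... | t , p = t , K.trans (K.reflexive (≡.cong (X ^_) p)) (^-V t)

  theta-2 : ∀ l k → every 2 (theta (suc (l ℕ.* 3))) k ≋ X ⊛ V (V (theta l k))
  theta-2 l k = K.trans (K.reflexive (≡.cong (X ^_) (tri-≡1 k l)))
    (K.*-congˡ (K.trans (^-V (tri k l ℕ.* 3)) (V-cong (^-V (tri k l)))))

  private
    module _ (m : ℕ) where
      l n n′ w : ℕ
      l  = suc m
      n′ = suc (l ℕ.+ l)
      -- For n = 3l + 1 there are 2n + 1 = 3(2l + 1) coefficients, so each residue class of the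
      -- index is a full sum of 2l + 1 terms, and class 2 is q times `theta l` at q⁹.
      n  = suc (l ℕ.* 3)
      w  = l ℕ.* 3

      P Q : Seq
      P = KS.ι (+ 3) ⊛ der n′ (λ k → X ^ proj₁ (theta-0 l k)) ⊕
        (alt n′ (λ k → X ^ proj₁ (theta-1 l k)) ⊕ ⊖ (KS.ι (+ 3) ⊛ der n′ (λ k → X ^ proj₁ (theta-1 l k))))
      Q = V (KS.ι (+ 3) ⊛ der n′ (theta l) ⊕ ⊖ (KS.ι (+ 2) ⊛ alt n′ (theta l)))

      n′*3 : suc (n ℕ.+ n) ≡ n′ ℕ.* 3
      n′*3 = let open +-*-Solver in solve 1 (λ l → con 1 :+ (con 1 :+ l :* con 3 :+ (con 1 :+ l :* con 3)) :=
        (con 1 :+ (l :+ l)) :* con 3) ≡.refl l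

      pull : ∀ i f → KS.ι i ⊛ V f ≋ V (KS.ι i ⊛ f)
      pull i f = K.sym (K.trans (V-* _ f) (K.*-congʳ (V-ι i)))

      pullX : ∀ i f → KS.ι i ⊛ (X ⊛ V f) ≋ X ⊛ V (KS.ι i ⊛ f)
      pullX i f = K.trans (KS.solve 3 (λ i x v → let open KS in i :* (x :* v) := x :* (i :* v)) K.refl _ _ _)
        (K.*-congˡ (pull i f))

      der-dissect : der (suc (n ℕ.+ n)) (theta n) ≋ V P ⊕ X ⊛ V Q
      der-dissect = K.trans (K.reflexive (≡.cong (λ k → der k (theta n)) n′*3))
        (K.trans (der-3 n′ (theta n)) (K.+-cong
        (K.trans (K.+-cong (K.trans (K.*-congˡ (d V-linear (λ k → proj₂ (theta-0 l k)))) (pull (+ 3) _))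
                   (K.trans (K.+-cong (a V-linear (λ k → proj₂ (theta-1 l k)))
                              (K.trans (K.-‿cong (K.trans (K.*-congˡ (d V-linear (λ k → proj₂ (theta-1 l k))))
                                (pull (+ 3) _))) (K.sym (V-⊖ _)))) (K.sym (V-+ _ _))))
          (K.sym (V-+ _ _)))
        (K.trans (K.+-cong (K.trans (K.*-congˡ (d XV-linear (theta-2 l))) (pullX (+ 3) _))
            (K.trans (K.-‿cong (K.trans (K.*-congˡ (a XV-linear (theta-2 l))) (pullX (+ 2) _)))
              (K.sym (Linear.φ-⊖ XV-linear _))))
          (K.trans (K.sym (Linear.φ-+ XV-linear _ _)) (K.*-congˡ (V-cong
            (K.trans (K.+-cong (K.trans (K.*-congˡ (K.sym (Linear.φ-der V-linear n′ (theta l)))) (pull (+ 3) _))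
                (K.trans (K.-‿cong (K.trans (K.*-congˡ (K.sym (Linear.φ-alt V-linear n′ (theta l)))) (pull (+ 2) _)))
                  (K.sym (V-⊖ _))))
              (K.sym (V-+ _ _)))))))))
        where
        d : ∀ {φ} (L : Linear φ) {c e} → (∀ k → c k ≋ φ (e k)) → der n′ c ≋ φ (der n′ e)
        d L {e = e} p = K.trans (der-cong n′ p) (K.sym (Linear.φ-der L n′ e))
        a : ∀ {φ} (L : Linear φ) {c e} → (∀ k → c k ≋ φ (e k)) → alt n′ c ≋ φ (alt n′ e)
        a L {e = e} p = K.trans (alt-cong n′ p) (K.sym (Linear.φ-alt L n′ e))

      s : Seq
      s = sign w

      E³≋ : cube E ≋[ w ] V (s ⊛ P) ⊕ X ⊛ (V (s ⊛ Q) ⊕ X ⊛ V 0ˢ)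
      E³≋ = truncate (ℕₚ.n≤1+n w) (M.trans n
        (M.trans n (weaken (K.trans (K.trans (K.sym (K.*-identityˡ _)) (K.*-congʳ (K.sym (sign² w))))
          (K.*-assoc s s _)))
                   (M.*-congˡ n (M.trans n (M.sym n (der-theta w)) (weaken der-dissect))))
        (weaken (K.trans (KS.solve 4 (λ s p x q → let open KS in s :* (p :+ x :* q) := s :* p :+ x :*
          (s :* q :+ x :* con (+ 0))) K.refl s (V P) X (V Q))
          (K.sym (K.+-cong (Vs P) (K.*-congˡ (K.+-cong (Vs Q) (K.*-congˡ V-0))))))))
        where
        Vs : ∀ f → V (s ⊛ f) ≋ s ⊛ V f
        Vs f = K.trans (V-* s f) (K.*-congʳ (V-sign w))

      -- No triangular number is ≡ 2 mod 3.
      U₂-E³ : U₂ (cube E) ≋[ l ] 0ˢ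
      U₂-E³ = M.trans l (U₂-cong< l E³≋) (weaken (proj₂ (proj₂ (U-V _ _ _ K.refl))))

      -- Exponents ≡ 1 are those of the form 9T + 1, so Jacobi's sum at q⁹ reappears with weight 3,
      -- the `alt` term vanishing by `alt-theta`. The minus sign is `sign l` against `sign m`, as l
      -- = m + 1.
      U₁-E³ : U₁ (cube E) ≋[ l ] ⊖ (KS.ι (+ 3) ⊛ V (cube E))
      U₁-E³ = M.trans l (U₁-cong< l E³≋) (M.trans l (weaken (proj₁ (proj₂ (U-V _ _ _ K.refl))))
        (M.trans l (M.*-congˡ l (truncate (ℕₚ.m≤m*n l 3)
          (V-cong< l (M.+-cong l (M.*-congˡ l (der-theta m)) (M.-‿cong l (M.*-congˡ l (alt-theta m)))))))
          (weaken (K.trans (K.*-cong (sign-3 l) (V-cong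
            (KS.solve 2 (λ s e → let open KS in con (+ 3) :* (s :* e) :+ :- (con (+ 2) :* con (+ 0)) := s :*
            (con (+ 3) :* e)) K.refl (sign m) (cube E))))
             (K.trans (K.*-congˡ (K.trans (V-* (sign m) _)
               (K.*-cong (V-sign m) (K.trans (V-* _ _) (K.*-congʳ (V-ι (+ 3)))))))
               (K.trans (KS.solve 2 (λ s e → let open KS in (:- s) :* (s :* (con (+ 3) :* e)) := s :* s :*
                 (:- (con (+ 3) :* e))) K.refl (sign m) (V (cube E)))
                 (K.trans (K.*-congʳ (sign² m)) (K.*-identityˡ _))))))))

  -- The exponents ≡ 1 and 2 mod 3 in Jacobi's identity E³ = Σ (−1)ᵐ (2m+1) q^(m(m+1)/2).
  U₁-cube-E : U₁ (cube E) ≋ ⊖ (KS.ι (+ 3) ⊛ V (cube E))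
  U₁-cube-E = ≋-from-< λ N → truncate (ℕₚ.n≤1+n N) (U₁-E³ N)

  U₂-cube-E : U₂ (cube E) ≋ 0ˢ
  U₂-cube-E = ≋-from-< λ N → truncate (ℕₚ.n≤1+n N) (U₂-E³ N)

-- The constant term of H³.

module ConstTerm (R : Ring) (3-torsion-free : 3-TorsionFree R) where

  open Series R
  open Dissect R
  open Eta R
  open Jacobi R
  open import Algebra.Properties.Semiring.Exp K.semiring using (_^_)
  open Gauss seriesRing X
  private
    module G³ = Gauss seriesRing (V X)
    module ZR = CommutativeRing Z.seriesRing
    module ZS = Scalars Z.seriesRing
    module ZD = Dissect seriesRing

  ^-cube : ∀ n → V X ^ n ≋ cube (X ^ n)
  ^-cube n = K.trans (K.sym (V-^ X n)) (K.trans (K.sym (^-V n)) (^-*3 n))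

  H : ℕ → Z.Seq
  H n = prodA n Z.X Z.⊛ prodB n Z.X

  zcube : Z.Seq → Z.Seq
  zcube f = f Z.⊛ f Z.⊛ f

  private
    const-cube : ∀ f → Z.const (cube f) Z.≋ zcube (Z.const f)
    const-cube f = ZR.trans (Z.const-* _ _) (ZR.*-congʳ (Z.const-* _ _))

    -- The norm is taken in z here: the product of 1 + ωⁱ z q^a over the three i is 1 + z³ q^(3a),
    -- so q turns into q³.
    N-factorA : ∀ a → ZD.N (Z.const 1ˢ Z.⊕ Z.X Z.⊛ Z.const (X ^ a)) Z.≋ Z.const 1ˢ Z.⊕ Z.X Z.⊛ Z.const (V X ^ a)
    N-factorA a = ZR.trans (ZD.N-V (Z.const 1ˢ) (Z.const (X ^ a)) Z.0ˢ
      (ZR.sym (ZR.+-cong (ZD.V-const 1ˢ) (ZR.*-congˡ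
        (ZR.trans (ZR.+-cong (ZD.V-const (X ^ a)) (ZR.trans (ZR.*-congˡ ZD.V-0) (ZR.zeroʳ _))) (ZR.+-identityʳ _))))))
      (ZR.trans (ZS.solve 2 (λ c x → let open ZS in con (+ 1) :* con (+ 1) :* con (+ 1) :+ x :* (c :* c :* c) :+ x :*
        (x :* (con (+ 0) :* con (+ 0) :* con (+ 0))) :+ :- (con (+ 3) :* (x :* (con (+ 1) :* c :* con (+ 0)))) := con
        (+ 1) :+ x :* (c :* c :* c)) ZR.refl (Z.const (X ^ a)) Z.X)
        (ZR.+-congˡ (ZR.*-congˡ (ZR.trans (ZR.sym (const-cube (X ^ a))) (Z.const-cong (K.sym (^-cube a)))))))

    N-factorB : ∀ b → ZD.N (Z.const (X ^ b) Z.⊕ Z.X Z.⊛ Z.const 1ˢ) Z.≋ Z.const (V X ^ b) Z.⊕ Z.X Z.⊛ Z.const 1ˢ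
    N-factorB b = ZR.trans (ZD.N-V (Z.const (X ^ b)) (Z.const 1ˢ) Z.0ˢ
      (ZR.sym (ZR.+-cong (ZD.V-const (X ^ b)) (ZR.*-congˡ
        (ZR.trans (ZR.+-cong (ZD.V-const 1ˢ) (ZR.trans (ZR.*-congˡ ZD.V-0) (ZR.zeroʳ _))) (ZR.+-identityʳ _))))))
      (ZR.trans (ZS.solve 2 (λ c x → let open ZS in c :* c :* c :+ x :* (con (+ 1) :* con (+ 1) :* con (+ 1)) :+ x :*
        (x :* (con (+ 0) :* con (+ 0) :* con (+ 0))) :+ :- (con (+ 3) :* (x :* (c :* con (+ 1) :* con (+ 0))))
        := c :* c :* c :+ x :* con (+ 1)) ZR.refl (Z.const (X ^ b)) Z.X)
        (ZR.+-congʳ (ZR.trans (ZR.sym (const-cube (X ^ b))) (Z.const-cong (K.sym (^-cube b))))))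

    N-1 : ZD.N (Z.const 1ˢ) Z.≋ Z.const 1ˢ
    N-1 = ZR.trans (ZD.N-V (Z.const 1ˢ) Z.0ˢ Z.0ˢ
      (ZR.sym (ZR.trans (ZR.+-cong (ZD.V-const 1ˢ)
      (ZR.trans (ZR.*-congˡ (ZR.trans (ZR.+-cong ZD.V-0 (ZR.trans (ZR.*-congˡ ZD.V-0) (ZR.zeroʳ _)))
      (ZR.+-identityʳ _))) (ZR.zeroʳ _))) (ZR.+-identityʳ _))))
      (ZS.solve 1 (λ x → let open ZS in con (+ 1) :* con (+ 1) :* con (+ 1) :+ x :*
        (con (+ 0) :* con (+ 0) :* con (+ 0)) :+ x :* (x :* (con (+ 0) :* con (+ 0) :* con (+ 0))) :+ :-
        (con (+ 3) :* (x :* (con (+ 1) :* con (+ 0) :* con (+ 0)))) := con (+ 1)) ZR.refl Z.X)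

    N-prodA : ∀ a → ZD.N (prodA a Z.X) Z.≋ G³.prodA a Z.X
    N-prodA zero    = N-1
    N-prodA (suc a) = ZR.trans (ZD.N-* _ _) (ZR.*-cong (N-factorA (suc a)) (N-prodA a))

    N-prodB : ∀ b → ZD.N (prodB b Z.X) Z.≋ G³.prodB b Z.X
    N-prodB zero    = N-1
    N-prodB (suc b) = ZR.trans (ZD.N-* _ _) (ZR.*-cong (N-factorB b) (N-prodB b))

    tri-diag : ∀ n → G³.tri n n ≡ 0
    tri-diag zero    = ≡.refl
    tri-diag (suc n) = tri-diag n

    qfac-V : ∀ n → G³.qfac n ≋ V (qfac n)
    qfac-V zero    = K.sym (V-const A.1#)
    qfac-V (suc n) = K.trans (K.*-cong (qfac-V n)
      (K.sym (K.trans (V-+ _ _) (K.+-cong (V-const A.1#) (K.trans (V-⊖ _) (K.-‿cong (V-^ X (suc n))))))))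
      (K.sym (V-* _ _))

  central : ℕ → Seq
  central n = G³.gauss (n ℕ.+ n) n

  N-H : ∀ n → ZD.N (H n) n ≋ central n
  N-H n = K.trans (Z.at (ZR.trans (ZD.N-* _ _)
    (ZR.trans (ZR.*-cong (N-prodA n) (N-prodB n)) (ZR.trans (G³.prodA-prodB n n Z.X)
      (G³.eval-X (suc (n ℕ.+ n)) (G³.coefAB (n ℕ.+ n) n)
        (λ k l → K.trans (K.*-congˡ (G³.gauss-zero (n ℕ.+ n) k l)) (K.zeroʳ _)))))) n)
    (K.trans (K.*-congʳ (K.reflexive (≡.cong (V X ^_) (tri-diag n)))) (K.*-identityˡ _))

  -- As for `E-gauss`, at q³: the constant term of the norm of H tends to 1/E₃.
  VE-central : ∀ n → V E ⊛ central n ≋[ n ] 1ˢ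
  VE-central n = unit-cancel (K.trans (K.sym (V-* E E⁻¹)) (K.trans (V-cong E⊛E⁻¹) (V-const A.1#))) (begin
    V E ⊛ (V E ⊛ central n)               ≈⟨ weaken (K.sym (K.*-assoc (V E) (V E) _)) ⟩
    V E ⊛ V E ⊛ central n                 ≈⟨ Mn.*-congʳ (Mn.*-cong (VE n ℕₚ.≤-refl) (VE n ℕₚ.≤-refl)) ⟩
    G³.qfac n ⊛ G³.qfac n ⊛ central n     ≈⟨ weaken (G³.gauss-qfac n n) ⟩
    G³.qfac (n ℕ.+ n)                     ≈⟨ Mn.sym (VE (n ℕ.+ n) (ℕₚ.m≤m+n n n)) ⟩
    V E                                   ≈⟨ weaken (K.sym (K.*-identityʳ _)) ⟩
    V E ⊛ 1ˢ                              ∎)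
    where
    module Mn = CommutativeRing (ringMod n)
    open import Relation.Binary.Reasoning.Setoid Mn.setoid
    VE : ∀ m → n ℕ.≤ m → V E ≋[ n ] G³.qfac m
    VE m n≤m = Mn.trans (truncate (ℕₚ.≤-trans (ℕₚ.n≤1+n n) (ℕₚ.m≤m*n (suc n) 3)) (V-cong< (suc n) (E-qfac n≤m)))
      (weaken (K.sym (qfac-V m)))

  E-H : ∀ n k → E ⊛ H n k ≋[ n ] theta n k
  E-H n k = M.trans n (weaken (K.*-congˡ (Z.at (ZR.trans (prodA-prodB n n Z.X)
     (eval-X (suc (n ℕ.+ n)) (coefAB (n ℕ.+ n) n)
       (λ k l → K.trans (K.*-congˡ (gauss-zero (n ℕ.+ n) k l)) (K.zeroʳ _)))) k))) (E-coefAB n k)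

  private
    -- The substitution q ↦ q³ with z left alone.
    mapV : Z.Seq → Z.Seq
    mapV f k = V (f k)

    mapV-* : ∀ f g → mapV (f Z.⊛ g) Z.≋ mapV f Z.⊛ mapV g
    mapV-* f g = Z.ext (go f g)
      where
      go : ∀ f g n → V ((f Z.⊛ g) n) ≋ (mapV f Z.⊛ mapV g) n
      go f g zero    = V-* _ _
      go f g (suc n) = K.trans (V-+ _ _) (K.+-cong (V-* _ _) (go (Z.tail f) g n))

    mapV-+ : ∀ f g → mapV (f Z.⊕ g) Z.≋ mapV f Z.⊕ mapV g
    mapV-+ f g = Z.ext λ k → V-+ _ _

    mapV-X : mapV Z.X Z.≋ Z.X
    mapV-X = Z.ext λ { 0 → V-0 ; 1 → V-const A.1# ; (suc (suc n)) → V-0 }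

    mapV-const : ∀ f → mapV (Z.const f) Z.≋ Z.const (V f)
    mapV-const f = Z.ext λ { zero → K.refl ; (suc n) → V-0 }

    -- The norm is F - 3W, and the part of the cube with exponents of z divisible by 3 is F + 6W.
    F W : Z.Seq → Z.Seq → Z.Seq → Z.Seq
    F a b c = zcube a Z.⊕ Z.X Z.⊛ zcube b Z.⊕ Z.X Z.⊛ (Z.X Z.⊛ zcube c)
    W a b c = Z.X Z.⊛ (a Z.⊛ b Z.⊛ c)

    mapV-cube : ∀ f → mapV (zcube f) Z.≋ zcube (mapV f)
    mapV-cube f = ZR.trans (mapV-* _ _) (ZR.*-congʳ (mapV-* _ _))

    mapV-X* : ∀ f → mapV (Z.X Z.⊛ f) Z.≋ Z.X Z.⊛ mapV f
    mapV-X* f = ZR.trans (mapV-* _ _) (ZR.*-congʳ mapV-X)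

    E³-at : ∀ f n → (zcube (Z.const E) Z.⊛ f) n ≋ cube E ⊛ f n
    E³-at f n = K.trans (Z.at (ZR.*-congʳ (ZR.sym (const-cube E))) n) (Z.const-⊛ (cube E) f n)

    module _ (l : ℕ) where
      n : ℕ
      n = suc (l ℕ.* 3)

      private
        module Mn = CommutativeRing (ringMod n)
        module ZM = Series (ringMod n)
        module ZMR = CommutativeRing ZM.seriesRing

      u₀ u₁ u₂ θ₀ θ₁ θ₂ : Z.Seq
      u₀ = ZD.U₀ (H n)
      u₁ = ZD.U₁ (H n)
      u₂ = ZD.U₂ (H n)
      θ₀ k = X ^ proj₁ (theta-0 l k)
      θ₁ k = X ^ proj₁ (theta-1 l k)
      θ₂ k = V (theta l k)

      f w f″ w″ : Seq
      f  = F u₀ u₁ u₂ n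
      w  = W u₀ u₁ u₂ n
      f″ = (zcube θ₀ Z.⊕ Z.X Z.⊛ zcube θ₁ Z.⊕ Z.X Z.⊛ (Z.X Z.⊛ (Z.const X Z.⊛ zcube θ₂))) n
      w″ = W θ₀ θ₁ θ₂ n

      -- The triple product turns each third of `H n` into a theta series with exponents in a single
      -- class mod 3, namely 0, 0 and 1. Hence the cubes live on exponents ≡ 0 and the mixed product
      -- on exponents ≡ 1.
      Eu : ∀ {i u θ} → (∀ k → u k ≡ every i (H n) k) → (∀ k → every i (theta n) k ≋ θ k) → (Z.const E Z.⊛ u) ZM.≋ θ
      Eu {i} p t = ZM.ext λ k → Mn.trans (weaken (K.trans (Z.const-⊛ E _ k) (K.*-congˡ (K.reflexive (p k)))))
        (Mn.trans (E-H n (i ℕ.+ k ℕ.* 3)) (weaken (t k)))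

      Eu₀ : (Z.const E Z.⊛ u₀) ZM.≋ mapV θ₀
      Eu₀ = Eu {0} (ZD.U₀-at (H n)) (λ k → proj₂ (theta-0 l k))

      Eu₁ : (Z.const E Z.⊛ u₁) ZM.≋ mapV θ₁
      Eu₁ = Eu {1} (ZD.U₀-at (Z.tail (H n))) (λ k → proj₂ (theta-1 l k))

      Eu₂ : (Z.const E Z.⊛ u₂) ZM.≋ (Z.const X Z.⊛ mapV θ₂)
      Eu₂ = Eu {2} (ZD.U₀-at (Z.tail (Z.tail (H n)))) (λ k → K.trans (theta-2 l k) (K.sym (Z.const-⊛ X (mapV θ₂) k)))

      E³w : cube E ⊛ w ≋[ n ] X ⊛ V w″
      E³w = Mn.trans (weaken (K.trans (K.sym (E³-at _ n))
        (Z.at (ZS.solve 5 (λ e x a b c → let open ZS in e :* e :* e :* (x :* (a :* b :* c)) := x :*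
        ((e :* a) :* (e :* b) :* (e :* c))) ZR.refl (Z.const E) Z.X u₀ u₁ u₂) n)))
        (Mn.trans (ZM.at (ZMR.*-congˡ {Z.X} (ZMR.*-cong (ZMR.*-cong Eu₀ Eu₁) Eu₂)) n)
        (weaken (K.trans (Z.at (ZS.solve 5 (λ q x a b c → let open ZS in x :* (a :* b :* (q :* c)) := q :*
          (x :* (a :* b :* c))) ZR.refl (Z.const X) Z.X (mapV θ₀) (mapV θ₁) (mapV θ₂)) n)
          (K.trans (Z.const-⊛ X _ n) (K.*-congˡ (K.sym
            (Z.at (ZR.trans (mapV-X* _) (ZR.*-congˡ (ZR.trans (mapV-* _ _) (ZR.*-congʳ (mapV-* _ _))))) n)))))))

      E³f : cube E ⊛ f ≋[ n ] V f″
      E³f = Mn.trans (weaken (K.trans (K.sym (E³-at _ n))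
        (Z.at (ZS.solve 5 (λ e x a b c → let open ZS; cub = λ a → a :* a :* a in
               e :* e :* e :* (cub a :+ x :* cub b :+ x :* (x :* cub c)) := cub (e :* a) :+ x :* cub (e :* b) :+ x :*
                 (x :* cub (e :* c))) ZR.refl (Z.const E) Z.X u₀ u₁ u₂) n)))
        (Mn.trans (ZM.at (ZMR.+-cong (ZMR.+-cong (cb Eu₀) (ZMR.*-congˡ {Z.X} (cb Eu₁)))
          (ZMR.*-congˡ {Z.X} (ZMR.*-congˡ {Z.X} (cb Eu₂)))) n)
        (weaken (K.sym (Z.at (ZR.trans (mapV-+ _ _) (ZR.+-cong
          (ZR.trans (mapV-+ _ _) (ZR.+-cong (mapV-cube θ₀) (ZR.trans (mapV-X* _) (ZR.*-congˡ (mapV-cube θ₁)))))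
             (ZR.trans (mapV-X* _) (ZR.*-congˡ (ZR.trans (mapV-X* _)
               (ZR.*-congˡ (ZR.trans (mapV-* _ _) (ZR.trans (ZR.*-cong VX (mapV-cube θ₂))
               (ZS.solve 2 (λ x c → let open ZS in x :* x :* x :* (c :* c :* c) := x :* c :* (x :* c) :*
                 (x :* c)) ZR.refl (Z.const X) (mapV θ₂)))))))))) n))))
        where
        cb : ∀ {a b} → a ZM.≋ b → zcube a ZM.≋ zcube b
        cb p = ZMR.*-cong (ZMR.*-cong p p) p
        VX : mapV (Z.const X) Z.≋ zcube (Z.const X)
        VX = ZR.trans (mapV-const X) (ZR.trans (Z.const-cong (K.trans V-X (K.sym (K.*-assoc X X X)))) (const-cube X))

      central-fw : f ⊕ ⊖ (KS.ι (+ 3) ⊛ w) ≋ central n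
      central-fw = K.trans (K.+-congˡ (K.-‿cong (K.sym (Z.ι-⊛ (+ 3) (W u₀ u₁ u₂) n)))) (N-H n)

      H³ : zcube (H n) (n ℕ.* 3) ≋ central n ⊕ KS.ι (+ 9) ⊛ w
      H³ = K.trans (K.reflexive (≡.sym (ZD.U₀-at (zcube (H n)) n)))
        (K.trans (Z.at (ZD.U₀-cube (H n)) n) (K.+-cong (N-H n) (Z.ι-⊛ (+ 9) (W u₀ u₁ u₂) n)))

      -- The factor 1 is replaced by E₃(f - 3w), from the norm of H. As E³f and E³w lie in different
      -- residue classes, this dissects E³.
      E³-dissect : cube E ≋[ n ] V (E ⊛ f″) ⊕ X ⊛ (V (⊖ (KS.ι (+ 3) ⊛ (E ⊛ w″))) ⊕ X ⊛ V 0ˢ)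
      E³-dissect = begin
        cube E
          ≈⟨ weaken (K.sym (K.*-identityʳ _)) ⟩
        cube E ⊛ 1ˢ
          ≈⟨ Mn.*-congˡ (Mn.sym (Mn.trans (Mn.*-congˡ (weaken central-fw)) (VE-central n))) ⟩
        cube E ⊛ (V E ⊛ (f ⊕ ⊖ (KS.ι (+ 3) ⊛ w)))
          ≈⟨ weaken (KS.solve 4 (λ c v f w → let open KS in c :* (v :* (f :+ :- (con (+ 3) :* w))) := v :*
            (c :* f :+ :- (con (+ 3) :* (c :* w)))) K.refl (cube E) (V E) f w) ⟩
        V E ⊛ (cube E ⊛ f ⊕ ⊖ (KS.ι (+ 3) ⊛ (cube E ⊛ w)))
          ≈⟨ Mn.*-congˡ (Mn.+-cong E³f (Mn.-‿cong (Mn.*-congˡ E³w))) ⟩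
        V E ⊛ (V f″ ⊕ ⊖ (KS.ι (+ 3) ⊛ (X ⊛ V w″)))
          ≈⟨ weaken (KS.solve 4 (λ v f x w → let open KS in v :* (f :+ :- (con (+ 3) :* (x :* w))) := v :* f :+ x :*
            (:- (con (+ 3) :* (v :* w)) :+ x :* con (+ 0))) K.refl (V E) (V f″) X (V w″)) ⟩
        V E ⊛ V f″ ⊕ X ⊛ (⊖ (KS.ι (+ 3) ⊛ (V E ⊛ V w″)) ⊕ X ⊛ 0ˢ)
          ≈⟨ weaken (K.sym (K.+-cong (V-* E f″) (K.*-congˡ
            (K.+-cong (K.trans (V-⊖ _) (K.-‿cong (K.trans (V-* _ _) (K.*-cong (V-ι (+ 3)) (V-* E w″)))))
            (K.*-congˡ V-0))))) ⟩
        V (E ⊛ f″) ⊕ X ⊛ (V (⊖ (KS.ι (+ 3) ⊛ (E ⊛ w″))) ⊕ X ⊛ V 0ˢ) ∎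
        where open import Relation.Binary.Reasoning.Setoid Mn.setoid

      cancel-3 : ∀ {N a b} → ⊖ (KS.ι (+ 3) ⊛ a) ≋[ N ] ⊖ (KS.ι (+ 3) ⊛ b) → a ≋[ N ] b
      cancel-3 {N} {a} {b} p = ext< λ k k<N → x∙y⁻¹≈ε⇒x≈y (a k) (b k)
        (3-torsion-free _ (A.trans (A.sym (ι-⊛ (+ 3) (a ⊕ ⊖ b) k)) (at< diff k k<N)))
        where
        open Algebra.Properties.AbelianGroup A.+-abelianGroup using (x∙y⁻¹≈ε⇒x≈y)
        diff : KS.ι (+ 3) ⊛ (a ⊕ ⊖ b) ≋[ N ] 0ˢ
        diff = M.trans N (weaken (KS.solve 2 (λ a b → let open KS in con (+ 3) :* (a :+ :- b) := :- (con (+ 3) :* b)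
          :+ :- (:- (con (+ 3) :* a))) K.refl a b))
          (M.trans N (M.+-congˡ N (M.-‿cong N p)) (M.-‿inverseʳ N _))

      -- The part of E³ with exponents ≡ 1 is known twice, from `E³-dissect` and from Jacobi's
      -- series; division by -3 determines w.
      E-w″ : V (cube E) ≋[ l ] E ⊛ w″
      E-w″ = cancel-3 (M.trans l (weaken (K.sym U₁-cube-E))
        (M.trans l (U₁-cong< l (truncate (ℕₚ.n≤1+n _) E³-dissect)) (weaken (proj₁ (proj₂ (U-V _ _ _ K.refl))))))

      constant-term : cube E ⊛ (V E ⊛ zcube (H n) (n ℕ.* 3)) ≋[ l ℕ.* 3 ] cube E ⊕ KS.ι (+ 9) ⊛ (X ⊛ V (V (cube E)))
      constant-term = begin
        cube E ⊛ (V E ⊛ zcube (H n) (n ℕ.* 3))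
          ≈⟨ weaken (K.*-congˡ (K.*-congˡ H³)) ⟩
        cube E ⊛ (V E ⊛ (central n ⊕ KS.ι (+ 9) ⊛ w))
          ≈⟨ weaken (KS.solve 4 (λ c v g w → let open KS in c :* (v :* (g :+ con (+ 9) :* w)) := c :* (v :* g) :+ con
            (+ 9) :* (v :* (c :* w))) K.refl (cube E) (V E) (central n) w) ⟩
        cube E ⊛ (V E ⊛ central n) ⊕ KS.ι (+ 9) ⊛ (V E ⊛ (cube E ⊛ w))
          ≈⟨ Mw.+-cong (Mw.*-congˡ (truncate w≤n (VE-central n))) (Mw.*-congˡ (Mw.*-congˡ (truncate w≤n E³w))) ⟩
        cube E ⊛ 1ˢ ⊕ KS.ι (+ 9) ⊛ (V E ⊛ (X ⊛ V w″))
          ≈⟨ weaken (KS.solve 4 (λ c v x w → let open KS in c :* con (+ 1) :+ con (+ 9) :* (v :* (x :* w)) := c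
            :+ con (+ 9) :* (x :* (v :* w))) K.refl (cube E) (V E) X (V w″)) ⟩
        cube E ⊕ KS.ι (+ 9) ⊛ (X ⊛ (V E ⊛ V w″))
          ≈⟨ Mw.+-congˡ (Mw.*-congˡ (Mw.*-congˡ (Mw.sym (Mw.trans (V-cong< l E-w″) (weaken (V-* E w″)))))) ⟩
        cube E ⊕ KS.ι (+ 9) ⊛ (X ⊛ V (V (cube E))) ∎
        where
        module Mw = CommutativeRing (ringMod (l ℕ.* 3))
        open import Relation.Binary.Reasoning.Setoid Mw.setoid
        w≤n : l ℕ.* 3 ℕ.≤ n
        w≤n = ℕₚ.n≤1+n _

  constant-term-H³ : ∀ l → let n = suc (l ℕ.* 3) in cube E ⊛ (V E ⊛ zcube (H n) (n ℕ.* 3)) ≋[ l ℕ.* 3 ] cube E ⊕ KS.ι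
    (+ 9) ⊛ (X ⊛ V (V (cube E)))
  constant-term-H³ = constant-term

-- From counts of colored rows to coefficients of H³.

module Frobenius (R : Ring) (3-torsion-free : 3-TorsionFree R) where

  open Series R
  open Dissect R
  open Adic R
  open Eta R
  open ConstTerm R 3-torsion-free
  open import Algebra.Properties.Semiring.Exp K.semiring using (_^_)
  open Gauss seriesRing X
  private
    module S = Scalars R
    module ZR = CommutativeRing Z.seriesRing
    module ZS = Scalars Z.seriesRing

  ιℕ : ℕ → A.Carrier
  ιℕ n = S.ι (+ n)

  module Sums (R : Ring) where
    open CommutativeRing R hiding (zero)
    Σ< : ℕ → (ℕ → Carrier) → Carrier
    Σ< zero    f = 0#
    Σ< (suc n) f = f 0 + Σ< n (f ∘ suc)

    Σ<-cong : ∀ n {f g} → (∀ i → i < n → f i ≈ g i) → Σ< n f ≈ Σ< n g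
    Σ<-cong zero    p = refl
    Σ<-cong (suc n) p = +-cong (p 0 (s≤s z≤n)) (Σ<-cong n (λ i i<n → p (suc i) (s≤s i<n)))

    Σ<-extend : ∀ m d {f} → (∀ i → m ℕ.≤ i → f i ≈ 0#) → Σ< (m ℕ.+ d) f ≈ Σ< m f
    Σ<-extend zero    zero    p = refl
    Σ<-extend zero    (suc d) p = trans (+-cong (p 0 z≤n) (Σ<-extend zero d (λ i _ → p (suc i) z≤n))) (+-identityˡ _)
    Σ<-extend (suc m) d       p = +-congˡ (Σ<-extend m d (λ i m≤i → p (suc i) (s≤s m≤i)))

    ⊛-Σ< : ∀ f g n → Series._⊛_ R f g n ≈ Σ< (suc n) (λ i → f i * g (n ∸ i))
    ⊛-Σ< f g zero    = sym (+-identityʳ _)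
    ⊛-Σ< f g (suc n) = +-congˡ (⊛-Σ< (f ∘ suc) g n)

  open Sums

  private
    ιℕ-+ : ∀ m n → ιℕ (m ℕ.+ n) A.≈ ιℕ m A.+ ιℕ n
    ιℕ-+ m n = S.ι-+ (+ m) (+ n)

    ιℕ-* : ∀ m n → ιℕ (m ℕ.* n) A.≈ ιℕ m A.* ιℕ n
    ιℕ-* m n = A.trans (A.reflexive (≡.cong S.ι (ℤₚ.pos-* m n))) (S.ι-* (+ m) (+ n))

    ιℕ-sum : ∀ (f g : ℕ → ℕ) n → ιℕ (sum (map f (applyUpTo g n))) A.≈ Σ< R n (ιℕ ∘ f ∘ g)
    ιℕ-sum f g zero    = A.refl
    ιℕ-sum f g (suc n) = A.trans (ιℕ-+ (f (g 0)) _) (A.+-congˡ (ιℕ-sum f (g ∘ suc) n))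

    ιℕ-Σ≤ : ∀ m (f : ℕ → ℕ) → ιℕ (Σ≤ m f) A.≈ Σ< R (suc m) (ιℕ ∘ f)
    ιℕ-Σ≤ m f = ιℕ-sum f (λ i → i) (suc m)

    Σ<-at : ∀ n (f : ℕ → Seq) s → Σ< seriesRing n f s A.≈ Σ< R n (λ i → f i s)
    Σ<-at zero    f s = A.refl
    Σ<-at (suc n) f s = A.+-congˡ (Σ<-at n (f ∘ suc) s)

    ≤ᵇ-true : ∀ {m n} → m ℕ.≤ n → (m ≤ᵇ n) ≡ true
    ≤ᵇ-true {m} {n} m≤n with m ≤ᵇ n | ℕₚ.≤⇒≤ᵇ m≤n
    ... | true | _ = ≡.refl

    ≤ᵇ-false : ∀ {m n} → n < m → (m ≤ᵇ n) ≡ false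
    ≤ᵇ-false {m} {n} n<m with m ≤ᵇ n | ℕₚ.≤ᵇ⇒≤ m n
    ... | false | _ = ≡.refl
    ... | true  | p with () ← ℕₚ.<⇒≱ n<m (p _)

    div-3 : ∀ i a → (i ℕ.+ a ℕ.* 3) / 3 ≡ i / 3 ℕ.+ a
    div-3 i a = ≡.trans (+-distrib-/-∣ʳ i (n∣m*n a)) (≡.cong (i / 3 ℕ.+_) (m*n/n≡m a 3))

  -- As a series in z this is the product of 1 + z q^⌊i/3⌋ over the codes i < b.
  rows : ℕ → Z.Seq
  rows b r s = ιℕ (choose 3 b r s)

  private
    X^-choose : ∀ e (g : ℕ → ℕ) s → (X ^ e ⊛ (ιℕ ∘ g)) s A.≈ ιℕ (if e ≤ᵇ s then g (s ∸ e) else 0)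
    X^-choose e g s with ℕₚ.≤-<-connex e s
    ... | inj₁ e≤s rewrite ≤ᵇ-true e≤s = A.trans (A.reflexive (≡.cong (X ^ e ⊛ (ιℕ ∘ g)) (≡.sym (ℕₚ.m+[n∸m]≡n e≤s))))
      (X^⊛-at e (ιℕ ∘ g) (s ∸ e))
    ... | inj₂ s<e rewrite ≤ᵇ-false s<e = at< (X^⊛-zero e (ιℕ ∘ g)) s s<e

    rows-suc : ∀ b r → rows (suc b) r ≋ times 1ˢ (X ^ (b / 3)) (rows b) r
    rows-suc b zero    = K.sym (K.*-identityˡ _)
    rows-suc b (suc r) = K.trans (ext λ s → A.trans (ιℕ-+ (choose 3 b (suc r) s) _)
      (A.+-congˡ (A.sym (X^-choose (b / 3) (choose 3 b r) s))))
      (K.+-congʳ (K.sym (K.*-identityˡ _)))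

    rows-0 : ∀ r → rows 0 r ≋ Z.const 1ˢ r
    rows-0 zero    = ext λ { zero → A.refl ; (suc s) → A.refl }
    rows-0 (suc r) = ext λ s → A.refl

    rows-zero : ∀ b r → b < r → rows b r ≋ 0ˢ
    rows-zero zero    (suc r) l       = K.refl
    rows-zero (suc b) (suc r) (s≤s l) = K.trans (rows-suc b (suc r))
      (K.trans (K.+-cong (K.*-congˡ (rows-zero b (suc r) (ℕₚ.m≤n⇒m≤1+n l))) (K.*-congˡ (rows-zero b r l)))
        (K.trans (K.+-cong (K.zeroʳ _) (K.zeroʳ _)) (K.+-identityˡ _)))

    times-cong : ∀ u w {f g} → f Z.≋ g → ∀ k → times u w f k ≋ times u w g k
    times-cong u w p zero    = K.*-congˡ (Z.at p 0)
    times-cong u w p (suc k) = K.+-cong (K.*-congˡ (Z.at p (suc k))) (K.*-congˡ (Z.at p k))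

    factorA factorB : ℕ → Z.Seq
    factorA a = Z.const 1ˢ Z.⊕ Z.X Z.⊛ Z.const (X ^ suc a)
    factorB b = Z.const (X ^ b) Z.⊕ Z.X Z.⊛ Z.const 1ˢ

    -- `rowsA` gives every entry one extra unit of weight, which accounts for the r in n = r + Σ(aᵢ
    -- + bᵢ). In `rowsB` the variable z marks the codes left out of the row, so index j belongs to
    -- rows of length b - j.
    rowsA rowsB : ℕ → Z.Seq
    rowsA zero    = Z.const 1ˢ
    rowsA (suc b) = factorA (b / 3) Z.⊛ rowsA b
    rowsB zero    = Z.const 1ˢ
    rowsB (suc b) = factorB (b / 3) Z.⊛ rowsB b

    rowsA-rows : ∀ b r → rowsA b r ≋ X ^ r ⊛ rows b r
    rowsA-rows zero    zero    = K.sym (K.trans (K.*-identityˡ _) (rows-0 0))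
    rowsA-rows zero    (suc r) = K.sym (K.trans (K.*-congˡ (rows-0 (suc r))) (K.zeroʳ _))
    rowsA-rows (suc b) r = K.trans (Z.at (times-at 1ˢ (X ^ suc (b / 3)) (rowsA b)) r)
      (K.trans (times-cong 1ˢ (X ^ suc (b / 3)) (Z.ext (rowsA-rows b)) r)
        (K.trans (scale r) (K.*-congˡ (K.sym (rows-suc b r)))))
      where
      scale : ∀ r → times 1ˢ (X ^ suc (b / 3)) (λ r → X ^ r ⊛ rows b r) r ≋ X ^ r ⊛ times 1ˢ (X ^ (b / 3)) (rows b) r
      scale zero    = KS.solve 1 (λ c → let open KS in con (+ 1) :* (con (+ 1) :* c) := con (+ 1) :*
        (con (+ 1) :* c)) K.refl _
      scale (suc r) = KS.solve 5 (λ x y z c d → let open KS in con (+ 1) :* (x :* y :* c) :+ x :* z :* (y :* d)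
        := x :* y :* (con (+ 1) :* c :+ z :* d)) K.refl X (X ^ r) (X ^ (b / 3)) _ _

    rowsB-zero : ∀ b j → b < j → rowsB b j ≋ 0ˢ
    rowsB-zero zero    (suc j) l       = K.refl
    rowsB-zero (suc b) (suc j) (s≤s l) = K.trans (Z.at (times-at (X ^ (b / 3)) 1ˢ (rowsB b)) (suc j))
      (K.trans (K.+-cong (K.*-congˡ (rowsB-zero b (suc j) (ℕₚ.m≤n⇒m≤1+n l))) (K.*-congˡ (rowsB-zero b j l)))
        (K.trans (K.+-cong (K.zeroʳ _) (K.zeroʳ _)) (K.+-identityˡ _)))

    rowsB-rows : ∀ b r j → r ℕ.+ j ≡ b → rowsB b j ≋ rows b r
    rowsB-rows zero    zero    zero    p = K.sym (rows-0 0)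
    rowsB-rows (suc b) r       j       p = K.trans (Z.at (times-at (X ^ (b / 3)) 1ˢ (rowsB b)) j)
      (K.trans (step r j p) (K.sym (rows-suc b r)))
      where
      step : ∀ r j → r ℕ.+ j ≡ suc b → times (X ^ (b / 3)) 1ˢ (rowsB b) j ≋ times 1ˢ (X ^ (b / 3)) (rows b) r
      step zero    (suc j) p = K.trans (K.+-cong (K.trans
        (K.*-congˡ (rowsB-zero b (suc j) (ℕₚ.≤-reflexive (≡.sym p)))) (K.zeroʳ _))
        (K.*-congˡ (rowsB-rows b 0 j (ℕₚ.suc-injective p)))) (K.+-identityˡ _)
      step (suc r) zero    p = K.trans (K.*-congˡ (rowsB-rows b r 0 (ℕₚ.suc-injective p)))
        (K.sym (K.trans (K.+-congʳ (K.trans (K.*-congˡ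
          (rows-zero b (suc r) (ℕₚ.≤-reflexive (≡.trans (≡.sym p) (ℕₚ.+-identityʳ _))))) (K.zeroʳ _)))
          (K.+-identityˡ _)))
      step (suc r) (suc j) p = K.trans (K.+-cong (K.*-congˡ (rowsB-rows b r (suc j) (ℕₚ.suc-injective p)))
        (K.*-congˡ (rowsB-rows b (suc r) j (≡.trans (≡.sym (ℕₚ.+-suc r j)) (ℕₚ.suc-injective p))))) (K.+-comm _ _)

    -- Three consecutive codes, one per color, share the value ⌊i/3⌋.
    rowsA-cube : ∀ a → rowsA (a ℕ.* 3) Z.≋ zcube (prodA a Z.X)
    rowsA-cube zero    = ZR.sym (ZR.trans (ZR.*-identityʳ _) (ZR.*-identityʳ _))
    rowsA-cube (suc a) rewrite div-3 0 a | div-3 1 a | div-3 2 a = ZR.trans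
      (ZR.*-congˡ (ZR.*-congˡ (ZR.*-congˡ (rowsA-cube a))))
      (ZS.solve 2 (λ f p → let open ZS in f :* (f :* (f :* (p :* p :* p))) := (f :* p) :* (f :* p) :*
        (f :* p)) ZR.refl (factorA a) (prodA a Z.X))

    rowsB-cube : ∀ b → rowsB (b ℕ.* 3) Z.≋ zcube (prodB b Z.X)
    rowsB-cube zero    = ZR.sym (ZR.trans (ZR.*-identityʳ _) (ZR.*-identityʳ _))
    rowsB-cube (suc b) rewrite div-3 0 b | div-3 1 b | div-3 2 b = ZR.trans
      (ZR.*-congˡ (ZR.*-congˡ (ZR.*-congˡ (rowsB-cube b))))
      (ZS.solve 2 (λ f p → let open ZS in f :* (f :* (f :* (p :* p :* p))) := (f :* p) :* (f :* p) :*
        (f :* p)) ZR.refl (factorB b) (prodB b Z.X))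

    -- Index b pairs a top row of length r with b - r omitted codes of the bottom row, that is, with
    -- a bottom row of the same length.
    H³-Σ< : ∀ n → let b = n ℕ.* 3 in zcube (H n) b ≋ Σ< seriesRing (suc b) (λ r → X ^ r ⊛ (rows b r ⊛ rows b r))
    H³-Σ< n = K.trans (Z.at (ZR.trans (ZS.solve 2
      (λ a b → let open ZS in (a :* b) :* (a :* b) :* (a :* b) := (a :* a :* a) :* (b :* b :* b)) ZR.refl
      (prodA n Z.X) (prodB n Z.X))
        (ZR.*-cong (ZR.sym (rowsA-cube n)) (ZR.sym (rowsB-cube n)))) b)
      (K.trans (⊛-Σ< seriesRing (rowsA b) (rowsB b) b) (Σ<-cong seriesRing (suc b) (λ r r<1+b →
        K.trans (K.*-cong (rowsA-rows b r) (rowsB-rows b r (b ∸ r) (ℕₚ.m+[n∸m]≡n (ℕₚ.≤-pred r<1+b))))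
          (K.*-assoc _ _ _))))
      where
      b : ℕ
      b = n ℕ.* 3

    -- Codes from b₀ on have underlying integer at least b₀ / 3, more than the available weight s.
    choose-stable : ∀ b₀ d r s → s < b₀ / 3 → choose 3 (d ℕ.+ b₀) r s ≡ choose 3 b₀ r s
    choose-stable b₀ zero    r       s l = ≡.refl
    choose-stable b₀ (suc d) zero    s l = choose-stable b₀ d zero s l
    choose-stable b₀ (suc d) (suc r) s l
      rewrite ≤ᵇ-false (ℕₚ.<-≤-trans l (/-monoˡ-≤ 3 (ℕₚ.m≤n+m b₀ d))) = ≡.trans (ℕₚ.+-identityʳ _)
        (choose-stable b₀ d (suc r) s l)

  frobenius : Seq
  frobenius n = ιℕ (cφ 3 n)

  private
    module _ {n N : ℕ} (n<N : n < N) where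
      b₀ b : ℕ
      b₀ = 3 ℕ.* suc n
      b  = N ℕ.* 3

      pairs : ℕ → ℕ → ℕ
      pairs r s = choose 3 b₀ r s ℕ.* choose 3 b₀ r ((n ∸ r) ∸ s)

      b₀/3 : b₀ / 3 ≡ suc n
      b₀/3 = ≡.trans (≡.cong (_/ 3) (ℕₚ.*-comm 3 (suc n))) (m*n/n≡m (suc n) 3)

      b₀≤b : b₀ ℕ.≤ b
      b₀≤b = ℕₚ.≤-trans (ℕₚ.≤-reflexive (ℕₚ.*-comm 3 (suc n))) (ℕₚ.*-monoˡ-≤ 3 n<N)

      rows-stable : ∀ r → rows b₀ r ≋[ suc n ] rows b r
      rows-stable r = ext< λ s s<1+n → A.reflexive
        (≡.cong ιℕ (≡.sym (≡.trans (≡.cong (λ b → choose 3 b r s) (≡.sym (ℕₚ.m∸n+n≡m b₀≤b)))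
        (choose-stable b₀ (b ∸ b₀) r s (ℕₚ.<-≤-trans s<1+n (ℕₚ.≤-reflexive (≡.sym b₀/3)))))))

      row-pairs : ∀ r → r < suc n → ιℕ (Σ≤ (n ∸ r) (pairs r)) A.≈ (X ^ r ⊛ (rows b r ⊛ rows b r)) n
      row-pairs r r<1+n = begin
        ιℕ (Σ≤ (n ∸ r) (pairs r))                                            ≈⟨ ιℕ-Σ≤ (n ∸ r) (pairs r) ⟩
        Σ< R (suc (n ∸ r)) (λ s → ιℕ (pairs r s))                            ≈⟨ Σ<-cong R (suc (n ∸ r))
          (λ s _ → ιℕ-* (choose 3 b₀ r s) (choose 3 b₀ r (n ∸ r ∸ s))) ⟩
        Σ< R (suc (n ∸ r)) (λ s → rows b₀ r s A.* rows b₀ r (n ∸ r ∸ s))     ≈⟨ A.sym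
          (⊛-Σ< R (rows b₀ r) (rows b₀ r) (n ∸ r)) ⟩
        (rows b₀ r ⊛ rows b₀ r) (n ∸ r)                                      ≈⟨ at<
          (M.*-cong (suc n) (rows-stable r) (rows-stable r)) (n ∸ r) (s≤s (ℕₚ.m∸n≤m n r)) ⟩
        (rows b r ⊛ rows b r) (n ∸ r)                                        ≈⟨ A.sym
          (X^⊛-at r (rows b r ⊛ rows b r) (n ∸ r)) ⟩
        (X ^ r ⊛ (rows b r ⊛ rows b r)) (r ℕ.+ (n ∸ r))                      ≡⟨ ≡.cong
          (X ^ r ⊛ (rows b r ⊛ rows b r)) (ℕₚ.m+[n∸m]≡n (ℕₚ.≤-pred r<1+n)) ⟩
        (X ^ r ⊛ (rows b r ⊛ rows b r)) n                                    ∎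
        where open import Relation.Binary.Reasoning.Setoid A.setoid

      -- `cφ` admits codes below 3(n + 1), `H N` codes below 3N; by `choose-stable` they agree for
      -- weights up to n, and rows longer than n are killed by X^r.
      frobenius-at : frobenius n A.≈ zcube (H N) b n
      frobenius-at = begin
        frobenius n                                                              ≈⟨ ιℕ-Σ≤ n
          (λ r → Σ≤ (n ∸ r) (pairs r)) ⟩
        Σ< R (suc n) (λ r → ιℕ (Σ≤ (n ∸ r) (pairs r)))                           ≈⟨ Σ<-cong R (suc n) row-pairs ⟩
        Σ< R (suc n) (λ r → (X ^ r ⊛ (rows b r ⊛ rows b r)) n)                   ≈⟨ A.sym
          (Σ<-extend R (suc n) (b ∸ n) (λ r n<r → at< (X^⊛-zero r (rows b r ⊛ rows b r)) n n<r)) ⟩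
        Σ< R (suc (n ℕ.+ (b ∸ n))) (λ r → (X ^ r ⊛ (rows b r ⊛ rows b r)) n)     ≡⟨ ≡.cong
          (λ k → Σ< R (suc k) (λ r → (X ^ r ⊛ (rows b r ⊛ rows b r)) n))
          (ℕₚ.m+[n∸m]≡n (ℕₚ.≤-trans (ℕₚ.<⇒≤ n<N) (ℕₚ.m≤m*n N 3))) ⟩
        Σ< R (suc b) (λ r → (X ^ r ⊛ (rows b r ⊛ rows b r)) n)                   ≈⟨ A.sym
          (Σ<-at (suc b) (λ r → X ^ r ⊛ (rows b r ⊛ rows b r)) n) ⟩
        Σ< seriesRing (suc b) (λ r → X ^ r ⊛ (rows b r ⊛ rows b r)) n            ≈⟨ A.sym (at (H³-Σ< N) n) ⟩
        zcube (H N) b n                                                          ∎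
        where open import Relation.Binary.Reasoning.Setoid A.setoid

  frobenius-≋ : ∀ N → frobenius ≋[ N ] zcube (H N) (N ℕ.* 3)
  frobenius-≋ N = ext< λ n n<N → frobenius-at n<N

  frobenius-E : cube E ⊛ (V E ⊛ frobenius) ≋ cube E ⊕ KS.ι (+ 9) ⊛ (X ⊛ V (V (cube E)))
  frobenius-E = ≋-from-< λ N → truncate (ℕₚ.m≤m*n N 3) (M.trans (N ℕ.* 3)
    (M.*-congˡ (N ℕ.* 3) (M.*-congˡ (N ℕ.* 3) (truncate (ℕₚ.n≤1+n _) (frobenius-≋ (suc (N ℕ.* 3))))))
      (constant-term-H³ N))

-- Relations between E₁, E₃, E₉, and the dissections of τ and τ².

module Tower (R : Ring) (3-torsion-free : 3-TorsionFree R) where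

  open Series R
  open Dissect R
  open Adic R
  open Eta R
  open Jacobi R
  open Frobenius R 3-torsion-free
  open import Relation.Binary.Reasoning.Setoid K.setoid
  private module S = Scalars R

  ιK : ℕ → Seq
  ιK n = KS.ι (+ n)

  private
    cancel-leading-3 : ∀ s y → s 0 A.≈ S.ι (+ 3) → s ⊛ y ≋ 0ˢ → y ≋ 0ˢ
    cancel-leading-3 s y s0 p = ≋-from-< go
      where
      product-at : ∀ n → y ≋[ n ] 0ˢ → (s ⊛ y) n A.≈ s 0 A.* y n
      product-at zero    y≋0 = A.refl
      product-at (suc n) y≋0 = A.trans (A.+-congˡ (at<
        (M.trans (suc n) (M.*-congˡ (suc n) y≋0) (M.zeroʳ (suc n) (tail s))) n ℕₚ.≤-refl)) (A.+-identityʳ _)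
      go : ∀ n → y ≋[ n ] 0ˢ
      go zero    = empty
      go (suc n) = ext< λ k k<1+n → case (ℕₚ.m≤n⇒m<n∨m≡n (ℕₚ.≤-pred k<1+n))
        where
        case : ∀ {k} → k < n ⊎ k ≡ n → y k A.≈ A.0#
        case (inj₁ k<n)    = at< (go n) _ k<n
        case (inj₂ ≡.refl) = 3-torsion-free _ (A.trans (A.*-congʳ (A.sym s0))
          (A.trans (A.sym (product-at n (go n))) (at p n)))

  -- In a³ - b³ = (a² + ab + b²)(a - b) the first factor has constant term 3, so it can be
  -- cancelled.
  cube-root : ∀ a b → a 0 A.≈ A.1# → b 0 A.≈ A.1# → cube a ≋ cube b → a ≋ b
  cube-root a b a0 b0 p = x∙y⁻¹≈ε⇒x≈y a b (cancel-leading-3 (a ⊛ a ⊕ a ⊛ b ⊕ b ⊛ b) (a ⊕ ⊖ b)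
    (A.trans (A.+-cong (A.+-cong (A.*-cong a0 a0) (A.*-cong a0 b0)) (A.*-cong b0 b0))
      (S.solve 0 (let open S in con (+ 1) :* con (+ 1) :+ con (+ 1) :* con (+ 1) :+ con (+ 1) :* con (+ 1) := con
        (+ 3)) A.refl))
    (K.trans (KS.solve 2 (λ a b → let open KS in (a :* a :+ a :* b :+ b :* b) :* (a :+ :- b) := a :* a :* a :+ :-
      (b :* b :* b)) K.refl a b)
      (x≈y⇒x∙y⁻¹≈ε p)))
    where open Algebra.Properties.Group K.+-group using (x∙y⁻¹≈ε⇒x≈y; x≈y⇒x∙y⁻¹≈ε)

  U-V* : ∀ v f → (U₀ (V v ⊛ f) ≋ v ⊛ U₀ f) × (U₁ (V v ⊛ f) ≋ v ⊛ U₁ f) × (U₂ (V v ⊛ f) ≋ v ⊛ U₂ f)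
  U-V* v f = U-V _ _ _ (begin
    V v ⊛ f
      ≈⟨ K.*-congˡ (dissect f) ⟩
    V v ⊛ (V (U₀ f) ⊕ X ⊛ (V (U₁ f) ⊕ X ⊛ V (U₂ f)))
      ≈⟨ KS.solve 5 (λ v a b c x → let open KS in v :* (a :+ x :* (b :+ x :* c)) := v :* a :+ x :*
        (v :* b :+ x :* (v :* c))) K.refl (V v) _ _ _ X ⟩
    V v ⊛ V (U₀ f) ⊕ X ⊛ (V v ⊛ V (U₁ f) ⊕ X ⊛ (V v ⊛ V (U₂ f)))
      ≈⟨ K.sym (K.+-cong (V-* _ _) (K.*-congˡ (K.+-cong (V-* _ _) (K.*-congˡ (V-* _ _))))) ⟩
    V (v ⊛ U₀ f) ⊕ X ⊛ (V (v ⊛ U₁ f) ⊕ X ⊛ V (v ⊛ U₂ f)) ∎)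

  U₀-X : ∀ f → U₀ (X ⊛ f) ≋ X ⊛ U₂ f
  U₀-X f = K.trans (U₀-cong (X⊛ f)) (K.trans (ext λ { zero → A.refl ; (suc n) → A.refl }) (K.sym (X⊛ (U₂ f))))

  U₂-X : ∀ f → U₂ (X ⊛ f) ≋ U₁ f
  U₂-X f = U₂-cong (X⊛ f)

  private
    V-inverse : ∀ {u v} → u ⊛ v ≋ 1ˢ → V u ⊛ V v ≋ 1ˢ
    V-inverse p = K.trans (K.sym (V-* _ _)) (K.trans (V-cong p) (V-const A.1#))

    -- The ring solver cannot use a relation such as `x ⊛ J ≋ 1ˢ`. The product is carried through
    -- polynomial identities as an extra factor, to be inserted or removed by `pad` and `collapse`.
    pad : ∀ {u} → u ≋ 1ˢ → ∀ f → f ≋ f ⊛ u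
    pad p f = K.sym (K.trans (K.*-congˡ p) (K.*-identityʳ f))

    collapse : ∀ {u} → u ≋ 1ˢ → ∀ a b c → a ⊛ (u ⊛ u ⊛ u) ⊕ b ⊛ (u ⊛ u) ⊕ c ⊛ u ≋ a ⊕ b ⊕ c
    collapse p a b c = K.+-cong (K.+-cong (K.trans (K.*-congˡ (K.trans (K.*-cong (u² p) p) (K.*-identityˡ _)))
      (K.*-identityʳ a)) (K.trans (K.*-congˡ (u² p)) (K.*-identityʳ b)))
      (K.sym (pad p c))
      where
      u² : ∀ {u} → u ≋ 1ˢ → u ⊛ u ≋ 1ˢ
      u² p = K.trans (K.*-cong p p) (K.*-identityˡ _)

  -- With E_k = E(q^k): x, c, d = E₁³, E₃³, E₉³ with inverses J, g, h, and y = 1/E₃.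
  x c d J g h y β p : Seq
  x = cube E
  c = V x
  d = V c
  J = cube E⁻¹
  g = V J
  h = V g
  y = V E⁻¹
  β = X ⊛ d
  p = U₀ x

  -- `κ` and `κ′` are the factors common to the parts of τ and τ² with exponents ≡ 2 and ≡ 1
  -- respectively.
  τ t κ κ′ : Seq
  τ  = β ⊛ J
  t  = X ⊛ (c ⊛ c ⊛ c ⊛ c) ⊛ (J ⊛ J ⊛ J ⊛ J)
  κ  = c ⊛ c ⊛ c ⊛ p ⊛ (J ⊛ J ⊛ J ⊛ J)
  κ′ = c ⊛ c ⊛ (p ⊛ p) ⊛ (J ⊛ J ⊛ J ⊛ J)

  private
    V-cube : ∀ f → V (cube f) ≋ cube (V f)
    V-cube f = K.trans (V-* _ _) (K.*-congʳ (V-* _ _))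

    V-⁴ : ∀ f → V (f ⊛ f ⊛ f ⊛ f) ≋ V f ⊛ V f ⊛ V f ⊛ V f
    V-⁴ f = K.trans (V-* _ _) (K.*-congʳ (V-cube f))

    xJ : x ⊛ J ≋ 1ˢ
    xJ = K.trans (KS.solve 2 (λ e i → let open KS in e :* e :* e :* (i :* i :* i) := e :* i :* (e :* i) :*
      (e :* i)) K.refl E E⁻¹)
      (K.trans (K.*-cong (K.trans (K.*-cong E⊛E⁻¹ E⊛E⁻¹) (K.*-identityˡ _)) E⊛E⁻¹) (K.*-identityˡ _))

    cg : c ⊛ g ≋ 1ˢ
    cg = V-inverse xJ

    dh : d ⊛ h ≋ 1ˢ
    dh = V-inverse cg

    Vy : V E ⊛ y ≋ 1ˢ
    Vy = V-inverse E⊛E⁻¹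

    x-dissect : x ≋ V p ⊕ X ⊛ (V (⊖ (KS.ι (+ 3) ⊛ c)) ⊕ X ⊛ V 0ˢ)
    x-dissect = K.trans (dissect x) (K.+-congˡ (K.*-congˡ
      (K.+-cong (V-cong U₁-cube-E) (K.*-congˡ (V-cong U₂-cube-E)))))

    Vp : V p ≋ x ⊕ KS.ι (+ 3) ⊛ β
    Vp = K.sym (K.trans (K.+-congʳ (K.trans x-dissect
      (K.+-congˡ (K.*-congˡ (K.+-cong (K.trans (V-⊖ _) (K.-‿cong (K.trans (V-* _ _) (K.*-congʳ (V-ι (+ 3))))))
      (K.*-congˡ V-0))))))
      (KS.solve 3 (λ p x d → let open KS in (p :+ x :* (:- (con (+ 3) :* d) :+ x :* con (+ 0))) :+ con (+ 3) :*
        (x :* d) := p) K.refl (V p) X d))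

    -- The norm of E³ in two ways: its dissection gives p³ - 27qE₃⁹, and `N-E` gives (E₁⁴/E₃)³.
    c-p³ : c ⊛ cube p ≋ x ⊛ x ⊛ x ⊛ x ⊕ KS.ι (+ 27) ⊛ (X ⊛ (c ⊛ c ⊛ c ⊛ c))
    c-p³ = begin
      c ⊛ cube p
        ≈⟨ KS.solve 3 (λ c p x → let open KS; b = :- (con (+ 3) :* c) in c :* (p :* p :* p) :=
             c :* (p :* p :* p :+ x :* (b :* b :* b) :+ x :* (x :* (con (+ 0) :* con (+ 0) :* con (+ 0))) :+ :-
               (con (+ 3) :* (x :* (p :* b :* con (+ 0))))) :+ con (+ 27) :* (x :* (c :* c :* c :* c))) K.refl c p X ⟩
      c ⊛ norm p (⊖ (KS.ι (+ 3) ⊛ c)) 0ˢ ⊕ KS.ι (+ 27) ⊛ (X ⊛ (c ⊛ c ⊛ c ⊛ c))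
        ≈⟨ K.+-congʳ (K.*-cong (V-cube E) (K.trans (K.sym (N-V _ _ _ x-dissect))
          (K.trans (N-* _ _) (K.*-congʳ (N-* _ _))))) ⟩
      cube (V E) ⊛ cube (N E) ⊕ KS.ι (+ 27) ⊛ (X ⊛ (c ⊛ c ⊛ c ⊛ c))
        ≈⟨ K.+-congʳ (KS.solve 2 (λ v n → let open KS in v :* v :* v :* (n :* n :* n) := n :* v :* (n :* v) :*
          (n :* v)) K.refl (V E) (N E)) ⟩
      cube (N E ⊛ V E) ⊕ KS.ι (+ 27) ⊛ (X ⊛ (c ⊛ c ⊛ c ⊛ c))
        ≈⟨ K.+-congʳ (K.*-cong (K.*-cong N-E N-E) N-E) ⟩
      cube (E ⊛ x) ⊕ KS.ι (+ 27) ⊛ (X ⊛ (c ⊛ c ⊛ c ⊛ c))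
        ≈⟨ K.+-congʳ (KS.solve 2 (λ e x → let open KS in e :* x :* (e :* x) :* (e :* x)
          := e :* e :* e :* x :* x :* x) K.refl E x) ⟩
      x ⊛ x ⊛ x ⊛ x ⊕ KS.ι (+ 27) ⊛ (X ⊛ (c ⊛ c ⊛ c ⊛ c)) ∎

    -- `c-p³` at q³, where p(q³) = x + 3β by the dissection of E³; the terms 27dβ³ and 27q³d⁴
    -- cancel.
    c⁴ : c ⊛ c ⊛ c ⊛ c ≋ d ⊛ (x ⊛ x ⊛ x ⊕ KS.ι (+ 9) ⊛ (x ⊛ x ⊛ β) ⊕ KS.ι (+ 27) ⊛ (x ⊛ β ⊛ β))
    c⁴ = begin
      c ⊛ c ⊛ c ⊛ c
        ≈⟨ K.sym (V-⁴ x) ⟩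
      V (x ⊛ x ⊛ x ⊛ x)
        ≈⟨ KS.solve 2 (λ w z → let open KS in w := (w :+ z) :+ :- z) K.refl (V (x ⊛ x ⊛ x ⊛ x))
          (V (KS.ι (+ 27) ⊛ (X ⊛ (c ⊛ c ⊛ c ⊛ c)))) ⟩
      (V (x ⊛ x ⊛ x ⊛ x) ⊕ V (KS.ι (+ 27) ⊛ (X ⊛ (c ⊛ c ⊛ c ⊛ c)))) ⊕ ⊖ V (KS.ι (+ 27) ⊛ (X ⊛ (c ⊛ c ⊛ c ⊛ c)))
        ≈⟨ K.+-cong (K.trans (K.sym (V-+ _ _)) (K.trans (V-cong (K.sym c-p³)) (V-* _ _)))
             (K.-‿cong (K.trans (V-* _ _) (K.*-cong (V-ι (+ 27)) (K.trans (V-* _ _) (K.*-cong V-X (V-⁴ c)))))) ⟩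
      d ⊛ V (cube p) ⊕ ⊖ (KS.ι (+ 27) ⊛ (X ⊛ (X ⊛ X) ⊛ (d ⊛ d ⊛ d ⊛ d)))
        ≈⟨ K.+-congʳ (K.*-congˡ (K.trans (V-cube p) (K.*-cong (K.*-cong Vp Vp) Vp))) ⟩
      d ⊛ cube (x ⊕ KS.ι (+ 3) ⊛ β) ⊕ ⊖ (KS.ι (+ 27) ⊛ (X ⊛ (X ⊛ X) ⊛ (d ⊛ d ⊛ d ⊛ d)))
        ≈⟨ KS.solve 3 (λ x d q → let open KS; b = q :* d; a = x :+ con (+ 3) :* b in
             d :* (a :* a :* a) :+ :- (con (+ 27) :* (q :* (q :* q) :* (d :* d :* d :* d))) := d :*
               (x :* x :* x :+ con (+ 9) :* (x :* x :* b) :+ con (+ 27) :* (x :* b :* b))) K.refl x d X ⟩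
      d ⊛ (x ⊛ x ⊛ x ⊕ KS.ι (+ 9) ⊛ (x ⊛ x ⊛ β) ⊕ KS.ι (+ 27) ⊛ (x ⊛ β ⊛ β)) ∎

    cg⁴ : ∀ f → f ≋ f ⊛ (g ⊛ g ⊛ g ⊛ g) ⊛ (c ⊛ c ⊛ c ⊛ c)
    cg⁴ f = K.trans (pad cg f) (K.trans (pad cg _) (K.trans (pad cg _) (K.trans (pad cg _)
      (KS.solve 3 (λ f c g → let open KS in f :* (c :* g) :* (c :* g) :* (c :* g) :* (c :* g) := f :*
        (g :* g :* g :* g) :* (c :* c :* c :* c)) K.refl f c g))))

    -- `c⁴` divided by x³ and by its left side: E₁⁻⁹ is a series in q³ times a quadratic in τ.
    J³ : cube J ≋ d ⊛ (g ⊛ g ⊛ g ⊛ g) ⊛ (1ˢ ⊕ KS.ι (+ 9) ⊛ τ ⊕ KS.ι (+ 27) ⊛ (τ ⊛ τ))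
    J³ = begin
      cube J
        ≈⟨ cg⁴ (cube J) ⟩
      cube J ⊛ (g ⊛ g ⊛ g ⊛ g) ⊛ (c ⊛ c ⊛ c ⊛ c)
        ≈⟨ K.*-congˡ c⁴ ⟩
      cube J ⊛ (g ⊛ g ⊛ g ⊛ g) ⊛ (d ⊛ (x ⊛ x ⊛ x ⊕ KS.ι (+ 9) ⊛ (x ⊛ x ⊛ β) ⊕ KS.ι (+ 27) ⊛ (x ⊛ β ⊛ β)))
        ≈⟨ KS.solve 5 (λ j γ d x b → let open KS; u = x :* j in
             j :* j :* j :* γ :* (d :* (x :* x :* x :+ con (+ 9) :* (x :* x :* b) :+ con (+ 27) :* (x :* b :* b))) :=
             d :* γ :* (con (+ 1) :* (u :* u :* u) :+ con (+ 9) :* (b :* j) :* (u :* u) :+ con (+ 27) :*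
               ((b :* j) :* (b :* j)) :* u)) K.refl J (g ⊛ g ⊛ g ⊛ g) d x β ⟩
      d ⊛ (g ⊛ g ⊛ g ⊛ g) ⊛ (1ˢ ⊛ (x ⊛ J ⊛ (x ⊛ J) ⊛ (x ⊛ J)) ⊕ KS.ι (+ 9) ⊛ τ ⊛ (x ⊛ J ⊛ (x ⊛ J)) ⊕ KS.ι (+ 27) ⊛
        (τ ⊛ τ) ⊛ (x ⊛ J))
        ≈⟨ K.*-congˡ (collapse xJ _ _ _) ⟩
      d ⊛ (g ⊛ g ⊛ g ⊛ g) ⊛ (1ˢ ⊕ KS.ι (+ 9) ⊛ τ ⊕ KS.ι (+ 27) ⊛ (τ ⊛ τ)) ∎

    Vt : V t ≋ cube β ⊛ (d ⊛ (g ⊛ g ⊛ g ⊛ g))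
    Vt = K.trans (V-* _ _) (K.trans (K.*-cong (K.trans (V-* _ _) (K.*-cong V-X (V-⁴ c))) (V-⁴ J))
      (KS.solve 3 (λ q d γ → let open KS; b = q :* d in q :* (q :* q) :* (d :* d :* d :* d) :* γ := b :* b :* b :*
        (d :* γ)) K.refl X d (g ⊛ g ⊛ g ⊛ g)))

  τ³ : cube τ ≋ V t ⊛ (1ˢ ⊕ KS.ι (+ 9) ⊛ τ ⊕ KS.ι (+ 27) ⊛ (τ ⊛ τ))
  τ³ = begin
    cube (β ⊛ J)
      ≈⟨ KS.solve 2 (λ b j → let open KS in b :* j :* (b :* j) :* (b :* j) := b :* b :* b :*
        (j :* j :* j)) K.refl β J ⟩
    cube β ⊛ cube J
      ≈⟨ K.trans (K.*-congˡ J³) (K.sym (K.*-assoc _ _ _)) ⟩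
    cube β ⊛ (d ⊛ (g ⊛ g ⊛ g ⊛ g)) ⊛ (1ˢ ⊕ KS.ι (+ 9) ⊛ τ ⊕ KS.ι (+ 27) ⊛ (τ ⊛ τ))
      ≈⟨ K.*-congʳ (K.sym Vt) ⟩
    V t ⊛ (1ˢ ⊕ KS.ι (+ 9) ⊛ τ ⊕ KS.ι (+ 27) ⊛ (τ ⊛ τ)) ∎

  t-τ : t ≋ τ ⊛ (1ˢ ⊕ KS.ι (+ 9) ⊛ τ ⊕ KS.ι (+ 27) ⊛ (τ ⊛ τ))
  t-τ = begin
    X ⊛ (c ⊛ c ⊛ c ⊛ c) ⊛ (J ⊛ J ⊛ J ⊛ J)
      ≈⟨ K.*-congʳ (K.*-congˡ c⁴) ⟩
    X ⊛ (d ⊛ (x ⊛ x ⊛ x ⊕ KS.ι (+ 9) ⊛ (x ⊛ x ⊛ β) ⊕ KS.ι (+ 27) ⊛ (x ⊛ β ⊛ β))) ⊛ (J ⊛ J ⊛ J ⊛ J)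
      ≈⟨ KS.solve 4 (λ q d x j → let open KS; b = q :* d; u = x :* j; τ = b :* j in
           q :* (d :* (x :* x :* x :+ con (+ 9) :* (x :* x :* b) :+ con (+ 27) :* (x :* b :* b))) :*
             (j :* j :* j :* j) :=
           τ :* (u :* u :* u) :+ con (+ 9) :* (τ :* τ) :* (u :* u) :+ con (+ 27) :*
             (τ :* τ :* τ) :* u) K.refl X d x J ⟩
    τ ⊛ (x ⊛ J ⊛ (x ⊛ J) ⊛ (x ⊛ J)) ⊕ KS.ι (+ 9) ⊛ (τ ⊛ τ) ⊛ (x ⊛ J ⊛ (x ⊛ J)) ⊕ KS.ι (+ 27) ⊛ (τ ⊛ τ ⊛ τ) ⊛ (x ⊛ J)
      ≈⟨ collapse xJ _ _ _ ⟩
    τ ⊕ KS.ι (+ 9) ⊛ (τ ⊛ τ) ⊕ KS.ι (+ 27) ⊛ (τ ⊛ τ ⊛ τ)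
      ≈⟨ KS.solve 1 (λ τ → let open KS in τ :+ con (+ 9) :* (τ :* τ) :+ con (+ 27) :* (τ :* τ :* τ) := τ :*
        (con (+ 1) :+ con (+ 9) :* τ :+ con (+ 27) :* (τ :* τ))) K.refl τ ⟩
    τ ⊛ (1ˢ ⊕ KS.ι (+ 9) ⊛ τ ⊕ KS.ι (+ 27) ⊛ (τ ⊛ τ)) ∎

  private
    -- both sides have the same cube, by c-p³ and c⁴
    E₃-p : V E ⊛ p ≋ E ⊛ (x ⊕ KS.ι (+ 9) ⊛ β)
    E₃-p = cube-root _ _ (A.trans (A.*-cong A.refl
      (A.trans (A.*-cong (A.*-cong A.refl A.refl) A.refl) (A.trans (A.*-identityʳ _) (A.*-identityʳ _))))
      (A.*-identityʳ _))
      (A.trans (A.*-congˡ (A.trans (A.+-cong (A.trans (A.*-identityʳ _) (A.*-identityʳ _))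
        (A.trans (A.*-congˡ (A.zeroˡ _)) (A.zeroʳ _))) (A.+-identityʳ _))) (A.*-identityʳ _))
      (≋-from-< λ N → unit-cancel dh (weaken (begin
        d ⊛ cube (V E ⊛ p)
          ≈⟨ K.*-congˡ (KS.solve 2 (λ v p → let open KS in v :* p :* (v :* p) :* (v :* p) := v :* v :* v :*
            (p :* p :* p)) K.refl (V E) p) ⟩
        d ⊛ (cube (V E) ⊛ cube p)
          ≈⟨ K.*-congˡ (K.trans (K.*-congʳ (K.sym (V-cube E))) c-p³) ⟩
        d ⊛ (x ⊛ x ⊛ x ⊛ x ⊕ KS.ι (+ 27) ⊛ (X ⊛ (c ⊛ c ⊛ c ⊛ c)))
          ≈⟨ K.*-congˡ (K.+-congˡ (K.*-congˡ (K.*-congˡ c⁴))) ⟩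
        d ⊛ (x ⊛ x ⊛ x ⊛ x ⊕ KS.ι (+ 27) ⊛ (X ⊛ (d ⊛
          (x ⊛ x ⊛ x ⊕ KS.ι (+ 9) ⊛ (x ⊛ x ⊛ β) ⊕ KS.ι (+ 27) ⊛ (x ⊛ β ⊛ β)))))
          ≈⟨ KS.solve 3 (λ d x q → let open KS; b = q :* d; s = x :+ con (+ 9) :* b in
               d :* (x :* x :* x :* x :+ con (+ 27) :* (q :*
                 (d :* (x :* x :* x :+ con (+ 9) :* (x :* x :* b) :+ con (+ 27) :* (x :* b :* b))))) := d :*
                 (x :* (s :* s :* s))) K.refl d x X ⟩
        d ⊛ (x ⊛ cube (x ⊕ KS.ι (+ 9) ⊛ β))
          ≈⟨ K.*-congˡ (KS.solve 2 (λ e s → let open KS in e :* e :* e :* (s :* s :* s) := e :* s :* (e :* s) :*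
            (e :* s)) K.refl E (x ⊕ KS.ι (+ 9) ⊛ β)) ⟩
        d ⊛ cube (E ⊛ (x ⊕ KS.ι (+ 9) ⊛ β)) ∎)))

    x+9β : x ⊕ KS.ι (+ 9) ⊛ β ≋ x ⊛ (1ˢ ⊕ KS.ι (+ 9) ⊛ τ)
    x+9β = K.trans (K.+-congˡ (pad xJ (KS.ι (+ 9) ⊛ β)))
      (KS.solve 3 (λ x b j → let open KS in x :+ con (+ 9) :* b :* (x :* j) := x :*
        (con (+ 1) :+ con (+ 9) :* (b :* j))) K.refl x β J)

    p-τ : p ≋ y ⊛ (E ⊛ (x ⊛ (1ˢ ⊕ KS.ι (+ 9) ⊛ τ)))
    p-τ = begin
      p                                             ≈⟨ pad Vy p ⟩
      p ⊛ (V E ⊛ y)                                 ≈⟨ KS.solve 3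
        (λ p v y → let open KS in p :* (v :* y) := y :* (v :* p)) K.refl p (V E) y ⟩
      y ⊛ (V E ⊛ p)                                 ≈⟨ K.*-congˡ (K.trans E₃-p (K.*-congˡ x+9β)) ⟩
      y ⊛ (E ⊛ (x ⊛ (1ˢ ⊕ KS.ι (+ 9) ⊛ τ)))         ∎

  frobenius-τ : frobenius ≋ y ⊛ (1ˢ ⊕ KS.ι (+ 9) ⊛ τ)
  frobenius-τ = begin
    frobenius
      ≈⟨ K.trans (pad xJ _) (pad Vy _) ⟩
    frobenius ⊛ (x ⊛ J) ⊛ (V E ⊛ y)
      ≈⟨ KS.solve 5 (λ f x j v y → let open KS in f :* (x :* j) :* (v :* y) := y :* j :*
        (x :* (v :* f))) K.refl frobenius x J (V E) y ⟩
    y ⊛ J ⊛ (x ⊛ (V E ⊛ frobenius))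
      ≈⟨ K.*-congˡ (K.trans frobenius-E x+9β) ⟩
    y ⊛ J ⊛ (x ⊛ (1ˢ ⊕ KS.ι (+ 9) ⊛ τ))
      ≈⟨ KS.solve 4 (λ x j y s → let open KS in y :* j :* (x :* s) := y :* s :* (x :* j)) K.refl x J y
        (1ˢ ⊕ KS.ι (+ 9) ⊛ τ) ⟩
    y ⊛ (1ˢ ⊕ KS.ι (+ 9) ⊛ τ) ⊛ (x ⊛ J)
      ≈⟨ K.sym (pad xJ _) ⟩
    y ⊛ (1ˢ ⊕ KS.ι (+ 9) ⊛ τ) ∎

  -- Splits the first prefactor into a series in q³, which passes through the `Uᵢ`, and a polynomial
  -- in τ: 1 + 9τ comes from p, the quadratic from `J³`.
  E⁻¹κ : E⁻¹ ⊛ κ ≋ V (c ⊛ J ⊛ E⁻¹) ⊛ ((1ˢ ⊕ KS.ι (+ 9) ⊛ τ ⊕ KS.ι (+ 27) ⊛ (τ ⊛ τ)) ⊛ (1ˢ ⊕ KS.ι (+ 9) ⊛ τ))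
  E⁻¹κ = begin
    E⁻¹ ⊛ (c ⊛ c ⊛ c ⊛ p ⊛ (J ⊛ J ⊛ J ⊛ J))
      ≈⟨ K.*-congˡ (K.*-congʳ (K.*-congˡ p-τ)) ⟩
    E⁻¹ ⊛ (c ⊛ c ⊛ c ⊛ (y ⊛ (E ⊛ (x ⊛ s))) ⊛ (J ⊛ J ⊛ J ⊛ J))
      ≈⟨ KS.solve 7 (λ i c y e x s j → let open KS in i :*
        (c :* c :* c :* (y :* (e :* (x :* s))) :* (j :* j :* j :* j)) := c :* c :* c :* y :* (j :* j :* j) :* s :*
        (e :* i) :* (x :* j)) K.refl E⁻¹ c y E x s J ⟩
    c ⊛ c ⊛ c ⊛ y ⊛ cube J ⊛ s ⊛ (E ⊛ E⁻¹) ⊛ (x ⊛ J)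
      ≈⟨ K.sym (K.trans (pad E⊛E⁻¹ _) (pad xJ _)) ⟩
    c ⊛ c ⊛ c ⊛ y ⊛ cube J ⊛ s
      ≈⟨ K.*-congʳ (K.*-congˡ J³) ⟩
    c ⊛ c ⊛ c ⊛ y ⊛ (d ⊛ (g ⊛ g ⊛ g ⊛ g) ⊛ r) ⊛ s
      ≈⟨ KS.solve 6 (λ c y d g r s → let open KS in c :* c :* c :* y :* (d :* (g :* g :* g :* g) :* r) :* s
        := d :* g :* y :* (r :* s) :* (c :* g) :* (c :* g) :* (c :* g)) K.refl c y d g r s ⟩
    d ⊛ g ⊛ y ⊛ (r ⊛ s) ⊛ (c ⊛ g) ⊛ (c ⊛ g) ⊛ (c ⊛ g)
      ≈⟨ K.sym (K.trans (pad cg _) (K.trans (pad cg _) (pad cg _))) ⟩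
    d ⊛ g ⊛ y ⊛ (r ⊛ s)
      ≈⟨ K.*-congʳ (K.sym (K.trans (V-* _ _) (K.*-congʳ (V-* _ _)))) ⟩
    V (c ⊛ J ⊛ E⁻¹) ⊛ (r ⊛ s) ∎
    where
    r s : Seq
    s = 1ˢ ⊕ KS.ι (+ 9) ⊛ τ
    r = 1ˢ ⊕ KS.ι (+ 9) ⊛ τ ⊕ KS.ι (+ 27) ⊛ (τ ⊛ τ)

  -- The second prefactor needs an extra q to complete t. This shift makes class 1 at the second
  -- kind of level play the role of class 2 at the first.
  X-cJE⁻¹κ : X ⊛ (c ⊛ J ⊛ E⁻¹ ⊛ κ) ≋ V E⁻¹ ⊛ (t ⊛ (1ˢ ⊕ KS.ι (+ 9) ⊛ τ))
  X-cJE⁻¹κ = begin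
    X ⊛ (c ⊛ J ⊛ E⁻¹ ⊛ (c ⊛ c ⊛ c ⊛ p ⊛ (J ⊛ J ⊛ J ⊛ J)))
      ≈⟨ K.*-congˡ (K.*-congˡ (K.*-congʳ (K.*-congˡ p-τ))) ⟩
    X ⊛ (c ⊛ J ⊛ E⁻¹ ⊛ (c ⊛ c ⊛ c ⊛ (y ⊛ (E ⊛ (x ⊛ s))) ⊛ (J ⊛ J ⊛ J ⊛ J)))
      ≈⟨ KS.solve 8 (λ q i c y e x s j → let open KS in q :*
        (c :* j :* i :* (c :* c :* c :* (y :* (e :* (x :* s))) :* (j :* j :* j :* j))) := y :*
        (q :* (c :* c :* c :* c) :* (j :* j :* j :* j) :* s) :* (e :* i) :* (x :* j)) K.refl X E⁻¹ c y E x s J ⟩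
    y ⊛ (t ⊛ s) ⊛ (E ⊛ E⁻¹) ⊛ (x ⊛ J)
      ≈⟨ K.sym (K.trans (pad E⊛E⁻¹ _) (pad xJ _)) ⟩
    y ⊛ (t ⊛ s) ∎
    where
    s : Seq
    s = 1ˢ ⊕ KS.ι (+ 9) ⊛ τ

  private
    -- With α = `V p` one has x = α - 3β, and α³ - 27β³ = c⁴/d is a series in q³; so 1/x is α² + 3αβ
    -- + 9β² over a series in q³.
    J-α : J ≋ d ⊛ (g ⊛ g ⊛ g ⊛ g) ⊛ (V p ⊛ V p ⊕ KS.ι (+ 3) ⊛ (V p ⊛ β) ⊕ KS.ι (+ 9) ⊛ (β ⊛ β))
    J-α = begin
      J
        ≈⟨ cg⁴ J ⟩
      J ⊛ (g ⊛ g ⊛ g ⊛ g) ⊛ (c ⊛ c ⊛ c ⊛ c)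
        ≈⟨ K.*-congˡ c⁴ ⟩
      J ⊛ (g ⊛ g ⊛ g ⊛ g) ⊛ (d ⊛ (x ⊛ x ⊛ x ⊕ KS.ι (+ 9) ⊛ (x ⊛ x ⊛ β) ⊕ KS.ι (+ 27) ⊛ (x ⊛ β ⊛ β)))
        ≈⟨ KS.solve 5 (λ j γ d x b → let open KS; a = x :+ con (+ 3) :* b in
             j :* γ :* (d :* (x :* x :* x :+ con (+ 9) :* (x :* x :* b) :+ con (+ 27) :* (x :* b :* b))) :=
             d :* γ :* (a :* a :+ con (+ 3) :* (a :* b) :+ con (+ 9) :* (b :* b)) :* (x :* j)) K.refl J
               (g ⊛ g ⊛ g ⊛ g) d x β ⟩
      d ⊛ (g ⊛ g ⊛ g ⊛ g) ⊛ ((x ⊕ KS.ι (+ 3) ⊛ β) ⊛ (x ⊕ KS.ι (+ 3) ⊛ β) ⊕ KS.ι (+ 3) ⊛ ((x ⊕ KS.ι (+ 3) ⊛ β) ⊛ β)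
        ⊕ KS.ι (+ 9) ⊛ (β ⊛ β)) ⊛ (x ⊛ J)
        ≈⟨ K.sym (pad xJ _) ⟩
      d ⊛ (g ⊛ g ⊛ g ⊛ g) ⊛ ((x ⊕ KS.ι (+ 3) ⊛ β) ⊛ (x ⊕ KS.ι (+ 3) ⊛ β) ⊕ KS.ι (+ 3) ⊛ ((x ⊕ KS.ι (+ 3) ⊛ β) ⊛ β)
        ⊕ KS.ι (+ 9) ⊛ (β ⊛ β))
        ≈⟨ K.*-congˡ (K.+-congʳ (K.+-cong (K.*-cong (K.sym Vp) (K.sym Vp)) (K.*-congˡ (K.*-congʳ (K.sym Vp))))) ⟩
      d ⊛ (g ⊛ g ⊛ g ⊛ g) ⊛ (V p ⊛ V p ⊕ KS.ι (+ 3) ⊛ (V p ⊛ β) ⊕ KS.ι (+ 9) ⊛ (β ⊛ β)) ∎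

    τ-dissect : τ ≋ V (KS.ι (+ 9) ⊛ t) ⊕ X ⊛ (V κ′ ⊕ X ⊛ V (KS.ι (+ 3) ⊛ κ))
    τ-dissect = begin
      β ⊛ J
        ≈⟨ K.*-congˡ J-α ⟩
      β ⊛ (d ⊛ γ ⊛ (V p ⊛ V p ⊕ KS.ι (+ 3) ⊛ (V p ⊛ β) ⊕ KS.ι (+ 9) ⊛ (β ⊛ β)))
        ≈⟨ KS.solve 4 (λ q d γ a → let open KS; b = q :* d in
             b :* (d :* γ :* (a :* a :+ con (+ 3) :* (a :* b) :+ con (+ 9) :* (b :* b))) :=
             con (+ 9) :* (b :* b :* b :* (d :* γ)) :+ q :*
               (d :* d :* (a :* a) :* γ :+ q :* (con (+ 3) :* (d :* d :* d :* a :* γ)))) K.refl X d γ (V p) ⟩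
      KS.ι (+ 9) ⊛ (cube β ⊛ (d ⊛ γ)) ⊕ X ⊛ (d ⊛ d ⊛ (V p ⊛ V p) ⊛ γ ⊕ X ⊛ (KS.ι (+ 3) ⊛ (d ⊛ d ⊛ d ⊛ V p ⊛ γ)))
        ≈⟨ K.sym (K.+-cong (K.trans (V-* _ _) (K.*-cong (V-ι (+ 9)) Vt)) (K.*-congˡ (K.+-cong
             (K.trans (V-* _ _) (K.*-cong (K.trans (V-* _ _) (K.*-cong (V-* _ _) (V-* _ _))) Vγ))
             (K.*-congˡ (K.trans (V-* _ _) (K.*-cong (V-ι (+ 3))
               (K.trans (V-* _ _) (K.*-cong (K.trans (V-* _ _) (K.*-congʳ (V-cube c))) Vγ)))))))) ⟩
      V (KS.ι (+ 9) ⊛ t) ⊕ X ⊛ (V κ′ ⊕ X ⊛ V (KS.ι (+ 3) ⊛ κ)) ∎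
      where
      γ : Seq
      γ = g ⊛ g ⊛ g ⊛ g
      Vγ : V (J ⊛ J ⊛ J ⊛ J) ≋ γ
      Vγ = V-⁴ J

    J⁴ : Seq
    J⁴ = J ⊛ J ⊛ J ⊛ J

    -- Closes the system under products: it gives qκκ′ = t(1 + 27t) and κ′² = κ(1 + 27t), while qκ²
    -- = tκ′ follows from the definitions.
    c-p³-J⁴ : c ⊛ cube p ⊛ J⁴ ≋ 1ˢ ⊕ KS.ι (+ 27) ⊛ t
    c-p³-J⁴ = K.trans (K.*-congʳ c-p³) (K.trans
      (KS.solve 4 (λ x j q c → let open KS in (x :* x :* x :* x :+ con (+ 27) :* (q :* (c :* c :* c :* c))) :*
        (j :* j :* j :* j) :=
         con (+ 1) :* (x :* j) :* (x :* j) :* (x :* j) :* (x :* j) :+ con (+ 27) :*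
           (q :* (c :* c :* c :* c) :* (j :* j :* j :* j))) K.refl x J X c)
      (K.+-congʳ (K.sym (K.trans (pad xJ _) (K.trans (pad xJ _) (K.trans (pad xJ _) (pad xJ _)))))))

  Uτ : (U₀ τ ≋ KS.ι (+ 9) ⊛ t) × (U₁ τ ≋ κ′) × (U₂ τ ≋ KS.ι (+ 3) ⊛ κ)
  Uτ = U-V _ _ _ τ-dissect

  Uτ² : (U₀ (τ ⊛ τ) ≋ KS.ι (+ 6) ⊛ t ⊕ KS.ι (+ 243) ⊛ (t ⊛ t)) × (U₁ (τ ⊛ τ) ≋ KS.ι (+ 27) ⊛ t ⊛ κ′) ×
    (U₂ (τ ⊛ τ) ≋ κ ⊛ (1ˢ ⊕ KS.ι (+ 81) ⊛ t))
  Uτ² = K.trans (proj₁ (U-* τ τ)) (K.trans (K.+-cong (K.*-cong U0 U0)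
    (K.*-congˡ (K.+-cong (K.*-cong U1 U2) (K.*-cong U2 U1))))
          (K.trans (KS.solve 5 (λ q c p j t → let open KS; k = c :* c :* c :* p :* (j :* j :* j :* j); k′ = c :* c :* (p :* p) :* (j :* j :* j :* j) in
              con (+ 9) :* t :* (con (+ 9) :* t) :+ q :* (k′ :* (con (+ 3) :* k) :+ con (+ 3) :* k :* k′) :=
              con (+ 81) :* (t :* t) :+ con (+ 6) :* (q :* (c :* c :* c :* c) :* (j :* j :* j :* j)) :*
                (c :* (p :* p :* p) :* (j :* j :* j :* j))) K.refl X c p J t)
            (K.trans (K.+-congˡ (K.*-congˡ c-p³-J⁴))
              (KS.solve 1 (λ t → let open KS in con (+ 81) :* (t :* t) :+ con (+ 6) :* t :*
                (con (+ 1) :+ con (+ 27) :* t) := con (+ 6) :* t :+ con (+ 243) :* (t :* t)) K.refl t))))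
      , K.trans (proj₁ (proj₂ (U-* τ τ))) (K.trans
        (K.+-cong (K.+-cong (K.*-cong U0 U1) (K.*-cong U1 U0)) (K.*-congˡ (K.*-cong U2 U2)))
          (KS.solve 4 (λ q c p j → let open KS; k = c :* c :* c :* p :* (j :* j :* j :* j); k′ = c :* c :* (p :* p) :* (j :* j :* j :* j); t = q :* (c :* c :* c :* c) :* (j :* j :* j :* j) in
              con (+ 9) :* t :* k′ :+ k′ :* (con (+ 9) :* t) :+ q :* (con (+ 3) :* k :* (con (+ 3) :* k)) := con
                (+ 27) :* t :* k′) K.refl X c p J))
      , K.trans (proj₂ (proj₂ (U-* τ τ))) (K.trans
        (K.+-cong (K.+-cong (K.*-cong U0 U2) (K.*-cong U1 U1)) (K.*-cong U2 U0))
          (K.trans (KS.solve 4 (λ c p j t → let open KS; k = c :* c :* c :* p :* (j :* j :* j :* j); k′ = c :* c :* (p :* p) :* (j :* j :* j :* j) in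
              con (+ 9) :* t :* (con (+ 3) :* k) :+ k′ :* k′ :+ con (+ 3) :* k :* (con (+ 9) :* t) := k :*
                (c :* (p :* p :* p) :* (j :* j :* j :* j) :+ con (+ 54) :* t)) K.refl c p J t)
            (K.*-congˡ (K.trans (K.+-congʳ c-p³-J⁴) (KS.solve 1
              (λ t → let open KS in con (+ 1) :+ con (+ 27) :* t :+ con (+ 54) :* t := con (+ 1) :+ con
              (+ 81) :* t) K.refl t)))))
    where
    U0 = proj₁ Uτ
    U1 = proj₁ (proj₂ Uτ)
    U2 = proj₂ (proj₂ Uτ)

-- Integer polynomials recording the dissections, evaluated by computation.

module Polys where

  Poly : Set
  Poly = List ℕ

  infixl 6 _⊞_
  infixl 7 _⊡_

  _⊞_ : Poly → Poly → Poly
  []       ⊞ bs       = bs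
  (a ∷ as) ⊞ []       = a ∷ as
  (a ∷ as) ⊞ (b ∷ bs) = a ℕ.+ b ∷ as ⊞ bs

  _⊡_ : ℕ → Poly → Poly
  n ⊡ []       = []
  n ⊡ (a ∷ as) = n ℕ.* a ∷ n ⊡ as

  timesT : Poly → Poly
  timesT as = 0 ∷ as

  -- (a , b , c) stands for a(T) + b(T) τ + c(T) τ², where T = t(q³) satisfies τ³ = T (1 + 9τ + 27τ²).
  Triple : Set
  Triple = Poly × Poly × Poly

  _⊞₃_ : Triple → Triple → Triple
  (a , b , c) ⊞₃ (a′ , b′ , c′) = a ⊞ a′ , b ⊞ b′ , c ⊞ c′

  _⊡₃_ : ℕ → Triple → Triple
  n ⊡₃ (a , b , c) = n ⊡ a , n ⊡ b , n ⊡ c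

  timesτ : Triple → Triple
  timesτ (a , b , c) = timesT c , a ⊞ 9 ⊡ timesT c , b ⊞ 27 ⊡ timesT c

  times1+9τ times1+9τ+27τ² timest : Triple → Triple
  times1+9τ x = x ⊞₃ (9 ⊡₃ timesτ x)
  times1+9τ+27τ² x = times1+9τ x ⊞₃ (27 ⊡₃ timesτ (timesτ x))
  timest x = timesτ (times1+9τ+27τ² x)

  substτ : Poly → Triple
  substτ []       = [] , [] , []
  substτ (a ∷ as) = (a ∷ [] , [] , []) ⊞₃ timest (substτ as)

  -- The constants are those of `Uτ` and `Uτ²`; the factors `κ′` and `κ` of classes 1 and 2 are left
  -- out. The polynomial variable changes meaning from t(q³) to t, as the `Uᵢ` undo q ↦ q³.
  part₀ part₁ part₂ : Triple → Poly
  part₀ (a , b , c) = a ⊞ 9 ⊡ timesT b ⊞ 6 ⊡ timesT c ⊞ 243 ⊡ timesT (timesT c)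
  part₁ (a , b , c) = b ⊞ 27 ⊡ timesT c
  part₂ (a , b , c) = 3 ⊡ b ⊞ c ⊞ 81 ⊡ timesT c

  -- The factors in front are the polynomials in τ found in `E⁻¹κ` and `X-cJE⁻¹κ`.
  expandI expandII : Poly → Triple
  expandI  Q = times1+9τ (times1+9τ+27τ² (substτ Q))
  expandII Q = times1+9τ (timest (substτ Q))

  multiple? : (m : ℕ) .{{_ : NonZero m}} → Poly → Bool
  multiple? m []       = true
  multiple? m (a ∷ as) = (a % m ≡ᵇ 0) ∧ multiple? m as

  -- The evaluated list is hidden behind an existential and kept abstract, since
  -- comparing power series during type checking would otherwise unfold it.
  Multiple : (m : ℕ) .{{_ : NonZero m}} → Poly → Set
  Multiple m P = ∃ λ Q → P ≡ Q × multiple? m Q ≡ true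

  abstract
    -- 27 is the 9 of 1 + 9τ times the 3 of U₂ τ = 3κ. The unprimed lists follow the classes 3n+2,
    -- 9n+8, 27n+17, 81n+71, 243n+152; the primed ones belong to 9n+5, 27n+26, 81n+44, 243n+233.
    list₁ : Multiple (3 ℕ.^ 3) (27 ∷ [])
    list₁ = _ , ≡.refl , ≡.refl

    list₂ : Multiple (3 ℕ.^ 7) (part₂ (expandI (proj₁ list₁)))
    list₂ = _ , ≡.refl , ≡.refl

    list₃ : Multiple (3 ℕ.^ 8) (part₂ (expandII (proj₁ list₂)))
    list₃ = _ , ≡.refl , ≡.refl

    list₄ : Multiple (3 ℕ.^ 12) (part₂ (expandI (proj₁ list₃)))
    list₄ = _ , ≡.refl , ≡.refl

    list₅ : Multiple (3 ℕ.^ 13) (part₂ (expandII (proj₁ list₄)))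
    list₅ = _ , ≡.refl , ≡.refl

    list₂′ : Multiple (3 ℕ.^ 5) (part₁ (expandI (proj₁ list₁)))
    list₂′ = _ , ≡.refl , ≡.refl

    list₃′ : Multiple (3 ℕ.^ 9) (part₀ (expandII (proj₁ list₂)))
    list₃′ = _ , ≡.refl , ≡.refl

    list₄′ : Multiple (3 ℕ.^ 10) (part₁ (expandI (proj₁ list₃)))
    list₄′ = _ , ≡.refl , ≡.refl

    list₅′ : Multiple (3 ℕ.^ 14) (part₀ (expandII (proj₁ list₄)))
    list₅′ = _ , ≡.refl , ≡.refl

-- Dissection of the generating function, level by level.

module Levels (R : Ring) (3-torsion-free : 3-TorsionFree R) where

  open Series R
  open Dissect R
  open Eta R
  open Jacobi R
  open Frobenius R 3-torsion-free
  open Tower R 3-torsion-free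
  open Polys
  open import Relation.Binary.Reasoning.Setoid K.setoid

  ⟦_⟧ : Poly → Seq → Seq
  ⟦ [] ⟧     w = 0ˢ
  ⟦ a ∷ as ⟧ w = ιK a ⊕ w ⊛ ⟦ as ⟧ w

  ιK-+ : ∀ m n → ιK (m ℕ.+ n) ≋ ιK m ⊕ ιK n
  ιK-+ m n = KS.ι-+ (+ m) (+ n)

  ιK-* : ∀ m n → ιK (m ℕ.* n) ≋ ιK m ⊛ ιK n
  ιK-* m n = K.trans (K.reflexive (≡.cong KS.ι (ℤₚ.pos-* m n))) (KS.ι-* (+ m) (+ n))

  ⟦⊞⟧ : ∀ as bs w → ⟦ as ⊞ bs ⟧ w ≋ ⟦ as ⟧ w ⊕ ⟦ bs ⟧ w
  ⟦⊞⟧ []       bs       w = K.sym (K.+-identityˡ _)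
  ⟦⊞⟧ (a ∷ as) []       w = K.sym (K.+-identityʳ _)
  ⟦⊞⟧ (a ∷ as) (b ∷ bs) w = K.trans (K.+-cong (ιK-+ a b) (K.*-congˡ (⟦⊞⟧ as bs w)))
    (KS.solve 5 (λ a b w f g → let open KS in (a :+ b) :+ w :* (f :+ g) := (a :+ w :* f) :+
      (b :+ w :* g)) K.refl _ _ w _ _)

  ⟦⊡⟧ : ∀ n as w → ⟦ n ⊡ as ⟧ w ≋ ιK n ⊛ ⟦ as ⟧ w
  ⟦⊡⟧ n []       w = K.sym (K.zeroʳ _)
  ⟦⊡⟧ n (a ∷ as) w = K.trans (K.+-cong (ιK-* n a) (K.*-congˡ (⟦⊡⟧ n as w)))
    (KS.solve 4 (λ n a w f → let open KS in n :* a :+ w :* (n :* f) := n :* (a :+ w :* f)) K.refl _ _ w _)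

  ⟦timesT⟧ : ∀ as w → ⟦ timesT as ⟧ w ≋ w ⊛ ⟦ as ⟧ w
  ⟦timesT⟧ as w = K.+-identityˡ _

  V-⟦⟧ : ∀ as w → V (⟦ as ⟧ w) ≋ ⟦ as ⟧ (V w)
  V-⟦⟧ []       w = V-0
  V-⟦⟧ (a ∷ as) w = K.trans (V-+ _ _) (K.+-cong (V-ι (+ a)) (K.trans (V-* _ _) (K.*-congˡ (V-⟦⟧ as w))))

  private
    T′ : Seq
    T′ = V t

  ⟦_⟧₃ : Triple → Seq
  ⟦ a , b , c ⟧₃ = ⟦ a ⟧ T′ ⊕ ⟦ b ⟧ T′ ⊛ τ ⊕ ⟦ c ⟧ T′ ⊛ (τ ⊛ τ)

  ⟦⊞₃⟧ : ∀ x x′ → ⟦ x ⊞₃ x′ ⟧₃ ≋ ⟦ x ⟧₃ ⊕ ⟦ x′ ⟧₃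
  ⟦⊞₃⟧ (a , b , c) (a′ , b′ , c′) = K.trans (K.+-cong (K.+-cong (⟦⊞⟧ a a′ T′) (K.*-congʳ (⟦⊞⟧ b b′ T′)))
    (K.*-congʳ (⟦⊞⟧ c c′ T′)))
    (KS.solve 7 (λ a b c a′ b′ c′ τ → let open KS in (a :+ a′) :+ (b :+ b′) :* τ :+ (c :+ c′) :* (τ :* τ) :=
      (a :+ b :* τ :+ c :* (τ :* τ)) :+ (a′ :+ b′ :* τ :+ c′ :* (τ :* τ))) K.refl _ _ _ _ _ _ τ)

  ⟦⊡₃⟧ : ∀ n x → ⟦ n ⊡₃ x ⟧₃ ≋ ιK n ⊛ ⟦ x ⟧₃
  ⟦⊡₃⟧ n (a , b , c) = K.trans (K.+-cong (K.+-cong (⟦⊡⟧ n a T′) (K.*-congʳ (⟦⊡⟧ n b T′))) (K.*-congʳ (⟦⊡⟧ n c T′)))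
    (KS.solve 5 (λ n a b c τ → let open KS in n :* a :+ n :* b :* τ :+ n :* c :* (τ :* τ) := n :*
      (a :+ b :* τ :+ c :* (τ :* τ))) K.refl _ _ _ _ τ)

  private
    ⊞-⊡T : ∀ n a c → ⟦ a ⊞ n ⊡ timesT c ⟧ T′ ≋ ⟦ a ⟧ T′ ⊕ ιK n ⊛ (T′ ⊛ ⟦ c ⟧ T′)
    ⊞-⊡T n a c = K.trans (⟦⊞⟧ a (n ⊡ timesT c) T′)
      (K.+-congˡ (K.trans (⟦⊡⟧ n (timesT c) T′) (K.*-congˡ (⟦timesT⟧ c T′))))

  ⟦timesτ⟧ : ∀ x → ⟦ timesτ x ⟧₃ ≋ τ ⊛ ⟦ x ⟧₃
  ⟦timesτ⟧ (a , b , c) = begin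
    ⟦ timesτ (a , b , c) ⟧₃
      ≈⟨ K.+-cong (K.+-cong (⟦timesT⟧ c T′) (K.*-congʳ (⊞-⊡T 9 a c))) (K.*-congʳ (⊞-⊡T 27 b c)) ⟩
    T′ ⊛ ⟦ c ⟧ T′ ⊕ (⟦ a ⟧ T′ ⊕ KS.ι (+ 9) ⊛ (T′ ⊛ ⟦ c ⟧ T′)) ⊛ τ ⊕ (⟦ b ⟧ T′ ⊕ KS.ι (+ 27) ⊛ (T′ ⊛ ⟦ c ⟧ T′)) ⊛
      (τ ⊛ τ)
      ≈⟨ KS.solve 5 (λ a b c t τ → let open KS in t :* c :+ (a :+ con (+ 9) :* (t :* c)) :* τ :+
        (b :+ con (+ 27) :* (t :* c)) :* (τ :* τ) :=
           τ :* (a :+ b :* τ) :+ c :* (t :* (con (+ 1) :+ con (+ 9) :* τ :+ con (+ 27) :* (τ :* τ)))) K.refl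
             (⟦ a ⟧ T′) (⟦ b ⟧ T′) (⟦ c ⟧ T′) T′ τ ⟩
    τ ⊛ (⟦ a ⟧ T′ ⊕ ⟦ b ⟧ T′ ⊛ τ) ⊕ ⟦ c ⟧ T′ ⊛ (T′ ⊛ (1ˢ ⊕ KS.ι (+ 9) ⊛ τ ⊕ KS.ι (+ 27) ⊛ (τ ⊛ τ)))
      ≈⟨ K.+-congˡ (K.*-congˡ (K.sym τ³)) ⟩
    τ ⊛ (⟦ a ⟧ T′ ⊕ ⟦ b ⟧ T′ ⊛ τ) ⊕ ⟦ c ⟧ T′ ⊛ (τ ⊛ τ ⊛ τ)
      ≈⟨ KS.solve 4 (λ a b c τ → let open KS in τ :* (a :+ b :* τ) :+ c :* (τ :* τ :* τ) := τ :*
        (a :+ b :* τ :+ c :* (τ :* τ))) K.refl (⟦ a ⟧ T′) (⟦ b ⟧ T′) (⟦ c ⟧ T′) τ ⟩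
    τ ⊛ ⟦ a , b , c ⟧₃ ∎

  private
    r s : Seq
    s = 1ˢ ⊕ KS.ι (+ 9) ⊛ τ
    r = 1ˢ ⊕ KS.ι (+ 9) ⊛ τ ⊕ KS.ι (+ 27) ⊛ (τ ⊛ τ)

  ⟦times1+9τ⟧ : ∀ x → ⟦ times1+9τ x ⟧₃ ≋ s ⊛ ⟦ x ⟧₃
  ⟦times1+9τ⟧ x = K.trans (⟦⊞₃⟧ x (9 ⊡₃ timesτ x))
    (K.trans (K.+-congˡ (K.trans (⟦⊡₃⟧ 9 (timesτ x)) (K.*-congˡ (⟦timesτ⟧ x))))
    (KS.solve 2 (λ τ f → let open KS in f :+ con (+ 9) :* (τ :* f) := (con (+ 1) :+ con (+ 9) :* τ) :* f) K.refl τ _))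

  ⟦times1+9τ+27τ²⟧ : ∀ x → ⟦ times1+9τ+27τ² x ⟧₃ ≋ r ⊛ ⟦ x ⟧₃
  ⟦times1+9τ+27τ²⟧ x = K.trans (⟦⊞₃⟧ (times1+9τ x) (27 ⊡₃ timesτ (timesτ x)))
    (K.trans (K.+-cong (⟦times1+9τ⟧ x) (K.trans (⟦⊡₃⟧ 27 (timesτ (timesτ x)))
      (K.*-congˡ (K.trans (⟦timesτ⟧ (timesτ x)) (K.*-congˡ (⟦timesτ⟧ x))))))
    (KS.solve 2 (λ τ f → let open KS in (con (+ 1) :+ con (+ 9) :* τ) :* f :+ con (+ 27) :* (τ :* (τ :* f)) :=
      (con (+ 1) :+ con (+ 9) :* τ :+ con (+ 27) :* (τ :* τ)) :* f) K.refl τ _))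

  ⟦timest⟧ : ∀ x → ⟦ timest x ⟧₃ ≋ t ⊛ ⟦ x ⟧₃
  ⟦timest⟧ x = K.trans (⟦timesτ⟧ (times1+9τ+27τ² x))
    (K.trans (K.*-congˡ (⟦times1+9τ+27τ²⟧ x)) (K.trans (K.sym (K.*-assoc τ r _)) (K.*-congʳ (K.sym t-τ))))

  ⟦substτ⟧ : ∀ Q → ⟦ substτ Q ⟧₃ ≋ ⟦ Q ⟧ t
  ⟦substτ⟧ []       = KS.solve 1 (λ τ → let open KS in con (+ 0) :+ con (+ 0) :* τ :+ con (+ 0) :* (τ :* τ) := con
    (+ 0)) K.refl τ
  ⟦substτ⟧ (a ∷ as) = K.trans (⟦⊞₃⟧ (a ∷ [] , [] , []) (timest (substτ as)))
    (K.+-cong (KS.solve 3 (λ a T τ → let open KS in a :+ T :* con (+ 0) :+ con (+ 0) :* τ :+ con (+ 0) :* (τ :* τ)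
      := a) K.refl (ιK a) T′ τ)
              (K.trans (⟦timest⟧ (substτ as)) (K.*-congˡ (⟦substτ⟧ as))))

  ⟦expandI⟧ : ∀ Q → ⟦ expandI Q ⟧₃ ≋ r ⊛ s ⊛ ⟦ Q ⟧ t
  ⟦expandI⟧ Q = K.trans (⟦times1+9τ⟧ (times1+9τ+27τ² (substτ Q)))
    (K.trans (K.*-congˡ (K.trans (⟦times1+9τ+27τ²⟧ (substτ Q)) (K.*-congˡ (⟦substτ⟧ Q))))
    (KS.solve 3 (λ r s f → let open KS in s :* (r :* f) := r :* s :* f) K.refl r s _))

  ⟦expandII⟧ : ∀ Q → ⟦ expandII Q ⟧₃ ≋ t ⊛ s ⊛ ⟦ Q ⟧ t
  ⟦expandII⟧ Q = K.trans (⟦times1+9τ⟧ (timest (substτ Q)))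
    (K.trans (K.*-congˡ (K.trans (⟦timest⟧ (substτ Q)) (K.*-congˡ (⟦substτ⟧ Q))))
    (KS.solve 3 (λ t s f → let open KS in s :* (t :* f) := t :* s :* f) K.refl t s _))

  private
    -- The coefficients are series in q³, so only τ and τ² have to be dissected.
    triple-dissect : ∀ a b c → ⟦ a , b , c ⟧₃ ≋
      V (⟦ part₀ (a , b , c) ⟧ t) ⊕ X ⊛ (V (κ′ ⊛ ⟦ part₁ (a , b , c) ⟧ t) ⊕ X ⊛ V (κ ⊛ ⟦ part₂ (a , b , c) ⟧ t))
    triple-dissect a b c = begin
      ⟦ a , b , c ⟧₃
        ≈⟨ K.+-cong (K.+-cong (K.sym (V-⟦⟧ a t)) (K.*-cong (K.sym (V-⟦⟧ b t)) (dissect τ)))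
          (K.*-cong (K.sym (V-⟦⟧ c t)) (dissect (τ ⊛ τ))) ⟩
      V A′ ⊕ V B′ ⊛ (V (U₀ τ) ⊕ X ⊛ (V (U₁ τ) ⊕ X ⊛ V (U₂ τ))) ⊕ V C′ ⊛
        (V (U₀ (τ ⊛ τ)) ⊕ X ⊛ (V (U₁ (τ ⊛ τ)) ⊕ X ⊛ V (U₂ (τ ⊛ τ))))
        ≈⟨ KS.solve 10 (λ a b c u₀ u₁ u₂ v₀ v₁ v₂ x → let open KS in
             a :+ b :* (u₀ :+ x :* (u₁ :+ x :* u₂)) :+ c :* (v₀ :+ x :* (v₁ :+ x :* v₂)) :=
             (a :+ b :* u₀ :+ c :* v₀) :+ x :* ((b :* u₁ :+ c :* v₁) :+ x :*
               (b :* u₂ :+ c :* v₂))) K.refl _ _ _ _ _ _ _ _ _ X ⟩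
      (V A′ ⊕ V B′ ⊛ V (U₀ τ) ⊕ V C′ ⊛ V (U₀ (τ ⊛ τ))) ⊕ X ⊛
        ((V B′ ⊛ V (U₁ τ) ⊕ V C′ ⊛ V (U₁ (τ ⊛ τ))) ⊕ X ⊛ (V B′ ⊛ V (U₂ τ) ⊕ V C′ ⊛ V (U₂ (τ ⊛ τ))))
        ≈⟨ K.+-cong (K.trans (K.+-cong (K.trans (K.+-congˡ (K.sym (V-* _ _))) (K.sym (V-+ _ _))) (K.sym (V-* _ _)))
          (K.sym (V-+ _ _)))
             (K.*-congˡ (K.+-cong (V2 _ _ _ _) (K.*-congˡ (V2 _ _ _ _)))) ⟩
      V (A′ ⊕ B′ ⊛ U₀ τ ⊕ C′ ⊛ U₀ (τ ⊛ τ)) ⊕ X ⊛ (V (B′ ⊛ U₁ τ ⊕ C′ ⊛ U₁ (τ ⊛ τ)) ⊕ X ⊛ V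
        (B′ ⊛ U₂ τ ⊕ C′ ⊛ U₂ (τ ⊛ τ)))
        ≈⟨ K.+-cong (V-cong p₀) (K.*-congˡ (K.+-cong (V-cong p₁) (K.*-congˡ (V-cong p₂)))) ⟩
      V (⟦ part₀ (a , b , c) ⟧ t) ⊕ X ⊛ (V (κ′ ⊛ ⟦ part₁ (a , b , c) ⟧ t) ⊕ X ⊛ V (κ ⊛ ⟦ part₂ (a , b , c) ⟧ t)) ∎
      where
      A′ B′ C′ : Seq
      A′ = ⟦ a ⟧ t
      B′ = ⟦ b ⟧ t
      C′ = ⟦ c ⟧ t
      V2 : ∀ f g h k → V f ⊛ V g ⊕ V h ⊛ V k ≋ V (f ⊛ g ⊕ h ⊛ k)
      V2 f g h k = K.trans (K.+-cong (K.sym (V-* _ _)) (K.sym (V-* _ _))) (K.sym (V-+ _ _))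
      ⊡T : ∀ n as → ⟦ n ⊡ timesT as ⟧ t ≋ ιK n ⊛ (t ⊛ ⟦ as ⟧ t)
      ⊡T n as = K.trans (⟦⊡⟧ n (timesT as) t) (K.*-congˡ (⟦timesT⟧ as t))
      p₀ : A′ ⊕ B′ ⊛ U₀ τ ⊕ C′ ⊛ U₀ (τ ⊛ τ) ≋ ⟦ part₀ (a , b , c) ⟧ t
      p₀ = K.trans (K.+-cong (K.+-congˡ (K.*-congˡ (proj₁ Uτ))) (K.*-congˡ (proj₁ Uτ²)))
        (K.trans (KS.solve 4 (λ a b c t → let open KS in a :+ b :* (con (+ 9) :* t) :+ c :*
          (con (+ 6) :* t :+ con (+ 243) :* (t :* t)) :=
            a :+ con (+ 9) :* (t :* b) :+ con (+ 6) :* (t :* c) :+ con (+ 243) :* (t :* (t :* c))) K.refl A′ B′ C′ t)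
          (K.sym (K.trans (⟦⊞⟧ (a ⊞ 9 ⊡ timesT b ⊞ 6 ⊡ timesT c) (243 ⊡ timesT (timesT c)) t)
            (K.+-cong (K.trans (⟦⊞⟧ (a ⊞ 9 ⊡ timesT b) (6 ⊡ timesT c) t)
              (K.+-cong (K.trans (⟦⊞⟧ a (9 ⊡ timesT b) t) (K.+-congˡ (⊡T 9 b))) (⊡T 6 c)))
              (K.trans (⊡T 243 (timesT c)) (K.*-congˡ (K.*-congˡ (⟦timesT⟧ c t))))))))
      p₁ : B′ ⊛ U₁ τ ⊕ C′ ⊛ U₁ (τ ⊛ τ) ≋ κ′ ⊛ ⟦ part₁ (a , b , c) ⟧ t
      p₁ = K.trans (K.+-cong (K.*-congˡ (proj₁ (proj₂ Uτ))) (K.*-congˡ (proj₁ (proj₂ Uτ²))))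
        (K.trans (KS.solve 4 (λ b c t k → let open KS in b :* k :+ c :* (con (+ 27) :* t :* k) := k :*
          (b :+ con (+ 27) :* (t :* c))) K.refl B′ C′ t κ′)
          (K.*-congˡ (K.sym (K.trans (⟦⊞⟧ b (27 ⊡ timesT c) t) (K.+-congˡ (⊡T 27 c))))))
      p₂ : B′ ⊛ U₂ τ ⊕ C′ ⊛ U₂ (τ ⊛ τ) ≋ κ ⊛ ⟦ part₂ (a , b , c) ⟧ t
      p₂ = K.trans (K.+-cong (K.*-congˡ (proj₂ (proj₂ Uτ))) (K.*-congˡ (proj₂ (proj₂ Uτ²))))
        (K.trans (KS.solve 4 (λ b c t k → let open KS in b :* (con (+ 3) :* k) :+ c :*
          (k :* (con (+ 1) :+ con (+ 81) :* t)) := k :*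
          (con (+ 3) :* b :+ c :+ con (+ 81) :* (t :* c))) K.refl B′ C′ t κ)
          (K.*-congˡ (K.sym (K.trans (⟦⊞⟧ (3 ⊡ b ⊞ c) (81 ⊡ timesT c) t)
            (K.+-cong (K.trans (⟦⊞⟧ (3 ⊡ b) c t) (K.+-congʳ (⟦⊡⟧ 3 b t))) (⊡T 81 c))))))

    U-triple : ∀ x → (U₀ ⟦ x ⟧₃ ≋ ⟦ part₀ x ⟧ t) × (U₁ ⟦ x ⟧₃ ≋ κ′ ⊛ ⟦ part₁ x ⟧ t) × (U₂ ⟦ x ⟧₃ ≋ κ ⊛ ⟦ part₂ x ⟧ t)
    U-triple (a , b , c) = U-V _ _ _ (triple-dissect a b c)

  -- E⁻¹ κ = E₃⁹ a(q) / E₁¹² and c J E⁻¹ κ = E₃¹² a(q) / E₁¹⁵, where a(q) = Σ q^(m² + mn + n²).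
  levelI levelII : Poly → Seq
  levelI  Q = E⁻¹ ⊛ κ ⊛ ⟦ Q ⟧ t
  levelII Q = c ⊛ J ⊛ E⁻¹ ⊛ κ ⊛ ⟦ Q ⟧ t

  private
    levelI-triple : ∀ Q → levelI Q ≋ V (c ⊛ J ⊛ E⁻¹) ⊛ ⟦ expandI Q ⟧₃
    levelI-triple Q = K.trans (K.*-congʳ E⁻¹κ) (K.trans (K.*-assoc _ _ _) (K.*-congˡ (K.sym (⟦expandI⟧ Q))))

    levelII-triple : ∀ Q → X ⊛ levelII Q ≋ V E⁻¹ ⊛ ⟦ expandII Q ⟧₃
    levelII-triple Q = K.trans (K.sym (K.*-assoc _ _ _))
      (K.trans (K.*-congʳ X-cJE⁻¹κ) (K.trans (K.*-assoc _ _ _) (K.*-congˡ (K.sym (⟦expandII⟧ Q)))))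

  -- `P` enters through an equation so that an evaluated, abstract list can stand for
  -- `part₁ (expandI Q)`.
  U₁-levelI : ∀ Q {P} → part₁ (expandI Q) ≡ P → U₁ (levelI Q) ≋ c ⊛ J ⊛ E⁻¹ ⊛ κ′ ⊛ ⟦ P ⟧ t
  U₁-levelI Q ≡.refl = K.trans (U₁-cong (levelI-triple Q)) (K.trans (proj₁ (proj₂ (U-V* _ _)))
    (K.trans (K.*-congˡ (proj₁ (proj₂ (U-triple (expandI Q))))) (K.sym (K.*-assoc _ _ _))))

  U₂-levelI : ∀ Q {P} → part₂ (expandI Q) ≡ P → U₂ (levelI Q) ≋ levelII P
  U₂-levelI Q ≡.refl = K.trans (U₂-cong (levelI-triple Q)) (K.trans (proj₂ (proj₂ (U-V* _ _)))
    (K.trans (K.*-congˡ (proj₂ (proj₂ (U-triple (expandI Q))))) (K.sym (K.*-assoc _ _ _))))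

  -- The known expansion is that of `X ⊛ levelII Q`, so class 1 is read off as class 2 of the
  -- shifted series.
  U₁-levelII : ∀ Q {P} → part₂ (expandII Q) ≡ P → U₁ (levelII Q) ≋ levelI P
  U₁-levelII Q ≡.refl = K.trans (K.sym (U₂-X (levelII Q)))
    (K.trans (U₂-cong (levelII-triple Q)) (K.trans (proj₂ (proj₂ (U-V* _ _)))
    (K.trans (K.*-congˡ (proj₂ (proj₂ (U-triple (expandII Q))))) (K.sym (K.*-assoc _ _ _)))))

  -- Class 2 becomes class 0 after the shift, where no `κ` occurs and the result keeps a factor `X`;
  -- `∣ˢ-X` removes it from divisibility statements.
  X-U₂-levelII : ∀ Q {P} → part₀ (expandII Q) ≡ P → X ⊛ U₂ (levelII Q) ≋ E⁻¹ ⊛ ⟦ P ⟧ t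
  X-U₂-levelII Q ≡.refl = K.trans (K.sym (U₀-X (levelII Q)))
    (K.trans (U₀-cong (levelII-triple Q)) (K.trans (proj₁ (U-V* _ _))
    (K.*-congˡ (proj₁ (U-triple (expandII Q))))))

  private
    frobenius-triple : frobenius ≋ V E⁻¹ ⊛ ⟦ 1 ∷ [] , 9 ∷ [] , [] ⟧₃
    frobenius-triple = K.trans frobenius-τ (K.*-congˡ
      (KS.solve 2 (λ T τ → let open KS in con (+ 1) :+ con (+ 9) :* τ := (con (+ 1) :+ T :* con (+ 0)) :+
        (con (+ 9) :+ T :* con (+ 0)) :* τ :+ con (+ 0) :* (τ :* τ)) K.refl T′ τ))

  U₁-frobenius : U₁ frobenius ≋ E⁻¹ ⊛ κ′ ⊛ ⟦ 9 ∷ [] ⟧ t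
  U₁-frobenius = K.trans (U₁-cong frobenius-triple)
    (K.trans (proj₁ (proj₂ (U-V* _ _))) (K.trans (K.*-congˡ (proj₁ (proj₂ (U-triple (1 ∷ [] , 9 ∷ [] , [])))))
    (K.sym (K.*-assoc _ _ _))))

  U₂-frobenius : ∀ {P} → 27 ∷ [] ≡ P → U₂ frobenius ≋ levelI P
  U₂-frobenius ≡.refl = K.trans (U₂-cong frobenius-triple)
    (K.trans (proj₂ (proj₂ (U-V* _ _))) (K.trans (K.*-congˡ (proj₂ (proj₂ (U-triple (1 ∷ [] , 9 ∷ [] , [])))))
    (K.sym (K.*-assoc _ _ _))))

  infix 4 _∣ˢ_
  record _∣ˢ_ (m : ℕ) (f : Seq) : Set where
    constructor factor
    field
      quotient : Seq
      equality : f ≋ ιK m ⊛ quotient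

  ∣ˢ-resp : ∀ {m f g} → f ≋ g → m ∣ˢ g → m ∣ˢ f
  ∣ˢ-resp p (factor h q) = factor h (K.trans p q)

  ∣ˢ-* : ∀ {m f} v → m ∣ˢ f → m ∣ˢ v ⊛ f
  ∣ˢ-* {m} {f} v (factor h q) = factor (v ⊛ h)
    (K.trans (K.*-congˡ q) (KS.solve 3 (λ v m h → let open KS in v :* (m :* h) := m :* (v :* h)) K.refl v (ιK m) h))

  multiple-∣ˢ : ∀ m .{{_ : NonZero m}} as → multiple? m as ≡ true → ∀ w → m ∣ˢ ⟦ as ⟧ w
  multiple-∣ˢ m []       p w = factor 0ˢ (K.sym (K.zeroʳ _))
  multiple-∣ˢ m (a ∷ as) p w with Equivalence.to T-∧ (Equivalence.from T-≡ p)
  ... | a%m≡0 , ps with multiple-∣ˢ m as (Equivalence.to T-≡ ps) w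
  ... | factor h q = factor (ιK (a / m) ⊕ w ⊛ h)
    (K.trans (K.+-cong (K.trans (K.reflexive (≡.cong ιK a≡)) (ιK-* m (a / m))) (K.*-congˡ q))
    (KS.solve 4 (λ m b w h → let open KS in m :* b :+ w :* (m :* h) := m :* (b :+ w :* h)) K.refl (ιK m)
      (ιK (a / m)) w h))
    where
    a≡ : a ≡ m ℕ.* (a / m)
    a≡ = ≡.trans (m≡m%n+[m/n]*n a m) (≡.trans (≡.cong (ℕ._+ a / m ℕ.* m) (ℕₚ.≡ᵇ⇒≡ (a % m) 0 a%m≡0))
      (ℕₚ.*-comm (a / m) m))

  ∣ˢ-at : ∀ {m f} → m ∣ˢ f → ∀ n → ∃ λ z → f n A.≈ Scalars.ι R (+ m) A.* z
  ∣ˢ-at {m} (factor h q) n = h n , A.trans (at q n) (ι-⊛ (+ m) h n)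

  ∣ˢ-X : ∀ {m f} → m ∣ˢ X ⊛ f → m ∣ˢ f
  ∣ˢ-X {m} {f} (factor h q) = factor (tail h) (ext λ n →
    A.trans (A.sym (at (X⊛ f) (suc n))) (A.trans (at q (suc n))
      (A.trans (ι-⊛ (+ m) h (suc n)) (A.sym (ι-⊛ (+ m) (tail h) n)))))

  -- The classes 3n+2, 9n+8, 27n+17, 81n+71, whose residues λ satisfy 8λ ≡ 1 modulo the power of 3;
  -- the operators follow the 3-adic digits 2, 2, 1, 2 of 1/8.
  f₁ f₂ f₃ f₄ : Seq
  f₁ = U₂ frobenius
  f₂ = U₂ f₁
  f₃ = U₁ f₂
  f₄ = U₂ f₃

  private
    Q₁ Q₂ Q₃ Q₄ : Poly
    Q₁ = proj₁ list₁
    Q₂ = proj₁ list₂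
    Q₃ = proj₁ list₃
    Q₄ = proj₁ list₄

    levelI-∣ˢ : ∀ m .{{_ : NonZero m}} Q → multiple? m Q ≡ true → m ∣ˢ levelI Q
    levelI-∣ˢ m Q p = ∣ˢ-* (E⁻¹ ⊛ κ) (multiple-∣ˢ m Q p t)

    levelII-∣ˢ : ∀ m .{{_ : NonZero m}} Q → multiple? m Q ≡ true → m ∣ˢ levelII Q
    levelII-∣ˢ m Q p = ∣ˢ-* (c ⊛ J ⊛ E⁻¹ ⊛ κ) (multiple-∣ˢ m Q p t)

    U₁-levelI-∣ˢ : ∀ m .{{_ : NonZero m}} Q → Multiple m (part₁ (expandI Q)) → m ∣ˢ U₁ (levelI Q)
    U₁-levelI-∣ˢ m Q (Q′ , eq , p) = ∣ˢ-resp (U₁-levelI Q eq) (∣ˢ-* (c ⊛ J ⊛ E⁻¹ ⊛ κ′) (multiple-∣ˢ m Q′ p t))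

    U₂-levelII-∣ˢ : ∀ m .{{_ : NonZero m}} Q → Multiple m (part₀ (expandII Q)) → m ∣ˢ U₂ (levelII Q)
    U₂-levelII-∣ˢ m Q (Q′ , eq , p) = ∣ˢ-X (∣ˢ-resp (X-U₂-levelII Q eq) (∣ˢ-* E⁻¹ (multiple-∣ˢ m Q′ p t)))

    f₁-level : f₁ ≋ levelI Q₁
    f₁-level = U₂-frobenius (proj₁ (proj₂ list₁))

    f₂-level : f₂ ≋ levelII Q₂
    f₂-level = K.trans (U₂-cong f₁-level) (U₂-levelI Q₁ (proj₁ (proj₂ list₂)))

    f₃-level : f₃ ≋ levelI Q₃
    f₃-level = K.trans (U₁-cong f₂-level) (U₁-levelII Q₂ (proj₁ (proj₂ list₃)))

    f₄-level : f₄ ≋ levelII Q₄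
    f₄-level = K.trans (U₂-cong f₃-level) (U₂-levelI Q₃ (proj₁ (proj₂ list₄)))

    f₅-level : U₁ f₄ ≋ levelI (proj₁ list₅)
    f₅-level = K.trans (U₁-cong f₄-level) (U₁-levelII Q₄ (proj₁ (proj₂ list₅)))

  3n+1 : 3 ℕ.^ 2 ∣ˢ U₁ frobenius
  3n+1 = ∣ˢ-resp U₁-frobenius (∣ˢ-* (E⁻¹ ⊛ κ′) (multiple-∣ˢ (3 ℕ.^ 2) (9 ∷ []) ≡.refl t))

  3n+2 : 3 ℕ.^ 3 ∣ˢ f₁
  3n+2 = ∣ˢ-resp f₁-level (levelI-∣ˢ (3 ℕ.^ 3) Q₁ (proj₂ (proj₂ list₁)))

  9n+5 : 3 ℕ.^ 5 ∣ˢ U₁ f₁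
  9n+5 = ∣ˢ-resp (U₁-cong f₁-level) (U₁-levelI-∣ˢ (3 ℕ.^ 5) Q₁ list₂′)

  9n+8 : 3 ℕ.^ 7 ∣ˢ f₂
  9n+8 = ∣ˢ-resp f₂-level (levelII-∣ˢ (3 ℕ.^ 7) Q₂ (proj₂ (proj₂ list₂)))

  27n+17 : 3 ℕ.^ 8 ∣ˢ f₃
  27n+17 = ∣ˢ-resp f₃-level (levelI-∣ˢ (3 ℕ.^ 8) Q₃ (proj₂ (proj₂ list₃)))

  27n+26 : 3 ℕ.^ 9 ∣ˢ U₂ f₂
  27n+26 = ∣ˢ-resp (U₂-cong f₂-level) (U₂-levelII-∣ˢ (3 ℕ.^ 9) Q₂ list₃′)

  81n+44 : 3 ℕ.^ 10 ∣ˢ U₁ f₃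
  81n+44 = ∣ˢ-resp (U₁-cong f₃-level) (U₁-levelI-∣ˢ (3 ℕ.^ 10) Q₃ list₄′)

  81n+71 : 3 ℕ.^ 12 ∣ˢ f₄
  81n+71 = ∣ˢ-resp f₄-level (levelII-∣ˢ (3 ℕ.^ 12) Q₄ (proj₂ (proj₂ list₄)))

  243n+152 : 3 ℕ.^ 13 ∣ˢ U₁ f₄
  243n+152 = ∣ˢ-resp f₅-level (levelI-∣ˢ (3 ℕ.^ 13) (proj₁ list₅) (proj₂ (proj₂ list₅)))

  243n+233 : 3 ℕ.^ 14 ∣ˢ U₂ f₄
  243n+233 = ∣ˢ-resp (U₂-cong f₄-level) (U₂-levelII-∣ˢ (3 ℕ.^ 14) Q₄ list₅′)

-- Specialization to the integers.

open import Data.Nat using (ℕ; _+_; _*_; _^_)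
open import Data.Nat.Divisibility using (_∣_)

private
  ℤ-ring : Ring
  ℤ-ring = ℤₚ.+-*-commutativeRing

  module S = Scalars ℤ-ring

  -- `ι` does not compute past 1, as its values there are abstract, so even over ℤ this takes an
  -- induction.
  ι-id : ∀ n → S.ι (+ n) ≡ + n
  ι-id zero    = ≡.refl
  ι-id (suc n) = ≡.trans (S.ι-suc n) (≡.cong (ℤ._+_ (+ 1)) (ι-id n))

  ℤ-3-torsion-free : 3-TorsionFree ℤ-ring
  ℤ-3-torsion-free x p with ℤₚ.i*j≡0⇒i≡0∨j≡0 (S.ι (+ 3)) p
  ... | inj₂ x≡0 = x≡0
  ... | inj₁ 3≡0 with () ← ≡.trans (≡.sym (ι-id 3)) 3≡0

open Dissect ℤ-ring
open Frobenius ℤ-ring ℤ-3-torsion-free using (frobenius)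
open Levels ℤ-ring ℤ-3-torsion-free

private
  record _Along_ (f : ℕ → ℤ) (i : ℕ → ℕ) : Set where
    constructor along
    field at : ∀ n → f n ≡ frobenius (i n)

  along₀ : frobenius Along (λ n → n)
  along₀ = along λ n → ≡.refl

  U₁-along : ∀ {f i} → f Along i → U₁ f Along (λ n → i (1 + n * 3))
  U₁-along (along p) = along λ n → ≡.trans (U₀-at _ n) (p _)

  U₂-along : ∀ {f i} → f Along i → U₂ f Along (λ n → i (2 + n * 3))
  U₂-along (along p) = along λ n → ≡.trans (U₀-at _ n) (p _)

  along₁ : f₁ Along _
  along₁ = U₂-along along₀

  along₂ : f₂ Along _
  along₂ = U₂-along along₁

  along₃ : f₃ Along _
  along₃ = U₁-along along₂

  along₄ : f₄ Along _
  along₄ = U₂-along along₃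

  -- Absolute values bring divisibility from ℤ down to ℕ; the last equation rewrites the nested
  -- index into the form of the theorem.
  ∣ˢ⇒∣ : ∀ {m f i} → m ∣ˢ f → f Along i → ∀ n k → i n ≡ k → m ∣ cφ 3 k
  ∣ˢ⇒∣ {m} {i = i} m∣f (along p) n k i≡k with ∣ˢ-at m∣f n
  ... | z , fn≡mz = ≡.subst (λ k → m ∣ cφ 3 k) i≡k
    (divides ℤ.∣ z ∣ (≡.trans (≡.cong ℤ.∣_∣ cφ≡mz) (≡.trans (ℤₚ.abs-* (+ m) z) (ℕₚ.*-comm m ℤ.∣ z ∣))))
    where
    cφ≡mz : + cφ 3 (i n) ≡ + m ℤ.* z
    cφ≡mz = ≡.trans (≡.sym (ι-id (cφ 3 (i n)))) (≡.trans (≡.sym (p n)) (≡.trans fn≡mz (≡.cong (ℤ._* z) (ι-id m))))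

theorem1p1 : (n : ℕ) →
    (3 ^ 2 ∣ cφ 3 (3 * n + 1))
    × (3 ^ 3 ∣ cφ 3 (3 * n + 2))
    × (3 ^ 5 ∣ cφ 3 (9 * n + 5))
    × (3 ^ 7 ∣ cφ 3 (9 * n + 8))
    × (3 ^ 8 ∣ cφ 3 (27 * n + 17))
    × (3 ^ 9 ∣ cφ 3 (27 * n + 26))
    × (3 ^ 10 ∣ cφ 3 (81 * n + 44))
    × (3 ^ 12 ∣ cφ 3 (81 * n + 71))
    × (3 ^ 13 ∣ cφ 3 (243 * n + 152))
    × (3 ^ 14 ∣ cφ 3 (243 * n + 233))
theorem1p1 n =
    ∣ˢ⇒∣ 3n+1 (U₁-along along₀) n (3 * n + 1)
      (solve 1 (λ n → con 1 :+ n :* con 3 := con 3 :* n :+ con 1) ≡.refl n)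
  , ∣ˢ⇒∣ 3n+2 along₁ n (3 * n + 2)
      (solve 1 (λ n → con 2 :+ n :* con 3 := con 3 :* n :+ con 2) ≡.refl n)
  , ∣ˢ⇒∣ 9n+5 (U₁-along along₁) n (9 * n + 5)
      (solve 1 (λ n → con 2 :+ (con 1 :+ n :* con 3) :* con 3 := con 9 :* n :+ con 5) ≡.refl n)
  , ∣ˢ⇒∣ 9n+8 along₂ n (9 * n + 8)
      (solve 1 (λ n → con 2 :+ (con 2 :+ n :* con 3) :* con 3 := con 9 :* n :+ con 8) ≡.refl n)
  , ∣ˢ⇒∣ 27n+17 along₃ n (27 * n + 17)
      (solve 1 (λ n → con 2 :+ (con 2 :+ (con 1 :+ n :* con 3) :* con 3) :* con 3 := con 27 :* n :+ con 17) ≡.refl n)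
  , ∣ˢ⇒∣ 27n+26 (U₂-along along₂) n (27 * n + 26)
      (solve 1 (λ n → con 2 :+ (con 2 :+ (con 2 :+ n :* con 3) :* con 3) :* con 3 := con 27 :* n :+ con 26) ≡.refl n)
  , ∣ˢ⇒∣ 81n+44 (U₁-along along₃) n (81 * n + 44)
      (solve 1 (λ n → con 2 :+ (con 2 :+ (con 1 :+ (con 1 :+ n :* con 3) :* con 3) :* con 3) :* con 3 := con 81 :* n
        :+ con 44) ≡.refl n)
  , ∣ˢ⇒∣ 81n+71 along₄ n (81 * n + 71)
      (solve 1 (λ n → con 2 :+ (con 2 :+ (con 1 :+ (con 2 :+ n :* con 3) :* con 3) :* con 3) :* con 3 := con 81 :* n
        :+ con 71) ≡.refl n)
  , ∣ˢ⇒∣ 243n+152 (U₁-along along₄) n (243 * n + 152)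
      (solve 1 (λ n → con 2 :+ (con 2 :+ (con 1 :+
        (con 2 :+ (con 1 :+ n :* con 3) :* con 3) :* con 3) :* con 3) :* con 3 := con 243 :* n :+ con 152) ≡.refl n)
  , ∣ˢ⇒∣ 243n+233 (U₂-along along₄) n (243 * n + 233)
      (solve 1 (λ n → con 2 :+ (con 2 :+ (con 1 :+
        (con 2 :+ (con 2 :+ n :* con 3) :* con 3) :* con 3) :* con 3) :* con 3 := con 243 :* n :+ con 233) ≡.refl n)
  where open +-*-Solver using (solve; con; _:=_; _:+_; _:*_)
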